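{- Let $k\ge 2$, let $\pi\in S_k$, let $A\subseteq\{1,\dots,k-1\}$, and let $j=k-|A|$ be the number of blocks of the vincular pattern $(\pi,A)$. For each $n$ let $\sigma_n$ be a uniformly random element of $S_n$ and let $X^{(\pi,A)}(\sigma_n)$ be the number of occurrences of $(\pi,A)$ in $\sigma_n$. Then there exists a constant $C>0$ such that $$\operatorname{Var}\bigl(X^{(\pi,A)}(\sigma_n)\bigr)\sim C\,n^{2j-1}\quad\text{as } n\to\infty,$$ i.e. $\lim_{n\to\infty}\operatorname{Var}(X^{(\pi,A)}(\sigma_n))/(Cn^{2j-1})=1$.
   Context: $S_n$ is the set of permutations of $\{1,\dots,n\}$, written in one-line notation $\sigma=\sigma_1\sigma_2\dots\sigma_n$. A vincular pattern of size $k$ is a pair $(\pi,A)$ with $\pi\in S_k$ and $A\subseteq\{1,\dots,k-1\}$; its number of blocks is $j=k-|A|$. An occurrence of $(\pi,A)$ in $\sigma\in S_n$ is a subsequence $\sigma_{i_1}\sigma_{i_2}\dots\sigma_{i_k}$ with $i_1<i_2<\dots<i_k$ (identified with its set of positions $\{i_1,\dots,i_k\}$) such that (i) for all $r,s\in\{1,\dots,k\}$, $\pi_r<\pi_s \iff \sigma_{i_r}<\sigma_{i_s}$; and (ii) $i_{a+1}=i_a+1$ for all $a\in A$. -}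

module Defs where

open import Data.Nat.Base as ℕ using (ℕ; zero; suc; pred; _∸_; _^_; _!)
import Data.Nat.Properties as ℕ
open import Data.Integer.Base as ℤ using (+_)
open import Data.Rational.Base as ℚ
  using (ℚ; 0ℚ; 1ℚ; ½; _+_; _*_; _-_; ∣_∣; _<_; _≤_; 1/_)
import Data.Rational.Properties as ℚ
open import Data.Rational.Solver using (module +-*-Solver)
open import Data.Fin.Base as Fin using (Fin; inject₁; toℕ)
import Data.Fin.Properties as Fin
open import Data.Fin.Permutation as Perm
  using (Permutation′; _⟨$⟩ʳ_; _≈_; insert; remove; insert-remove)
open import Data.Fin.Subset as Subset using (Subset; _∈_)
open import Data.Fin.Subset.Properties using (_∈?_)
open import Data.Vec.Base using (Vec; []; _∷_; lookup)
open import Data.List.Base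
  using (List; []; _∷_; [_]; map; foldr; length; filter; allFin; cartesianProductWith)
import Data.List.Properties as List
open import Data.List.Relation.Unary.Any using (here)
open import Data.List.Relation.Unary.All using ([])
import Data.List.Relation.Unary.AllPairs as AllPairs
import Data.List.Membership.Setoid as Membership
import Data.List.Membership.Setoid.Properties as Membership
import Data.List.Membership.Propositional.Properties as Membership≡
import Data.List.Relation.Unary.Unique.Setoid as Unique
import Data.List.Relation.Unary.Unique.Setoid.Properties as Unique
import Data.List.Relation.Unary.Unique.Propositional.Properties as Unique≡
open import Data.Product using (∃; _×_; _,_)
open import Data.Sum.Base using (inj₁; inj₂)
open import Function.Base using (_∘_)
open import Function.Bundles using (_⇔_; mk⇔; Equivalence)
open import Relation.Nullary.Decidable using (Dec; yes; no; map′; _×-dec_; _→-dec_)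
open import Relation.Nullary.Negation using (contradiction)
open import Relation.Unary using (Decidable)
open import Relation.Binary.Bundles using (Setoid)
open import Relation.Binary.PropositionalEquality
  using (_≡_; refl; sym; trans; cong; cong₂; subst; setoid)

------------------------------------------------------------------------
-- Vincular patterns

-- Positions and values are 0-based.  A set A ⊆ {1,…,k-1} of adjacencies is a
-- Subset (pred k); its member a : Fin (pred k) stands for the 1-based number
-- toℕ a + 1, so it constrains the a-th and the (a+1)-st letter counted from 0.

blocks : ∀ k → Subset (pred k) → ℕ
blocks k A = k ∸ Subset.∣ A ∣

left right : ∀ {k} → Fin (pred k) → Fin k
left  {suc k} = inject₁
right {suc k} = Fin.suc

module _ {k n : ℕ} (π : Permutation′ k) (A : Subset (pred k)) (σ : Permutation′ n) where

  -- A set of k positions is represented by its increasing listing.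
  IsOccurrence : Vec (Fin n) k → Set
  IsOccurrence i =
      (∀ r s → r Fin.< s → lookup i r Fin.< lookup i s)
    × (∀ r s → (π ⟨$⟩ʳ r) Fin.< (π ⟨$⟩ʳ s)
             ⇔ (σ ⟨$⟩ʳ lookup i r) Fin.< (σ ⟨$⟩ʳ lookup i s))
    × (∀ a → a ∈ A → toℕ (lookup i (right a)) ≡ suc (toℕ (lookup i (left a))))

  isOccurrence? : Decidable IsOccurrence
  isOccurrence? i =
      Fin.all? (λ r → Fin.all? (λ s → (r Fin.<? s) →-dec (lookup i r Fin.<? lookup i s)))
    ×-dec
      Fin.all? (λ r → Fin.all? (λ s →
        ((π ⟨$⟩ʳ r) Fin.<? (π ⟨$⟩ʳ s))
          ⇔-dec ((σ ⟨$⟩ʳ lookup i r) Fin.<? (σ ⟨$⟩ʳ lookup i s))))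
    ×-dec
      Fin.all? (λ a → (a ∈? A)
        →-dec (toℕ (lookup i (right a)) ℕ.≟ suc (toℕ (lookup i (left a)))))
    where
    _⇔-dec_ : ∀ {P Q : Set} → Dec P → Dec Q → Dec (P ⇔ Q)
    P? ⇔-dec Q? = map′ (λ (f , g) → mk⇔ f g)
                       (λ e → Equivalence.to e , Equivalence.from e)
                       ((P? →-dec Q?) ×-dec (Q? →-dec P?))

tuples : ∀ n k → List (Vec (Fin n) k)
tuples n zero    = [ [] ]
tuples n (suc k) = cartesianProductWith _∷_ (allFin n) (tuples n k)

occurrences : ∀ {k n} → Permutation′ k → Subset (pred k) → Permutation′ n → ℕ
occurrences {k} {n} π A σ = length (filter (isOccurrence? π A σ) (tuples n k))

------------------------------------------------------------------------
-- The uniform distribution on permutations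

-- insert 0 j π is the permutation with first letter j whose other letters are
-- order-isomorphic to π.
permutations : ∀ n → List (Permutation′ n)
permutations zero    = [ Perm.id ]
permutations (suc n) =
  cartesianProductWith (insert Fin.zero) (allFin (suc n)) (permutations n)

fromℕ : ℕ → ℚ
fromℕ m = + m ℚ./ 1

𝔼 : ∀ {n} → (Permutation′ n → ℚ) → ℚ
𝔼 {n} X = foldr _+_ 0ℚ (map X (permutations n)) * ((+ 1 ℚ./ n !) {{n ℕ.!≢0}})

Var : ∀ {n} → (Permutation′ n → ℕ) → ℚ
Var X = 𝔼 (λ σ → (fromℕ (X σ) - μ) * (fromℕ (X σ) - μ))
  where μ = 𝔼 (fromℕ ∘ X)

-- permutations n contains every permutation exactly once, up to the pointwise
-- equality _≈_, and has n ! entries.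

≈-setoid : ℕ → Setoid _ _
≈-setoid n = record
  { Carrier       = Permutation′ n
  ; _≈_           = _≈_
  ; isEquivalence = record
    { refl  = λ _ → refl
    ; sym   = λ p i → sym (p i)
    ; trans = λ p q i → trans (p i) (q i)
    }
  }

private
  insert-cong : ∀ {n} {i j : Fin (suc n)} {π ρ : Permutation′ n} →
                i ≡ j → π ≈ ρ → insert Fin.zero i π ≈ insert Fin.zero j ρ
  insert-cong             refl p Fin.zero    = refl
  insert-cong {i = i} refl p (Fin.suc l) = cong (Fin.punchIn i) (p l)

  insert-injective : ∀ {n} {i j : Fin (suc n)} {π ρ : Permutation′ n} →
                     insert Fin.zero i π ≈ insert Fin.zero j ρ → i ≡ j × π ≈ ρ
  insert-injective {i = i} {j} {π} {ρ} p with refl ← p Fin.zero =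
    refl , λ l → Fin.punchIn-injective i (π ⟨$⟩ʳ l) (ρ ⟨$⟩ʳ l) (p (Fin.suc l))

permutations-complete : ∀ n (σ : Permutation′ n) →
                        Membership._∈_ (≈-setoid n) σ (permutations n)
permutations-complete zero    σ = here λ ()
permutations-complete (suc n) σ =
  Membership.∈-resp-≈ (≈-setoid (suc n))
    {_} {insert Fin.zero (σ ⟨$⟩ʳ Fin.zero) (remove Fin.zero σ)} {σ} (insert-remove Fin.zero σ)
    (Membership.∈-cartesianProductWith⁺ (setoid _) (≈-setoid n) (≈-setoid (suc n))
      {f = insert Fin.zero} (λ {a} {b} {π} {ρ} → insert-cong {i = a} {b} {π} {ρ})
      (Membership≡.∈-allFin (σ ⟨$⟩ʳ Fin.zero))
      (permutations-complete n (remove Fin.zero σ)))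

permutations-unique : ∀ n → Unique.Unique (≈-setoid n) (permutations n)
permutations-unique zero    = [] AllPairs.∷ AllPairs.[]
permutations-unique (suc n) =
  Unique.cartesianProductWith⁺ (setoid _) (≈-setoid n) (≈-setoid (suc n))
    (insert Fin.zero) (λ {a} {b} {π} {ρ} → insert-injective {i = a} {b} {π} {ρ})
    (Unique≡.allFin⁺ (suc n)) (permutations-unique n)

length-permutations : ∀ n → length (permutations n) ≡ n !
length-permutations zero    = refl
length-permutations (suc n) = trans (length-product (allFin (suc n)))
  (cong₂ ℕ._*_ (List.length-tabulate {n = suc n} (λ i → i)) (length-permutations n))
  where
  length-product : ∀ is → length (cartesianProductWith (insert Fin.zero) is (permutations n))
                        ≡ length is ℕ.* length (permutations n)
  length-product []       = refl
  length-product (i ∷ is) = trans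
    (List.length-++ (map (insert Fin.zero i) (permutations n)))
    (cong₂ ℕ._+_ (List.length-map (insert Fin.zero i) (permutations n)) (length-product is))

------------------------------------------------------------------------
-- Real numbers as Cauchy sequences of rationals

Cauchy : (ℕ → ℚ) → Set
Cauchy x = ∀ ε → 0ℚ < ε →
  ∃ λ N → ∀ m n → N ℕ.≤ m → N ℕ.≤ n → ∣ x m - x n ∣ < ε

record ℝ : Set where
  field
    seq    : ℕ → ℚ
    cauchy : Cauchy seq

open ℝ public

private
  module S = +-*-Solver
  open S using (_:=_; _:+_; _:*_; _:-_; :-_; con)

  *-pos : ∀ {p q} → 0ℚ < p → 0ℚ < q → 0ℚ < p * q
  *-pos {p} {q} p>0 q>0 = ℚ.positive⁻¹ (p * q)
    {{ℚ.pos*pos⇒pos p {{ℚ.positive p>0}} q {{ℚ.positive q>0}}}}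

  *-monoʳ : ∀ {p q r} → 0ℚ ≤ r → p ≤ q → p * r ≤ q * r
  *-monoʳ {r = r} r≥0 = ℚ.*-monoʳ-≤-nonNeg r {{ℚ.nonNegative r≥0}}

  *-monoˡ : ∀ {p q r} → 0ℚ ≤ r → p ≤ q → r * p ≤ r * q
  *-monoˡ {r = r} r≥0 = ℚ.*-monoˡ-≤-nonNeg r {{ℚ.nonNegative r≥0}}

  *-mono : ∀ {p q r s} → 0ℚ ≤ r → 0ℚ ≤ q → p ≤ q → r ≤ s → p * r ≤ q * s
  *-mono r≥0 q≥0 p≤q r≤s = ℚ.≤-trans (*-monoʳ r≥0 p≤q) (*-monoˡ q≥0 r≤s)

  *-mono-< : ∀ {p q r} → 0ℚ < r → p < q → p * r < q * r
  *-mono-< {r = r} r>0 = ℚ.*-monoˡ-<-pos r {{ℚ.positive r>0}}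

  ½-pos : 0ℚ < ½
  ½-pos = ℚ.positive⁻¹ ½

  halves : ∀ ε → ½ * ε + ½ * ε ≡ ε
  halves = S.solve 1 (λ ε → con ½ :* ε :+ con ½ :* ε := ε) refl

  ∣-∣-swap : ∀ p q → ∣ p - q ∣ ≡ ∣ q - p ∣
  ∣-∣-swap p q = trans
    (cong ∣_∣ (S.solve 2 (λ p q → p :- q := :- (q :- p)) refl p q))
    (ℚ.∣-p∣≡∣p∣ (q - p))

  p≤∣p∣ : ∀ p → p ≤ ∣ p ∣
  p≤∣p∣ p with ℚ.≤-total 0ℚ p
  ... | inj₁ p≥0 = ℚ.≤-reflexive (sym (ℚ.0≤p⇒∣p∣≡p p≥0))
  ... | inj₂ p≤0 = ℚ.≤-trans p≤0 (ℚ.0≤∣p∣ p)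

  ∣p∣≤∣q∣+∣p-q∣ : ∀ p q → ∣ p ∣ ≤ ∣ q ∣ + ∣ p - q ∣
  ∣p∣≤∣q∣+∣p-q∣ p q = ℚ.≤-trans
    (ℚ.≤-reflexive (cong ∣_∣ (S.solve 2 (λ p q → p := q :+ (p :- q)) refl p q)))
    (ℚ.∣p+q∣≤∣p∣+∣q∣ q (p - q))

  ∣∣p∣-∣q∣∣≤∣p-q∣ : ∀ p q → ∣ ∣ p ∣ - ∣ q ∣ ∣ ≤ ∣ p - q ∣
  ∣∣p∣-∣q∣∣≤∣p-q∣ p q with ℚ.∣p∣≡p∨∣p∣≡-p (∣ p ∣ - ∣ q ∣)
  ... | inj₁ eq = ℚ.≤-trans (ℚ.≤-reflexive eq) (≤-move {∣ p ∣} (∣p∣≤∣q∣+∣p-q∣ p q))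
    where
    ≤-move : ∀ {a b c} → a ≤ b + c → a - b ≤ c
    ≤-move {a} {b} {c} a≤b+c = ℚ.≤-trans (ℚ.+-monoˡ-≤ (ℚ.- b) a≤b+c)
      (ℚ.≤-reflexive (S.solve 2 (λ b c → b :+ c :- b := c) refl b c))
  ... | inj₂ eq = ℚ.≤-trans (ℚ.≤-reflexive eq)
    (≤-move {∣ p ∣} (subst (λ d → ∣ q ∣ ≤ ∣ p ∣ + d) (∣-∣-swap q p) (∣p∣≤∣q∣+∣p-q∣ q p)))
    where
    ≤-move : ∀ {a b c} → b ≤ a + c → ℚ.- (a - b) ≤ c
    ≤-move {a} {b} {c} b≤a+c = ℚ.≤-trans
      (ℚ.≤-reflexive (S.solve 2 (λ a b → :- (a :- b) := b :- a) refl a b))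
      (ℚ.≤-trans (ℚ.+-monoˡ-≤ (ℚ.- a) b≤a+c)
        (ℚ.≤-reflexive (S.solve 2 (λ a c → a :+ c :- a := c) refl a c)))

fromℚ : ℚ → ℝ
fromℚ q .seq    _     = q
fromℚ q .cauchy ε ε>0 = 0 , λ _ _ _ _ →
  subst (_< ε) (sym (cong ∣_∣ (ℚ.+-inverseʳ q))) ε>0

0ℝ 1ℝ : ℝ
0ℝ = fromℚ 0ℚ
1ℝ = fromℚ 1ℚ

infix  4 _<ℝ_
infixl 6 _-ℝ_
infixl 7 _*ℝ_

_<ℝ_ : ℝ → ℝ → Set
x <ℝ y = ∃ λ ε → 0ℚ < ε × ∃ λ N → ∀ n → N ℕ.≤ n → seq x n + ε ≤ seq y n

_-ℝ_ : ℝ → ℝ → ℝ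
(x -ℝ y) .seq    n     = seq x n - seq y n
(x -ℝ y) .cauchy ε ε>0 =
  let M , hx = cauchy x (½ * ε) (*-pos ½-pos ε>0)
      N , hy = cauchy y (½ * ε) (*-pos ½-pos ε>0)
  in M ℕ.⊔ N , λ m n m≥ n≥ →
     let a = seq x m ; b = seq x n ; c = seq y m ; d = seq y n in
     begin-strict
       ∣ (a - c) - (b - d) ∣
         ≡⟨ cong ∣_∣ (S.solve 4 (λ a b c d →
              (a :- c) :- (b :- d) := (a :- b) :- (c :- d)) refl a b c d) ⟩
       ∣ (a - b) - (c - d) ∣
         ≤⟨ ℚ.∣p-q∣≤∣p∣+∣q∣ (a - b) (c - d) ⟩
       ∣ a - b ∣ + ∣ c - d ∣
         <⟨ ℚ.+-mono-< (hx m n (ℕ.m⊔n≤o⇒m≤o M N m≥) (ℕ.m⊔n≤o⇒m≤o M N n≥))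
                       (hy m n (ℕ.m⊔n≤o⇒n≤o M N m≥) (ℕ.m⊔n≤o⇒n≤o M N n≥)) ⟩
       ½ * ε + ½ * ε
         ≡⟨ halves ε ⟩
       ε ∎
  where open ℚ.≤-Reasoning

∣_∣ℝ : ℝ → ℝ
∣ x ∣ℝ .seq    n     = ∣ seq x n ∣
∣ x ∣ℝ .cauchy ε ε>0 =
  let N , h = cauchy x ε ε>0
  in N , λ m n m≥ n≥ →
     ℚ.≤-<-trans (∣∣p∣-∣q∣∣≤∣p-q∣ (seq x m) (seq x n)) (h m n m≥ n≥)

private
  bounded : ∀ x → ∃ λ B → 0ℚ < B × ∃ λ N → ∀ n → N ℕ.≤ n → ∣ seq x n ∣ ≤ B
  bounded x =
    let N , h = cauchy x 1ℚ (ℚ.positive⁻¹ 1ℚ)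
        b     = ∣ seq x N ∣
    in b + 1ℚ
     , ℚ.<-≤-trans (ℚ.positive⁻¹ 1ℚ)
         (ℚ.≤-trans (ℚ.≤-reflexive (sym (ℚ.+-identityˡ 1ℚ)))
                    (ℚ.+-monoˡ-≤ 1ℚ (ℚ.0≤∣p∣ (seq x N))))
     , N
     , λ n n≥ → ℚ.≤-trans (∣p∣≤∣q∣+∣p-q∣ (seq x n) (seq x N))
         (ℚ.+-monoʳ-≤ b (ℚ.<⇒≤ (h n N n≥ ℕ.≤-refl)))

-- The multiplicative inverse, extended by inv 0 = 0.
inv : ℚ → ℚ
inv q with q ℚ.≟ 0ℚ
... | yes _  = 0ℚ
... | no q≢0 = (1/ q) {{ℚ.≢-nonZero q≢0}}

inv-inverseʳ : ∀ {q} → 0ℚ < q → q * inv q ≡ 1ℚ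
inv-inverseʳ {q} q>0 with q ℚ.≟ 0ℚ
... | yes q≡0 = contradiction (sym q≡0) (ℚ.<⇒≢ q>0)
... | no q≢0  = ℚ.*-inverseʳ q {{ℚ.≢-nonZero q≢0}}

inv-pos : ∀ {q} → 0ℚ < q → 0ℚ < inv q
inv-pos {q} q>0 with q ℚ.≟ 0ℚ
... | yes q≡0 = contradiction (sym q≡0) (ℚ.<⇒≢ q>0)
... | no q≢0  = ℚ.positive⁻¹ _ {{ℚ.1/pos⇒pos q {{ℚ.positive q>0}}}}

_*ℝ_ : ℝ → ℝ → ℝ
(x *ℝ y) .seq    n     = seq x n * seq y n
(x *ℝ y) .cauchy ε ε>0 =
  let B , B>0 , M₁ , hB = bounded x
      C , C>0 , M₂ , hC = bounded y
      M₃ , hx = cauchy x (½ * ε * inv C) (*-pos (*-pos ½-pos ε>0) (inv-pos C>0))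
      M₄ , hy = cauchy y (½ * ε * inv B) (*-pos (*-pos ½-pos ε>0) (inv-pos B>0))
      M = M₁ ℕ.⊔ M₂
      N = M₃ ℕ.⊔ M₄
      split : ∀ {n} → M ℕ.⊔ N ℕ.≤ n → (M₁ ℕ.≤ n × M₂ ℕ.≤ n) × (M₃ ℕ.≤ n × M₄ ℕ.≤ n)
      split n≥ =
        let m = ℕ.m⊔n≤o⇒m≤o M N n≥ ; n = ℕ.m⊔n≤o⇒n≤o M N n≥
        in (ℕ.m⊔n≤o⇒m≤o M₁ M₂ m , ℕ.m⊔n≤o⇒n≤o M₁ M₂ m)
         , (ℕ.m⊔n≤o⇒m≤o M₃ M₄ n , ℕ.m⊔n≤o⇒n≤o M₃ M₄ n)
  in M ℕ.⊔ N , λ m n m≥ n≥ →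
     let (m≥₁ , _)   , (m≥₃ , m≥₄) = split m≥
         (_   , n≥₂) , (n≥₃ , n≥₄) = split n≥
         a = seq x m ; b = seq x n ; c = seq y m ; d = seq y n
     in begin-strict
       ∣ a * c - b * d ∣
         ≡⟨ cong ∣_∣ (S.solve 4 (λ a b c d →
              a :* c :- b :* d := (c :- d) :* a :+ (a :- b) :* d) refl a b c d) ⟩
       ∣ (c - d) * a + (a - b) * d ∣
         ≤⟨ ℚ.∣p+q∣≤∣p∣+∣q∣ ((c - d) * a) ((a - b) * d) ⟩
       ∣ (c - d) * a ∣ + ∣ (a - b) * d ∣
         ≡⟨ cong₂ _+_ (ℚ.∣p*q∣≡∣p∣*∣q∣ (c - d) a) (ℚ.∣p*q∣≡∣p∣*∣q∣ (a - b) d) ⟩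
       ∣ c - d ∣ * ∣ a ∣ + ∣ a - b ∣ * ∣ d ∣
         ≤⟨ ℚ.+-mono-≤ (*-monoˡ (ℚ.0≤∣p∣ (c - d)) (hB m m≥₁))
                       (*-monoˡ (ℚ.0≤∣p∣ (a - b)) (hC n n≥₂)) ⟩
       ∣ c - d ∣ * B + ∣ a - b ∣ * C
         <⟨ ℚ.+-mono-< (*-mono-< B>0 (hy m n m≥₄ n≥₄)) (*-mono-< C>0 (hx m n m≥₃ n≥₃)) ⟩
       ½ * ε * inv B * B + ½ * ε * inv C * C
         ≡⟨ cong₂ _+_ (cancel B>0) (cancel C>0) ⟩
       ½ * ε + ½ * ε
         ≡⟨ halves ε ⟩
       ε ∎
  where
  open ℚ.≤-Reasoning
  cancel : ∀ {B} → 0ℚ < B → ½ * ε * inv B * B ≡ ½ * ε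
  cancel {B} B>0 = trans
    (S.solve 3 (λ e i b → e :* i :* b := e :* (b :* i)) refl (½ * ε) (inv B) B)
    (trans (cong (½ * ε *_) (inv-inverseʳ B>0)) (ℚ.*-identityʳ (½ * ε)))

private
  inv-anti : ∀ {p q} → 0ℚ < p → p ≤ q → inv q ≤ inv p
  inv-anti {p} {q} p>0 p≤q = begin
    inv q
      ≡⟨ ℚ.*-identityʳ (inv q) ⟨
    inv q * 1ℚ
      ≡⟨ cong (inv q *_) (inv-inverseʳ p>0) ⟨
    inv q * (p * inv p)
      ≤⟨ *-monoˡ (ℚ.<⇒≤ (inv-pos q>0)) (*-monoʳ (ℚ.<⇒≤ (inv-pos p>0)) p≤q) ⟩
    inv q * (q * inv p)
      ≡⟨ S.solve 3 (λ i q j → i :* (q :* j) := q :* i :* j) refl (inv q) q (inv p) ⟩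
    q * inv q * inv p
      ≡⟨ cong (_* inv p) (inv-inverseʳ q>0) ⟩
    1ℚ * inv p
      ≡⟨ ℚ.*-identityˡ (inv p) ⟩
    inv p ∎
    where
    open ℚ.≤-Reasoning
    q>0 = ℚ.<-≤-trans p>0 p≤q

  -- 1/p − 1/q = (q − p)/(pq), with p, q ≥ δ.
  inv-lipschitz : ∀ {δ p q} → 0ℚ < δ → δ ≤ p → δ ≤ q →
                  ∣ inv p - inv q ∣ ≤ ∣ p - q ∣ * (inv δ * inv δ)
  inv-lipschitz {δ} {p} {q} δ>0 δ≤p δ≤q = begin
    ∣ i - j ∣
      ≡⟨ cong ∣_∣ (cong₂ _-_ (ℚ.*-identityʳ i) (ℚ.*-identityʳ j)) ⟨
    ∣ i * 1ℚ - j * 1ℚ ∣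
      ≡⟨ cong ∣_∣ (cong₂ (λ u v → i * u - j * v) (inv-inverseʳ q>0) (inv-inverseʳ p>0)) ⟨
    ∣ i * (q * j) - j * (p * i) ∣
      ≡⟨ cong ∣_∣ (S.solve 4 (λ i j p q →
           i :* (q :* j) :- j :* (p :* i) := (q :- p) :* (i :* j)) refl i j p q) ⟩
    ∣ (q - p) * (i * j) ∣
      ≡⟨ ℚ.∣p*q∣≡∣p∣*∣q∣ (q - p) (i * j) ⟩
    ∣ q - p ∣ * ∣ i * j ∣
      ≡⟨ cong₂ _*_ (∣-∣-swap q p) (ℚ.0≤p⇒∣p∣≡p (ℚ.<⇒≤ (*-pos (inv-pos p>0) (inv-pos q>0)))) ⟩
    ∣ p - q ∣ * (i * j)
      ≤⟨ *-monoˡ (ℚ.0≤∣p∣ (p - q))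
           (*-mono (ℚ.<⇒≤ (inv-pos q>0)) (ℚ.<⇒≤ (inv-pos δ>0))
                   (inv-anti δ>0 δ≤p) (inv-anti δ>0 δ≤q)) ⟩
    ∣ p - q ∣ * (inv δ * inv δ) ∎
    where
    open ℚ.≤-Reasoning
    i = inv p
    j = inv q
    p>0 = ℚ.<-≤-trans δ>0 δ≤p
    q>0 = ℚ.<-≤-trans δ>0 δ≤q

-- Since y is positive, only finitely many terms of y can be 0, so the value
-- of inv at 0 does not matter.
recip : (y : ℝ) → 0ℝ <ℝ y → ℝ
recip y y>0 .seq n = inv (seq y n)
recip y (δ , δ>0 , M , y≥δ) .cauchy ε ε>0 =
  let N , h = cauchy y (ε * (δ * δ)) (*-pos ε>0 (*-pos δ>0 δ>0))
  in M ℕ.⊔ N , λ m n m≥ n≥ → begin-strict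
       ∣ inv (seq y m) - inv (seq y n) ∣
         ≤⟨ inv-lipschitz δ>0 (lower m (ℕ.m⊔n≤o⇒m≤o M N m≥))
                              (lower n (ℕ.m⊔n≤o⇒m≤o M N n≥)) ⟩
       ∣ seq y m - seq y n ∣ * (inv δ * inv δ)
         <⟨ *-mono-< (*-pos (inv-pos δ>0) (inv-pos δ>0))
              (h m n (ℕ.m⊔n≤o⇒n≤o M N m≥) (ℕ.m⊔n≤o⇒n≤o M N n≥)) ⟩
       ε * (δ * δ) * (inv δ * inv δ)
         ≡⟨ S.solve 3 (λ e d i → e :* (d :* d) :* (i :* i) := e :* ((d :* i) :* (d :* i)))
              refl ε δ (inv δ) ⟩
       ε * ((δ * inv δ) * (δ * inv δ))
         ≡⟨ cong (λ u → ε * (u * u)) (inv-inverseʳ δ>0) ⟩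
       ε * (1ℚ * 1ℚ)
         ≡⟨ ℚ.*-identityʳ ε ⟩
       ε ∎
  where
  open ℚ.≤-Reasoning
  lower : ∀ n → M ℕ.≤ n → δ ≤ seq y n
  lower n n≥ = subst (_≤ seq y n) (ℚ.+-identityˡ δ) (y≥δ n n≥)

_÷ℝ_⟨_⟩ : ℝ → (y : ℝ) → 0ℝ <ℝ y → ℝ
x ÷ℝ y ⟨ y>0 ⟩ = x *ℝ recip y y>0

*ℝ-pos : ∀ x y → 0ℝ <ℝ x → 0ℝ <ℝ y → 0ℝ <ℝ x *ℝ y
*ℝ-pos x y (δ , δ>0 , M , x≥δ) (ε , ε>0 , N , y≥ε) =
  δ * ε , *-pos δ>0 ε>0 , M ℕ.⊔ N , λ n n≥ →
    let x≥ = subst (_≤ seq x n) (ℚ.+-identityˡ δ) (x≥δ n (ℕ.m⊔n≤o⇒m≤o M N n≥))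
        y≥ = subst (_≤ seq y n) (ℚ.+-identityˡ ε) (y≥ε n (ℕ.m⊔n≤o⇒n≤o M N n≥))
    in ℚ.≤-trans (ℚ.≤-reflexive (ℚ.+-identityˡ (δ * ε)))
         (*-mono (ℚ.<⇒≤ ε>0) (ℚ.≤-trans (ℚ.<⇒≤ δ>0) x≥) x≥ y≥)

pow : ℕ → ℕ → ℝ
pow n p = fromℚ (fromℕ (n ^ p))

pow-pos : ∀ n .{{_ : ℕ.NonZero n}} p → 0ℝ <ℝ pow n p
pow-pos n p =
    fromℕ (n ^ p)
  , ℚ.positive⁻¹ _ {{ℚ.normalize-pos (n ^ p) 1 {{_}} {{ℕ.m^n≢0 n p}}}}
  , 0
  , λ _ _ → ℚ.≤-reflexive (ℚ.+-identityˡ (fromℕ (n ^ p)))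

-- Sequences are indexed by n ≥ 1, so that a quotient by a power of n makes sense.
infix 4 _⟶_
_⟶_ : ((n : ℕ) → .{{ℕ.NonZero n}} → ℝ) → ℝ → Set
x ⟶ L = ∀ ε → 0ℝ <ℝ ε →
  ∃ λ N → ∀ n → .{{_ : ℕ.NonZero n}} → N ℕ.≤ n → ∣ x n -ℝ L ∣ℝ <ℝ ε

{-# OPTIONS --safe #-}
-- The variance of the number X of occurrences is the sum of cov (χ I) (χ J) over pairs of
-- admissible position sets I, J, where χ I indicates the pattern at I.  The covariance depends only on the
-- relative order of I and J and vanishes for disjoint I, J, so for large n the variance
-- is a polynomial in n of degree at most 2j - 1.  It remains to exclude that it is
-- O(n^(2j-2)).
--
-- For j = 1 the successive differences of the variance are bounded below by
-- 1/k! - (2k-1)/k!² > 0 if k > 2, and by 1/12 if k = 2.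
--
-- For j ≥ 2 let Y be the number of letters smaller than qn among the first m, where q is
-- a small constant.  Then Var Y ≤ m.  An occurrence at I is, to first order in q,
-- correlated with its letters as if only its minimum could be smaller than qn.  Most
-- occurrences that meet the first m positions do so in their first block only; as this
-- is not the whole pattern, the correlations of its letters do not cancel and
-- ∣ cov X Y ∣ is of order m n^(j-1).  By Cauchy-Schwarz Var X ≥ c m n^(2j-2) for large n,
-- with c independent of m.
module Submission where

open import Defs
open import Data.Bool.Base using (Bool; true; false)
open import Data.Nat.Base as ℕ using (ℕ; zero; suc; pred; _∸_; _^_; _!)
import Data.Nat.Properties as ℕ
import Data.Integer.Base as ℤ
import Data.Integer.Properties as ℤ
open import Data.Rational.Base as ℚ
  using (ℚ; 0ℚ; 1ℚ; ½; _+_; _*_; _-_; -_; ∣_∣; _<_; _≤_)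
import Data.Rational.Properties as ℚ
import Data.Rational.Unnormalised.Base as ℚᵘ
import Data.Rational.Unnormalised.Properties as ℚᵘ
open import Data.Rational.Solver using (module +-*-Solver)
open import Data.Fin.Base as Fin using (Fin; toℕ; punchIn; punchOut)
import Data.Fin.Properties as Fin
open import Data.Fin.Permutation as Perm
  using (Permutation′; _⟨$⟩ʳ_; _⟨$⟩ˡ_; _≈_; _∘ₚ_; insert; remove; transpose)
open import Data.Fin.Permutation.Transposition.List using (eval; decompose; eval-decompose)
open import Data.Fin.Subset as Subset using (Subset)
open import Data.Vec.Base as Vec using (Vec; []; _∷_; lookup)
import Data.Vec.Properties as Vec
open import Data.List.Base
  using (List; []; _∷_; map; foldr; length; filter; allFin; cartesianProductWith; _++_)
import Data.List.Properties as List
open import Data.List.Relation.Unary.All as All using (All; []; _∷_)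
import Data.List.Relation.Unary.All.Properties as All
open import Data.Product using (∃; Σ-syntax; _×_; _,_; proj₁; proj₂)
open import Data.Sum.Base using (_⊎_; inj₁; inj₂)
open import Data.Empty using (⊥)
open import Data.Unit.Base using (⊤; tt)
open import Function.Base using (_∘_; id)
open import Function.Bundles using (_⇔_; mk⇔; Equivalence)
open import Relation.Nullary.Decidable using (Dec; yes; no; _×-dec_; _→-dec_; map′; dec-true; dec-false)
open import Relation.Nullary.Negation using (¬_; contradiction)
open import Relation.Binary.PropositionalEquality
  using (_≡_; _≢_; refl; sym; trans; cong; cong₂; subst; subst₂; module ≡-Reasoning)
open import Relation.Unary using (Decidable)

-- The leading coefficient is never computed. If it were not positive, an eventually polynomial
-- variance would be at most K n^(2j-2), so it suffices to refute every such bound. This is done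
-- along the multiples n of a fixed integer `D`, for which q n with q = 1/`D` is an integer.
--
-- For j ≥ 2 and a pattern of size k, the covariance of an occurrence with the smallness of its
-- letter in role r is (q/k!)(k [r is the minimum] - 1), up to an error of at most k q². Over a
-- block of c letters the main terms sum to (q/k!)(k - c) if the block contains the minimum, and to
-- -(q/k!) c otherwise; for c < k neither is zero, but the sign depends on the pattern. For c = k
-- the covariances cancel exactly, because the number of small letters at given positions is
-- independent of their pattern. Hence consecutive patterns need a different argument.
--
-- The window length m is the free parameter: it is chosen after the constant K to be refuted, and n
-- after m.

module S = +-*-Solver
open S using (_:=_; _:+_; _:*_; _:-_; :-_; con)

private
  variable
    I J : Set
    P Q : Set
    m n k l : ℕ

-- Linear arithmetic over ℚ

≤-by : ∀ {p q} d → 0ℚ ≤ d → p + d ≡ q → p ≤ q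
≤-by {p} d d≥0 refl = ℚ.≤-trans (ℚ.≤-reflexive (sym (ℚ.+-identityʳ p))) (ℚ.+-monoʳ-≤ p d≥0)

0≤-diff : ∀ {p q} → p ≤ q → 0ℚ ≤ q - p
0≤-diff {p} {q} p≤q = ℚ.≤-trans (ℚ.≤-reflexive (sym (ℚ.+-inverseʳ p))) (ℚ.+-monoˡ-≤ (- p) p≤q)

0<-diff : ∀ {p q} → p < q → 0ℚ < q - p
0<-diff {p} {q} p<q = ℚ.≤-<-trans (ℚ.≤-reflexive (sym (ℚ.+-inverseʳ p))) (ℚ.+-monoˡ-< (- p) p<q)

+-nonNeg : ∀ {p q} → 0ℚ ≤ p → 0ℚ ≤ q → 0ℚ ≤ p + q
+-nonNeg = ℚ.+-mono-≤ {0ℚ} {_} {0ℚ}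

*-nonNeg : ∀ {p q} → 0ℚ ≤ p → 0ℚ ≤ q → 0ℚ ≤ p * q
*-nonNeg {p} {q} p≥0 q≥0 = ℚ.nonNegative⁻¹ (p * q)
  {{ℚ.nonNeg*nonNeg⇒nonNeg p {{ℚ.nonNegative p≥0}} q {{ℚ.nonNegative q≥0}}}}

*-pos : ∀ {p q} → 0ℚ < p → 0ℚ < q → 0ℚ < p * q
*-pos {p} {q} p>0 q>0 = ℚ.positive⁻¹ (p * q)
  {{ℚ.pos*pos⇒pos p {{ℚ.positive p>0}} q {{ℚ.positive q>0}}}}

*-monoˡ : ∀ {p q} r → 0ℚ ≤ r → p ≤ q → r * p ≤ r * q
*-monoˡ r r≥0 = ℚ.*-monoˡ-≤-nonNeg r {{ℚ.nonNegative r≥0}}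

*-monoʳ : ∀ {p q} r → 0ℚ ≤ r → p ≤ q → p * r ≤ q * r
*-monoʳ r r≥0 = ℚ.*-monoʳ-≤-nonNeg r {{ℚ.nonNegative r≥0}}

*-mono : ∀ {p q r s} → 0ℚ ≤ r → 0ℚ ≤ q → p ≤ q → r ≤ s → p * r ≤ q * s
*-mono {p} {q} {r} r≥0 q≥0 p≤q r≤s = ℚ.≤-trans (*-monoʳ r r≥0 p≤q) (*-monoˡ q q≥0 r≤s)

square-nonNeg : ∀ p → 0ℚ ≤ p * p
square-nonNeg p with ℚ.≤-total 0ℚ p
... | inj₁ p≥0 = *-nonNeg p≥0 p≥0
... | inj₂ p≤0 = ℚ.≤-trans (*-nonNeg -p≥0 -p≥0)
  (ℚ.≤-reflexive (S.solve 1 (λ p → (:- p) :* (:- p) := p :* p) refl p))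
  where -p≥0 = ℚ.neg-antimono-≤ p≤0

≤⇒≯ : ∀ {p q} → p ≤ q → ¬ q < p
≤⇒≯ p≤q q<p = ℚ.<-irrefl refl (ℚ.<-≤-trans q<p p≤q)

p≤∣p∣ : ∀ p → p ≤ ∣ p ∣
p≤∣p∣ p with ℚ.≤-total 0ℚ p
... | inj₁ p≥0 = ℚ.≤-reflexive (sym (ℚ.0≤p⇒∣p∣≡p p≥0))
... | inj₂ p≤0 = ℚ.≤-trans p≤0 (ℚ.0≤∣p∣ p)

-p≤∣p∣ : ∀ p → - p ≤ ∣ p ∣
-p≤∣p∣ p = ℚ.≤-trans (p≤∣p∣ (- p)) (ℚ.≤-reflexive (ℚ.∣-p∣≡∣p∣ p))

private
  fromℕᵘ : ∀ n → ℚ.toℚᵘ (fromℕ n) ℚᵘ.≃ ((ℤ.+ n) ℚᵘ./ 1)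
  fromℕᵘ n = ℚ.toℚᵘ-fromℚᵘ (ℚᵘ.mkℚᵘ (ℤ.+ n) 0)

fromℕ-+ : ∀ m n → fromℕ (m ℕ.+ n) ≡ fromℕ m + fromℕ n
fromℕ-+ m n = ℚ.toℚᵘ-injective (begin
  ℚ.toℚᵘ (fromℕ (m ℕ.+ n))             ≈⟨ fromℕᵘ (m ℕ.+ n) ⟩
  (ℤ.+ (m ℕ.+ n)) ℚᵘ./ 1                  ≈⟨ ℚᵘ.*≡* (cong (ℤ._* ℤ.+ 1) (sym (cong₂ ℤ._+_ (ℤ.*-identityʳ (ℤ.+ m)) (ℤ.*-identityʳ (ℤ.+ n))))) ⟩
  ((ℤ.+ m) ℚᵘ./ 1) ℚᵘ.+ ((ℤ.+ n) ℚᵘ./ 1)    ≈⟨ ℚᵘ.+-cong (fromℕᵘ m) (fromℕᵘ n) ⟨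
  ℚ.toℚᵘ (fromℕ m) ℚᵘ.+ ℚ.toℚᵘ (fromℕ n) ≈⟨ ℚ.toℚᵘ-homo-+ (fromℕ m) (fromℕ n) ⟨
  ℚ.toℚᵘ (fromℕ m + fromℕ n)           ∎)
  where open ℚᵘ.≃-Reasoning

fromℕ-suc : ∀ n → fromℕ (suc n) ≡ 1ℚ + fromℕ n
fromℕ-suc = fromℕ-+ 1

fromℕ-* : ∀ m n → fromℕ (m ℕ.* n) ≡ fromℕ m * fromℕ n
fromℕ-* zero    n = sym (ℚ.*-zeroˡ (fromℕ n))
fromℕ-* (suc m) n = begin
  fromℕ (n ℕ.+ m ℕ.* n)          ≡⟨ fromℕ-+ n (m ℕ.* n) ⟩
  fromℕ n + fromℕ (m ℕ.* n)      ≡⟨ cong (fromℕ n +_) (fromℕ-* m n) ⟩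
  fromℕ n + fromℕ m * fromℕ n    ≡⟨ S.solve 2 (λ m n → n :+ m :* n := (con 1ℚ :+ m) :* n) refl (fromℕ m) (fromℕ n) ⟩
  (1ℚ + fromℕ m) * fromℕ n       ≡⟨ cong (_* fromℕ n) (fromℕ-suc m) ⟨
  fromℕ (suc m) * fromℕ n        ∎
  where open ≡-Reasoning

0≤1 : 0ℚ ≤ 1ℚ
0≤1 = ℚ.nonNegative⁻¹ 1ℚ

0<1 : 0ℚ < 1ℚ
0<1 = ℚ.positive⁻¹ 1ℚ

0≤fromℕ : ∀ n → 0ℚ ≤ fromℕ n
0≤fromℕ zero    = ℚ.≤-refl
0≤fromℕ (suc n) = subst (0ℚ ≤_) (sym (fromℕ-suc n)) (+-nonNeg 0≤1 (0≤fromℕ n))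

fromℕ-mono-≤ : m ℕ.≤ n → fromℕ m ≤ fromℕ n
fromℕ-mono-≤ {m} {n} m≤n = ≤-by (fromℕ (n ∸ m)) (0≤fromℕ (n ∸ m))
  (trans (sym (fromℕ-+ m (n ∸ m))) (cong fromℕ (ℕ.m+[n∸m]≡n m≤n)))

fromℕ-mono-< : m ℕ.< n → fromℕ m < fromℕ n
fromℕ-mono-< {m} {n} m<n = ℚ.<-≤-trans
  (ℚ.≤-<-trans (ℚ.≤-reflexive (sym (ℚ.+-identityˡ (fromℕ m)))) (ℚ.+-monoˡ-< (fromℕ m) 0<1))
  (ℚ.≤-trans (ℚ.≤-reflexive (sym (fromℕ-suc m))) (fromℕ-mono-≤ m<n))

0<fromℕ : .{{_ : ℕ.NonZero n}} → 0ℚ < fromℕ n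
0<fromℕ {suc n} = fromℕ-mono-< {0} {suc n} (ℕ.s≤s ℕ.z≤n)

-- ∣ numerator ∣ is an upper bound.
archimedean : ∀ p → ∃ λ n → p ≤ fromℕ n
archimedean p@(ℚ.mkℚ num den-1 _) = ℤ.∣ num ∣ , ℚ.toℚᵘ-cancel-≤ (ℚᵘ.≤-respʳ-≃ (ℚᵘ.≃-sym (fromℕᵘ ℤ.∣ num ∣))
  (ℚᵘ.*≤* (ℤ.≤-trans (ℤ.≤-reflexive (ℤ.*-identityʳ num)) (ℤ.≤-trans (i≤∣i∣ num)
    (ℤ.≤-trans (ℤ.+≤+ (ℕ.m≤m*n ℤ.∣ num ∣ (suc den-1))) (ℤ.≤-reflexive (ℤ.pos-* ℤ.∣ num ∣ (suc den-1))))))))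
  where
  i≤∣i∣ : ∀ i → i ℤ.≤ ℤ.+ ℤ.∣ i ∣
  i≤∣i∣ (ℤ.+ n)      = ℤ.≤-refl
  i≤∣i∣ ℤ.-[1+ n ] = ℤ.-≤+

archimedean-* : ∀ p {q} → 0ℚ < q → ∃ λ n → p < fromℕ n * q
archimedean-* p {q} q>0 with archimedean (p * inv q)
... | n , le = suc n , (begin-strict
  p                      ≡⟨ ℚ.*-identityʳ p ⟨
  p * 1ℚ                 ≡⟨ cong (p *_) (inv-inverseʳ q>0) ⟨
  p * (q * inv q)        ≡⟨ S.solve 3 (λ p q i → p :* (q :* i) := p :* i :* q) refl p q (inv q) ⟩
  p * inv q * q          ≤⟨ *-monoʳ q (ℚ.<⇒≤ q>0) le ⟩
  fromℕ n * q            <⟨ ℚ.*-monoˡ-<-pos q {{ℚ.positive q>0}} (fromℕ-mono-< (ℕ.n<1+n n)) ⟩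
  fromℕ (suc n) * q      ∎)
  where open ℚ.≤-Reasoning

-- Indicators of decidable propositions

𝟙 : Dec P → ℚ
𝟙 (yes _) = 1ℚ
𝟙 (no  _) = 0ℚ

𝟙-true : (d : Dec P) → P → 𝟙 d ≡ 1ℚ
𝟙-true (yes _) _ = refl
𝟙-true (no ¬p) p = contradiction p ¬p

𝟙-false : (d : Dec P) → ¬ P → 𝟙 d ≡ 0ℚ
𝟙-false (yes p) ¬p = contradiction p ¬p
𝟙-false (no _)  _  = refl

𝟙-mono : (d : Dec P) (e : Dec Q) → (P → Q) → 𝟙 d ≤ 𝟙 e
𝟙-mono (yes p) (yes _) _   = ℚ.≤-refl
𝟙-mono (yes p) (no ¬q) p→q = contradiction (p→q p) ¬q
𝟙-mono (no _)  (yes _) _   = 0≤1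
𝟙-mono (no _)  (no _)  _   = ℚ.≤-refl

𝟙-cong : (d : Dec P) (e : Dec Q) → (P → Q) → (Q → P) → 𝟙 d ≡ 𝟙 e
𝟙-cong d e f g = ℚ.≤-antisym (𝟙-mono d e f) (𝟙-mono e d g)

𝟙-× : (d : Dec P) (e : Dec Q) → 𝟙 (d ×-dec e) ≡ 𝟙 d * 𝟙 e
𝟙-× (yes _) (yes _) = refl
𝟙-× (yes _) (no _)  = refl
𝟙-× (no _)  (yes _) = refl
𝟙-× (no _)  (no _)  = refl

0≤𝟙 : (d : Dec P) → 0ℚ ≤ 𝟙 d
0≤𝟙 (yes _) = 0≤1
0≤𝟙 (no _)  = ℚ.≤-refl

𝟙≤1 : (d : Dec P) → 𝟙 d ≤ 1ℚ
𝟙≤1 (yes _) = ℚ.≤-refl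
𝟙≤1 (no _)  = 0≤1

𝟙-cong-* : (d : Dec P) {p q : ℚ} → (P → p ≡ q) → 𝟙 d * p ≡ 𝟙 d * q
𝟙-cong-* (yes p) h = cong (1ℚ *_) (h p)
𝟙-cong-* (no _) {p} {q} _ = trans (ℚ.*-zeroˡ p) (sym (ℚ.*-zeroˡ q))

-- Finite sums

∑ : List I → (I → ℚ) → ℚ
∑ xs f = foldr _+_ 0ℚ (map f xs)

∑-cong : (xs : List I) {f g : I → ℚ} → (∀ x → f x ≡ g x) → ∑ xs f ≡ ∑ xs g
∑-cong []       f≡g = refl
∑-cong (x ∷ xs) f≡g = cong₂ _+_ (f≡g x) (∑-cong xs f≡g)

∑-mono : (xs : List I) {f g : I → ℚ} → (∀ x → f x ≤ g x) → ∑ xs f ≤ ∑ xs g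
∑-mono []       f≤g = ℚ.≤-refl
∑-mono (x ∷ xs) f≤g = ℚ.+-mono-≤ (f≤g x) (∑-mono xs f≤g)

∑-zero : (xs : List I) {f : I → ℚ} → (∀ x → f x ≡ 0ℚ) → ∑ xs f ≡ 0ℚ
∑-zero []       f≡0 = refl
∑-zero (x ∷ xs) f≡0 = cong₂ _+_ (f≡0 x) (∑-zero xs f≡0)

∑-+ : (xs : List I) (f g : I → ℚ) → ∑ xs (λ x → f x + g x) ≡ ∑ xs f + ∑ xs g
∑-+ []       f g = refl
∑-+ (x ∷ xs) f g = trans (cong (f x + g x +_) (∑-+ xs f g))
  (S.solve 4 (λ a b c d → a :+ b :+ (c :+ d) := a :+ c :+ (b :+ d)) refl (f x) (g x) (∑ xs f) (∑ xs g))

∑-*ˡ : (xs : List I) (c : ℚ) (f : I → ℚ) → ∑ xs (λ x → c * f x) ≡ c * ∑ xs f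
∑-*ˡ []       c f = sym (ℚ.*-zeroʳ c)
∑-*ˡ (x ∷ xs) c f = trans (cong (c * f x +_) (∑-*ˡ xs c f)) (sym (ℚ.*-distribˡ-+ c (f x) (∑ xs f)))

∑-*ʳ : (xs : List I) (c : ℚ) (f : I → ℚ) → ∑ xs (λ x → f x * c) ≡ ∑ xs f * c
∑-*ʳ xs c f = trans (∑-cong xs (λ x → ℚ.*-comm (f x) c)) (trans (∑-*ˡ xs c f) (ℚ.*-comm c (∑ xs f)))

∑-const : (xs : List I) (c : ℚ) → ∑ xs (λ _ → c) ≡ fromℕ (length xs) * c
∑-const []       c = sym (ℚ.*-zeroˡ c)
∑-const (x ∷ xs) c = trans (cong (c +_) (∑-const xs c)) (trans
  (S.solve 2 (λ c n → c :+ n :* c := (con 1ℚ :+ n) :* c) refl c (fromℕ (length xs)))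
  (cong (_* c) (sym (fromℕ-suc (length xs)))))

∑-++ : (xs ys : List I) (f : I → ℚ) → ∑ (xs ++ ys) f ≡ ∑ xs f + ∑ ys f
∑-++ []       ys f = sym (ℚ.+-identityˡ (∑ ys f))
∑-++ (x ∷ xs) ys f = trans (cong (f x +_) (∑-++ xs ys f)) (sym (ℚ.+-assoc (f x) (∑ xs f) (∑ ys f)))

∑-map : (g : I → J) (xs : List I) (f : J → ℚ) → ∑ (map g xs) f ≡ ∑ xs (f ∘ g)
∑-map g []       f = refl
∑-map g (x ∷ xs) f = cong (f (g x) +_) (∑-map g xs f)

∑-cartesianProductWith : {K : Set} (g : I → J → K) (xs : List I) (ys : List J) (f : K → ℚ) →
  ∑ (cartesianProductWith g xs ys) f ≡ ∑ xs (λ x → ∑ ys (λ y → f (g x y)))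
∑-cartesianProductWith g []       ys f = refl
∑-cartesianProductWith g (x ∷ xs) ys f = trans
  (∑-++ (map (g x) ys) (cartesianProductWith g xs ys) f)
  (cong₂ _+_ (∑-map (g x) ys f) (∑-cartesianProductWith g xs ys f))

∑-swap : (xs : List I) (ys : List J) (f : I → J → ℚ) →
  ∑ xs (λ x → ∑ ys (f x)) ≡ ∑ ys (λ y → ∑ xs (λ x → f x y))
∑-swap []       ys f = sym (∑-zero ys (λ _ → refl))
∑-swap (x ∷ xs) ys f = trans (cong (∑ ys (f x) +_) (∑-swap xs ys f))
  (sym (∑-+ ys (f x) (λ y → ∑ xs (λ x → f x y))))

∑-filter : {R : I → Set} (R? : Decidable R) (xs : List I) →
  fromℕ (length (filter R? xs)) ≡ ∑ xs (λ x → 𝟙 (R? x))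
∑-filter R? []       = refl
∑-filter R? (x ∷ xs) with R? x
... | yes _ = trans (fromℕ-suc (length (filter R? xs))) (cong (1ℚ +_) (∑-filter R? xs))
... | no  _ = trans (∑-filter R? xs) (sym (ℚ.+-identityˡ (∑ xs (λ x → 𝟙 (R? x)))))

∑Fin : (n : ℕ) → (Fin n → ℚ) → ℚ
∑Fin n = ∑ (allFin n)

∑Fin-suc : (f : Fin (suc n) → ℚ) → ∑Fin (suc n) f ≡ f Fin.zero + ∑Fin n (f ∘ Fin.suc)
∑Fin-suc {n} f = cong (f Fin.zero +_) (trans
  (cong (λ xs → ∑ xs f) (sym (List.map-tabulate id Fin.suc)))
  (∑-map Fin.suc (allFin n) f))

∑Fin-const : (n : ℕ) (c : ℚ) → ∑Fin n (λ _ → c) ≡ fromℕ n * c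
∑Fin-const n c = trans (∑-const (allFin n) c) (cong (λ l → fromℕ l * c) (List.length-tabulate {n = n} id))

∑Fin-delta : (i : Fin n) (f : Fin n → ℚ) → ∑Fin n (λ j → 𝟙 (i Fin.≟ j) * f j) ≡ f i
∑Fin-delta {suc n} Fin.zero f = trans (∑Fin-suc (λ j → 𝟙 (Fin.zero Fin.≟ j) * f j)) (trans
  (cong₂ _+_ (ℚ.*-identityˡ (f Fin.zero)) (∑-zero (allFin n) (λ j → ℚ.*-zeroˡ (f (Fin.suc j)))))
  (ℚ.+-identityʳ (f Fin.zero)))
∑Fin-delta {suc n} (Fin.suc i) f = trans (∑Fin-suc (λ j → 𝟙 (Fin.suc i Fin.≟ j) * f j)) (trans
  (cong₂ _+_ (ℚ.*-zeroˡ (f Fin.zero)) (trans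
    (∑-cong (allFin n) (λ j → cong (_* f (Fin.suc j))
      (𝟙-cong (Fin.suc i Fin.≟ Fin.suc j) (i Fin.≟ j) Fin.suc-injective (cong Fin.suc))))
    (∑Fin-delta i (f ∘ Fin.suc))))
  (ℚ.+-identityˡ (f (Fin.suc i))))

∑Fin-delta′ : (i : Fin n) (f : Fin n → ℚ) → ∑Fin n (λ j → 𝟙 (j Fin.≟ i) * f j) ≡ f i
∑Fin-delta′ {n} i f = trans
  (∑-cong (allFin n) (λ j → cong (_* f j) (𝟙-cong (j Fin.≟ i) (i Fin.≟ j) sym sym)))
  (∑Fin-delta i f)

-- Reindexing along a bijection is the case of a permutation matrix d.
∑-transport : (xs : List I) (ys : List J) (d : I → J → ℚ) {f : J → ℚ} {g : I → ℚ} →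
  (∀ x → ∑ ys (λ y → d x y * f y) ≡ g x) → (∀ y → ∑ xs (λ x → d x y) ≡ 1ℚ) → ∑ xs g ≡ ∑ ys f
∑-transport xs ys d {f} {g} row column = begin
  ∑ xs g                                   ≡⟨ ∑-cong xs row ⟨
  ∑ xs (λ x → ∑ ys (λ y → d x y * f y))    ≡⟨ ∑-swap xs ys (λ x y → d x y * f y) ⟩
  ∑ ys (λ y → ∑ xs (λ x → d x y * f y))    ≡⟨ ∑-cong ys (λ y → ∑-*ʳ xs (f y) (λ x → d x y)) ⟩
  ∑ ys (λ y → ∑ xs (λ x → d x y) * f y)    ≡⟨ ∑-cong ys (λ y → trans (cong (_* f y) (column y)) (ℚ.*-identityˡ (f y))) ⟩
  ∑ ys f                                   ∎
  where open ≡-Reasoning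

-- Sequences with an eventually constant p-th difference: for large n they are
-- polynomials of degree at most p, with c = p ! times the coefficient of n ^ p.

Δ : (ℕ → ℚ) → ℕ → ℚ
Δ f n = f (suc n) - f n

data Degree : ℕ → ℚ → (ℕ → ℚ) → Set where
  constant   : ∀ {c f} N → (∀ n → N ℕ.≤ n → f n ≡ c) → Degree 0 c f
  difference : ∀ {p c f} → Degree p c (Δ f) → Degree (suc p) c f

Degree-resp : ∀ {p c d f g} → (∀ n → f n ≡ g n) → c ≡ d → Degree p c f → Degree p d g
Degree-resp f≡g refl (constant N h) = constant N (λ n n≥N → trans (sym (f≡g n)) (h n n≥N))
Degree-resp f≡g c≡d  (difference h) =
  difference (Degree-resp (λ n → cong₂ _-_ (f≡g (suc n)) (f≡g n)) c≡d h)

Degree-+ : ∀ {p c d f g} → Degree p c f → Degree p d g → Degree p (c + d) (λ n → f n + g n)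
Degree-+ (constant M hf) (constant N hg) = constant (M ℕ.⊔ N) λ n n≥ →
  cong₂ _+_ (hf n (ℕ.m⊔n≤o⇒m≤o M N n≥)) (hg n (ℕ.m⊔n≤o⇒n≤o M N n≥))
Degree-+ {f = f} {g} (difference hf) (difference hg) = difference (Degree-resp
  (λ n → S.solve 4 (λ a b c d → (a :- b) :+ (c :- d) := (a :+ c) :- (b :+ d)) refl
    (f (suc n)) (f n) (g (suc n)) (g n))
  refl (Degree-+ hf hg))

Degree-* : ∀ {p c f} a → Degree p c f → Degree p (a * c) (λ n → a * f n)
Degree-* a (constant N h) = constant N (λ n n≥N → cong (a *_) (h n n≥N))
Degree-* {f = f} a (difference hf) = difference (Degree-resp
  (λ n → S.solve 3 (λ a x y → a :* (x :- y) := a :* x :- a :* y) refl a (f (suc n)) (f n))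
  refl (Degree-* a hf))

Degree-raise : ∀ {p c f} → Degree p c f → Degree (suc p) 0ℚ f
Degree-raise {c = c} (constant N h) = difference (constant N λ n n≥N →
  trans (cong₂ _-_ (h (suc n) (ℕ.m≤n⇒m≤1+n n≥N)) (h n n≥N)) (ℚ.+-inverseʳ c))
Degree-raise (difference h) = difference (Degree-raise h)

-- If the top difference is eventually zero, the difference below it is eventually constant. The
-- recursion only descends to that level.
Degree-lower : ∀ {p f} → Degree (suc p) 0ℚ f → ∃ λ c → Degree p c f
Degree-lower {f = f} (difference (constant N h)) = f N , constant N λ n n≥N →
  subst (λ n → f n ≡ f N) (ℕ.m∸n+n≡m n≥N) (stays (n ∸ N))
  where
  stays : ∀ i → f (i ℕ.+ N) ≡ f N
  stays zero    = refl
  stays (suc i) = begin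
    f (suc (i ℕ.+ N))             ≡⟨ S.solve 2 (λ x y → x := (x :- y) :+ y) refl (f (suc (i ℕ.+ N))) (f (i ℕ.+ N)) ⟩
    Δ f (i ℕ.+ N) + f (i ℕ.+ N)   ≡⟨ cong₂ _+_ (h (i ℕ.+ N) (ℕ.m≤n+m N i)) (stays i) ⟩
    0ℚ + f N                      ≡⟨ ℚ.+-identityˡ (f N) ⟩
    f N                           ∎
    where open ≡-Reasoning
Degree-lower (difference (difference h)) with Degree-lower (difference h)
... | c , h′ = c , difference h′

Degree-sum : ∀ {p c f g} → (∀ n → f (suc n) ≡ f n + g n) → Degree p c g → Degree (suc p) c f
Degree-sum {f = f} {g} step h = difference (Degree-resp
  (λ n → trans (S.solve 2 (λ x y → y := x :+ y :- x) refl (f n) (g n)) (cong (_- f n) (sym (step n)))) refl h)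

Degree-unshift : ∀ {p c f} → Degree p c (f ∘ suc) → Degree p c f
Degree-unshift (constant N h)   = constant (suc N) λ { (suc n) (ℕ.s≤s n≥N) → h n n≥N }
Degree-unshift (difference h) = difference (Degree-unshift h)

-- Discrete Leibniz rule: Δ(n f) = f + Δf + n Δf. The first and the last summand have full degree
-- and contribute c and p c (for f of degree p), which gives the factor p + 1.
Degree-n* : ∀ {p c f} → Degree p c f → Degree (suc p) (fromℕ (suc p) * c) (λ n → fromℕ n * f n)
Degree-n* {c = c} {f} (constant N h) = difference (constant N λ n n≥N → begin
  fromℕ (suc n) * f (suc n) - fromℕ n * f n   ≡⟨ cong₂ _-_ (cong₂ _*_ (fromℕ-suc n) (h (suc n) (ℕ.m≤n⇒m≤1+n n≥N)))
                                                           (cong (fromℕ n *_) (h n n≥N)) ⟩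
  (1ℚ + fromℕ n) * c - fromℕ n * c            ≡⟨ S.solve 2 (λ n c → (con 1ℚ :+ n) :* c :- n :* c := con 1ℚ :* c) refl (fromℕ n) c ⟩
  1ℚ * c                                      ∎)
  where open ≡-Reasoning
Degree-n* {suc p} {c} {f} (difference hf) = difference (Degree-resp leibniz factor
  (Degree-+ (Degree-+ (difference {f = f} hf) (Degree-raise hf)) (Degree-n* hf)))
  where
  leibniz : ∀ n → f n + Δ f n + fromℕ n * Δ f n ≡ Δ (λ n → fromℕ n * f n) n
  leibniz n = begin
    f n + Δ f n + fromℕ n * Δ f n              ≡⟨ S.solve 3 (λ x y n → y :+ (x :- y) :+ n :* (x :- y) := (con 1ℚ :+ n) :* x :- n :* y) refl
                                                    (f (suc n)) (f n) (fromℕ n) ⟩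
    (1ℚ + fromℕ n) * f (suc n) - fromℕ n * f n ≡⟨ cong (λ m → m * f (suc n) - fromℕ n * f n) (fromℕ-suc n) ⟨
    fromℕ (suc n) * f (suc n) - fromℕ n * f n  ∎
    where open ≡-Reasoning
  factor : c + 0ℚ + fromℕ (suc p) * c ≡ fromℕ (suc (suc p)) * c
  factor = trans
    (S.solve 2 (λ p c → c :+ con 0ℚ :+ p :* c := (con 1ℚ :+ p) :* c) refl (fromℕ (suc p)) c)
    (cong (_* c) (sym (fromℕ-suc (suc p))))

Degree-^ : ∀ p → Degree p (fromℕ (p !)) (λ n → fromℕ (n ^ p))
Degree-^ zero    = constant 0 (λ _ _ → refl)
Degree-^ (suc p) = Degree-resp (λ n → sym (fromℕ-* n (n ^ p))) (sym (fromℕ-* (suc p) (p !)))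
  (Degree-n* (Degree-^ p))

1≤n^p : ∀ p → 1 ℕ.≤ n → 1 ℕ.≤ n ^ p
1≤n^p {n} p n≥1 = ℕ.m^n>0 n {{ℕ.>-nonZero n≥1}} p

-- From `M` to n there are at most n steps, and by induction each of them is at most K n^p.
Degree⇒bounded : ∀ {p c f} → Degree p c f →
  ∃ λ K → 0ℚ ≤ K × ∃ λ N → ∀ n → N ℕ.≤ n → ∣ f n ∣ ≤ K * fromℕ (n ^ p)
Degree⇒bounded {c = c} (constant N h) = ∣ c ∣ , ℚ.0≤∣p∣ c , N , λ n n≥N →
  ℚ.≤-reflexive (trans (cong ∣_∣ (h n n≥N)) (sym (ℚ.*-identityʳ ∣ c ∣)))
Degree⇒bounded {suc p} {f = f} (difference hf) with Degree⇒bounded hf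
... | K , K≥0 , N , h = ∣ f M ∣ + K , +-nonNeg (ℚ.0≤∣p∣ (f M)) K≥0 , M , λ n n≥M →
  ℚ.≤-trans (subst (λ n → ∣ f n ∣ ≤ ∣ f M ∣ + fromℕ (n ∸ M) * (K * fromℕ (n ^ p)))
                   (ℕ.m∸n+n≡m n≥M)
                   (subst (λ j → ∣ f (n ∸ M ℕ.+ M) ∣ ≤ ∣ f M ∣ + fromℕ j * (K * fromℕ ((n ∸ M ℕ.+ M) ^ p)))
                          (sym (ℕ.m+n∸n≡m (n ∸ M) M)) (growth (n ∸ M))))
            (final n n≥M)
  where
  -- Starting at `suc N` rather than `N` ensures n ≥ 1, so that 1 ≤ n^(p+1) and the initial value
  -- `∣ f M ∣` is absorbed.
  M = suc N
  growth : ∀ i → ∣ f (i ℕ.+ M) ∣ ≤ ∣ f M ∣ + fromℕ i * (K * fromℕ ((i ℕ.+ M) ^ p))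
  growth zero    = ℚ.≤-reflexive (trans (sym (ℚ.+-identityʳ ∣ f M ∣))
    (cong (∣ f M ∣ +_) (sym (ℚ.*-zeroˡ (K * fromℕ (M ^ p))))))
  growth (suc i) = begin
    ∣ f (suc j) ∣                              ≡⟨ cong ∣_∣ (S.solve 2 (λ x y → x := y :+ (x :- y)) refl (f (suc j)) (f j)) ⟩
    ∣ f j + Δ f j ∣                            ≤⟨ ℚ.∣p+q∣≤∣p∣+∣q∣ (f j) (Δ f j) ⟩
    ∣ f j ∣ + ∣ Δ f j ∣                        ≤⟨ ℚ.+-mono-≤ (growth i) (h j (ℕ.≤-trans (ℕ.n≤1+n N) (ℕ.m≤n+m M i))) ⟩
    ∣ f M ∣ + fromℕ i * b j + b j              ≤⟨ ℚ.+-mono-≤ (ℚ.+-monoʳ-≤ ∣ f M ∣ (*-monoˡ (fromℕ i) (0≤fromℕ i) b-mono)) b-mono ⟩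
    ∣ f M ∣ + fromℕ i * b (suc j) + b (suc j)  ≡⟨ S.solve 3 (λ a i b → a :+ i :* b :+ b := a :+ (con 1ℚ :+ i) :* b) refl ∣ f M ∣ (fromℕ i) (b (suc j)) ⟩
    ∣ f M ∣ + (1ℚ + fromℕ i) * b (suc j)       ≡⟨ cong (λ s → ∣ f M ∣ + s * b (suc j)) (fromℕ-suc i) ⟨
    ∣ f M ∣ + fromℕ (suc i) * b (suc j)        ∎
    where
    open ℚ.≤-Reasoning
    j = i ℕ.+ M
    b : ℕ → ℚ
    b j = K * fromℕ (j ^ p)
    b-mono : b j ≤ b (suc j)
    b-mono = *-monoˡ K K≥0 (fromℕ-mono-≤ (ℕ.^-monoˡ-≤ p (ℕ.n≤1+n j)))
  final : ∀ n → M ℕ.≤ n →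
    ∣ f M ∣ + fromℕ (n ∸ M) * (K * fromℕ (n ^ p)) ≤ (∣ f M ∣ + K) * fromℕ (n ^ suc p)
  final n n≥M = begin
    ∣ f M ∣ + fromℕ (n ∸ M) * (K * fromℕ (n ^ p))  ≤⟨ ℚ.+-mono-≤ (ℚ.≤-trans (ℚ.≤-reflexive (sym (ℚ.*-identityʳ ∣ f M ∣)))
                                                         (*-monoˡ ∣ f M ∣ (ℚ.0≤∣p∣ (f M)) (fromℕ-mono-≤ (1≤n^p (suc p) n≥1))))
                                                       (*-monoʳ (K * fromℕ (n ^ p)) (*-nonNeg K≥0 (0≤fromℕ (n ^ p))) (fromℕ-mono-≤ (ℕ.m∸n≤m n M))) ⟩
    ∣ f M ∣ * fromℕ (n ^ suc p) + fromℕ n * (K * fromℕ (n ^ p)) ≡⟨ cong (∣ f M ∣ * fromℕ (n ^ suc p) +_)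
                                                       (S.solve 3 (λ n k m → n :* (k :* m) := k :* (n :* m)) refl (fromℕ n) K (fromℕ (n ^ p))) ⟩
    ∣ f M ∣ * fromℕ (n ^ suc p) + K * (fromℕ n * fromℕ (n ^ p)) ≡⟨ cong (λ m → ∣ f M ∣ * fromℕ (n ^ suc p) + K * m) (fromℕ-* n (n ^ p)) ⟨
    ∣ f M ∣ * fromℕ (n ^ suc p) + K * fromℕ (n ^ suc p) ≡⟨ ℚ.*-distribʳ-+ (fromℕ (n ^ suc p)) ∣ f M ∣ K ⟨
    (∣ f M ∣ + K) * fromℕ (n ^ suc p)              ∎
    where
    open ℚ.≤-Reasoning
    n≥1 = ℕ.≤-trans (ℕ.s≤s ℕ.z≤n) n≥M

-- The top difference of n^(p+1) is (p+1)! by `Degree-^`, so subtracting C n^(p+1) makes the top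
-- difference vanish and leaves a sequence of degree p.
Degree⇒leading : ∀ {p c f} → Degree (suc p) c f → let C = c * inv (fromℕ (suc p !)) in
  ∃ λ K → 0ℚ ≤ K × ∃ λ N → ∀ n → N ℕ.≤ n → ∣ f n - C * fromℕ (n ^ suc p) ∣ ≤ K * fromℕ (n ^ p)
Degree⇒leading {p} {c} {f} hf = Degree⇒bounded (proj₂ (Degree-lower
  (Degree-resp
    (λ n → S.solve 3 (λ x a b → x :+ (:- a) :* b := x :- a :* b) refl (f n) C (fromℕ (n ^ suc p)))
    vanish (Degree-+ hf (Degree-* (- C) (Degree-^ (suc p)))))))
  where
  C = c * inv (fromℕ (suc p !))
  F>0 : 0ℚ < fromℕ (suc p !)
  F>0 = 0<fromℕ {{(suc p) ℕ.!≢0}}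
  vanish : c + - C * fromℕ (suc p !) ≡ 0ℚ
  vanish = begin
    c + - (c * inv (fromℕ (suc p !))) * fromℕ (suc p !)  ≡⟨ S.solve 3 (λ c i F → c :+ (:- (c :* i)) :* F := c :- c :* (F :* i)) refl
                                                              c (inv (fromℕ (suc p !))) (fromℕ (suc p !)) ⟩
    c - c * (fromℕ (suc p !) * inv (fromℕ (suc p !)))    ≡⟨ cong (λ u → c - c * u) (inv-inverseʳ F>0) ⟩
    c - c * 1ℚ                                          ≡⟨ S.solve 1 (λ c → c :- c :* con 1ℚ := con 0ℚ) refl c ⟩
    0ℚ                                                  ∎
    where open ≡-Reasoning

-- Sums over permutations

-- The enumeration meets each permutation only up to pointwise equality, so sums can be reindexed
-- only for functionals that do not distinguish `≈`-equal permutations.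
Respects≈ : (Permutation′ n → ℚ) → Set
Respects≈ F = ∀ {σ τ} → σ ≈ τ → F σ ≡ F τ

_≈?_ : (σ τ : Permutation′ n) → Dec (σ ≈ τ)
σ ≈? τ = Fin.all? (λ i → (σ ⟨$⟩ʳ i) Fin.≟ (τ ⟨$⟩ʳ i))

≈-sym : {σ τ : Permutation′ n} → σ ≈ τ → τ ≈ σ
≈-sym e i = sym (e i)

perm-injective : (σ : Permutation′ n) {i j : Fin n} → σ ⟨$⟩ʳ i ≡ σ ⟨$⟩ʳ j → i ≡ j
perm-injective σ e = trans (sym (Perm.inverseˡ σ)) (trans (cong (σ ⟨$⟩ˡ_) e) (Perm.inverseˡ σ))

insert-at : ∀ (i j : Fin (suc n)) (π : Permutation′ n) → insert i j π ⟨$⟩ʳ i ≡ j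
insert-at i j π with i Fin.≟ i
... | yes _  = refl
... | no i≢i = contradiction refl i≢i

data PunchedView (p : Fin (suc n)) : Fin (suc n) → Set where
  here    : PunchedView p p
  punched : ∀ i → PunchedView p (punchIn p i)

punchedView : (p i : Fin (suc n)) → PunchedView p i
punchedView p i with p Fin.≟ i
... | yes refl = here
... | no p≢i   = subst (PunchedView p) (Fin.punchIn-punchOut p≢i) (punched (punchOut p≢i))

module _ (p : Fin (suc n)) (v : Fin (suc n)) (τ : Permutation′ n) (σ : Permutation′ (suc n)) where

  insert≈⇒ : insert p v τ ≈ σ → (σ ⟨$⟩ʳ p ≡ v) × (remove p σ ≈ τ)
  insert≈⇒ e = σp≡v , λ i → Fin.punchIn-injective v _ _ (begin
    punchIn v (remove p σ ⟨$⟩ʳ i)           ≡⟨ cong (λ v → punchIn v (remove p σ ⟨$⟩ʳ i)) σp≡v ⟨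
    punchIn (σ ⟨$⟩ʳ p) (remove p σ ⟨$⟩ʳ i)  ≡⟨ Perm.punchIn-permute σ p i ⟨
    σ ⟨$⟩ʳ punchIn p i                     ≡⟨ e (punchIn p i) ⟨
    insert p v τ ⟨$⟩ʳ punchIn p i          ≡⟨ Perm.insert-punchIn p v τ i ⟩
    punchIn v (τ ⟨$⟩ʳ i)                   ∎)
    where
    open ≡-Reasoning
    σp≡v = trans (sym (e p)) (insert-at p v τ)

  ⇒insert≈ : (σ ⟨$⟩ʳ p ≡ v) × (remove p σ ≈ τ) → insert p v τ ≈ σ
  ⇒insert≈ (refl , e) i with punchedView p i
  ... | here      = insert-at p v τ
  ... | punched i = begin
    insert p v τ ⟨$⟩ʳ punchIn p i          ≡⟨ Perm.insert-punchIn p v τ i ⟩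
    punchIn v (τ ⟨$⟩ʳ i)                   ≡⟨ cong (punchIn v) (e i) ⟨
    punchIn v (remove p σ ⟨$⟩ʳ i)           ≡⟨ Perm.punchIn-permute σ p i ⟨
    σ ⟨$⟩ʳ punchIn p i                     ∎
    where open ≡-Reasoning

  𝟙-insert : 𝟙 (insert p v τ ≈? σ) ≡ 𝟙 ((σ ⟨$⟩ʳ p) Fin.≟ v) * 𝟙 (remove p σ ≈? τ)
  𝟙-insert = trans
    (𝟙-cong (insert p v τ ≈? σ) (((σ ⟨$⟩ʳ p) Fin.≟ v) ×-dec (remove p σ ≈? τ)) insert≈⇒ ⇒insert≈)
    (𝟙-× ((σ ⟨$⟩ʳ p) Fin.≟ v) (remove p σ ≈? τ))

insert-cong : ∀ (p v : Fin (suc n)) {τ τ′ : Permutation′ n} → τ ≈ τ′ → insert p v τ ≈ insert p v τ′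
insert-cong p v {τ} {τ′} e = ⇒insert≈ p v τ (insert p v τ′)
  (insert-at p v τ′ , λ i → trans (Perm.remove-insert p v τ′ i) (sym (e i)))

-- A permutation is determined by its letter at `p` and the rest, so its delta factors. The last
-- hypothesis is the delta rule one size lower; keeping it abstract serves both the induction of
-- `∑-perm-delta` and the columns of `∑-insert`.
∑-insert-delta : (p : Fin (suc n)) (σ : Permutation′ (suc n)) (G : Fin (suc n) → Permutation′ n → ℚ) →
  (∀ v → ∑ (permutations n) (λ τ → 𝟙 (remove p σ ≈? τ) * G v τ) ≡ G v (remove p σ)) →
  ∑Fin (suc n) (λ v → ∑ (permutations n) (λ τ → 𝟙 (insert p v τ ≈? σ) * G v τ)) ≡ G (σ ⟨$⟩ʳ p) (remove p σ)
∑-insert-delta {n} p σ G delta = trans (∑-cong (allFin (suc n)) row) (∑Fin-delta (σ ⟨$⟩ʳ p) (λ v → G v (remove p σ)))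
  where
  row : ∀ v → ∑ (permutations n) (λ τ → 𝟙 (insert p v τ ≈? σ) * G v τ)
            ≡ 𝟙 ((σ ⟨$⟩ʳ p) Fin.≟ v) * G v (remove p σ)
  row v = begin
    ∑ (permutations n) (λ τ → 𝟙 (insert p v τ ≈? σ) * G v τ)      ≡⟨ ∑-cong (permutations n) (λ τ → trans
                                                                       (cong (_* G v τ) (𝟙-insert p v τ σ))
                                                                       (ℚ.*-assoc δ (𝟙 (remove p σ ≈? τ)) (G v τ))) ⟩
    ∑ (permutations n) (λ τ → δ * (𝟙 (remove p σ ≈? τ) * G v τ))  ≡⟨ ∑-*ˡ (permutations n) δ (λ τ → 𝟙 (remove p σ ≈? τ) * G v τ) ⟩
    δ * ∑ (permutations n) (λ τ → 𝟙 (remove p σ ≈? τ) * G v τ)    ≡⟨ cong (δ *_) (delta v) ⟩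
    δ * G v (remove p σ)                                          ∎
    where
    open ≡-Reasoning
    δ = 𝟙 ((σ ⟨$⟩ʳ p) Fin.≟ v)

-- Expresses that `permutations n` contains each `≈`-class once, in the shape of the row condition
-- of `∑-transport`.
∑-perm-delta : (σ : Permutation′ n) {F : Permutation′ n → ℚ} → Respects≈ F →
  ∑ (permutations n) (λ τ → 𝟙 (σ ≈? τ) * F τ) ≡ F σ
∑-perm-delta {zero} σ {F} resp = begin
  𝟙 (σ ≈? Perm.id) * F Perm.id + 0ℚ   ≡⟨ ℚ.+-identityʳ _ ⟩
  𝟙 (σ ≈? Perm.id) * F Perm.id        ≡⟨ cong (_* F Perm.id) (𝟙-true (σ ≈? Perm.id) (λ ())) ⟩
  1ℚ * F Perm.id                      ≡⟨ ℚ.*-identityˡ (F Perm.id) ⟩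
  F Perm.id                           ≡⟨ resp (λ ()) ⟩
  F σ                                 ∎
  where open ≡-Reasoning
∑-perm-delta {suc n} σ {F} resp = begin
  ∑ (permutations (suc n)) (λ τ → 𝟙 (σ ≈? τ) * F τ)
    ≡⟨ ∑-cong (permutations (suc n)) (λ τ → cong (_* F τ) (𝟙-cong (σ ≈? τ) (τ ≈? σ) (λ e i → sym (e i)) (λ e i → sym (e i)))) ⟩
  ∑ (permutations (suc n)) (λ τ → 𝟙 (τ ≈? σ) * F τ)
    ≡⟨ ∑-cartesianProductWith (insert Fin.zero) (allFin (suc n)) (permutations n) (λ τ → 𝟙 (τ ≈? σ) * F τ) ⟩
  ∑Fin (suc n) (λ v → ∑ (permutations n) (λ τ → 𝟙 (insert Fin.zero v τ ≈? σ) * F (insert Fin.zero v τ)))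
    ≡⟨ ∑-insert-delta Fin.zero σ (λ v τ → F (insert Fin.zero v τ))
         (λ v → ∑-perm-delta (remove Fin.zero σ) (λ {τ} {τ′} e → resp (insert-cong Fin.zero v {τ} {τ′} e))) ⟩
  F (insert Fin.zero (σ ⟨$⟩ʳ Fin.zero) (remove Fin.zero σ))
    ≡⟨ resp (Perm.insert-remove Fin.zero σ) ⟩
  F σ ∎
  where open ≡-Reasoning

∑-perm-unique : (σ : Permutation′ n) → ∑ (permutations n) (λ τ → 𝟙 (σ ≈? τ)) ≡ 1ℚ
∑-perm-unique {n} σ = trans
  (∑-cong (permutations n) (λ τ → sym (ℚ.*-identityʳ (𝟙 (σ ≈? τ)))))
  (∑-perm-delta σ (λ _ → refl))

-- The enumeration inserts at position zero; any other position serves as well, since σ is recovered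
-- from its letter at `p` and `remove p σ`. In terms of expectations this is conditioning on the
-- letter at `p`.
∑-insert : (p : Fin (suc n)) {F : Permutation′ (suc n) → ℚ} → Respects≈ F →
  ∑Fin (suc n) (λ v → ∑ (permutations n) (λ τ → F (insert p v τ))) ≡ ∑ (permutations (suc n)) F
∑-insert {n} p {F} resp = trans
  (sym (∑-cartesianProductWith _,_ (allFin (suc n)) (permutations n) (λ (v , τ) → F (insert p v τ))))
  (∑-transport (cartesianProductWith _,_ (allFin (suc n)) (permutations n)) (permutations (suc n))
    (λ (v , τ) σ → 𝟙 (insert p v τ ≈? σ))
    (λ (v , τ) → ∑-perm-delta (insert p v τ) resp)
    column)
  where
  column : ∀ σ → ∑ (cartesianProductWith _,_ (allFin (suc n)) (permutations n)) (λ (v , τ) → 𝟙 (insert p v τ ≈? σ)) ≡ 1ℚ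
  column σ = trans
    (∑-cartesianProductWith _,_ (allFin (suc n)) (permutations n) (λ (v , τ) → 𝟙 (insert p v τ ≈? σ)))
    (trans
      (∑-cong (allFin (suc n)) (λ v → ∑-cong (permutations n) (λ τ → sym (ℚ.*-identityʳ (𝟙 (insert p v τ ≈? σ))))))
      (∑-insert-delta p σ (λ _ _ → 1ℚ) (λ _ → ∑-perm-delta (remove p σ) (λ _ → refl))))

∑-∘ₚ : (ρ : Permutation′ n) {F : Permutation′ n → ℚ} → Respects≈ F →
  ∑ (permutations n) (λ σ → F (ρ ∘ₚ σ)) ≡ ∑ (permutations n) F
∑-∘ₚ {n} ρ {F} resp = ∑-transport (permutations n) (permutations n)
  (λ σ σ′ → 𝟙 ((ρ ∘ₚ σ) ≈? σ′))
  (λ σ → ∑-perm-delta (ρ ∘ₚ σ) resp)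
  (λ σ′ → trans
    (∑-cong (permutations n) (λ σ → 𝟙-cong ((ρ ∘ₚ σ) ≈? σ′) ((Perm.flip ρ ∘ₚ σ′) ≈? σ)
      (λ e i → trans (sym (e (ρ ⟨$⟩ˡ i))) (cong (σ ⟨$⟩ʳ_) (Perm.inverseʳ ρ)))
      (λ e i → trans (sym (e (ρ ⟨$⟩ʳ i))) (cong (σ′ ⟨$⟩ʳ_) (Perm.inverseˡ ρ)))))
    (∑-perm-unique (Perm.flip ρ ∘ₚ σ′)))

-- Expectation

1/_! : ℕ → ℚ
1/ n ! = ((ℤ.+ 1) ℚ./ (n !)) {{n ℕ.!≢0}}

n!*1/n!≡1 : ∀ n → fromℕ (n !) * 1/ n ! ≡ 1ℚ
n!*1/n!≡1 n = helper (n !) {{n ℕ.!≢0}}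
  where
  helper : ∀ m .{{_ : ℕ.NonZero m}} → fromℕ m * ((ℤ.+ 1) ℚ./ m) ≡ 1ℚ
  helper (suc m) = ℚ.toℚᵘ-injective (begin
    ℚ.toℚᵘ (fromℕ (suc m) * ((ℤ.+ 1) ℚ./ suc m))            ≈⟨ ℚ.toℚᵘ-homo-* (fromℕ (suc m)) ((ℤ.+ 1) ℚ./ suc m) ⟩
    ℚ.toℚᵘ (fromℕ (suc m)) ℚᵘ.* ℚ.toℚᵘ ((ℤ.+ 1) ℚ./ suc m)  ≈⟨ ℚᵘ.*-cong (ℚ.toℚᵘ-fromℚᵘ (ℚᵘ.mkℚᵘ (ℤ.+ suc m) 0)) (ℚ.toℚᵘ-fromℚᵘ (ℚᵘ.mkℚᵘ (ℤ.+ 1) m)) ⟩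
    ℚᵘ.mkℚᵘ (ℤ.+ suc m) 0 ℚᵘ.* ℚᵘ.mkℚᵘ (ℤ.+ 1) m             ≈⟨ ℚᵘ.*≡* (trans (ℤ.*-identityʳ _) (trans (ℤ.*-identityʳ _)
                                                                  (sym (trans (ℤ.*-identityˡ _) (cong (λ m → ℤ.+ suc m) (ℕ.+-identityʳ m)))))) ⟩
    ℚᵘ.1ℚᵘ                                                  ∎)
    where open ℚᵘ.≃-Reasoning

0<1/n! : ∀ n → 0ℚ < 1/ n !
0<1/n! n = ℚ.positive⁻¹ (1/ n !) {{ℚ.normalize-pos 1 (n !) {{n ℕ.!≢0}}}}

module _ {n : ℕ} where

  𝔼-cong : {F G : Permutation′ n → ℚ} → (∀ σ → F σ ≡ G σ) → 𝔼 F ≡ 𝔼 G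
  𝔼-cong F≡G = cong (_* 1/ n !) (∑-cong (permutations n) F≡G)

  𝔼-mono : {F G : Permutation′ n → ℚ} → (∀ σ → F σ ≤ G σ) → 𝔼 F ≤ 𝔼 G
  𝔼-mono F≤G = *-monoʳ (1/ n !) (ℚ.<⇒≤ (0<1/n! n)) (∑-mono (permutations n) F≤G)

  𝔼-+ : (F G : Permutation′ n → ℚ) → 𝔼 (λ σ → F σ + G σ) ≡ 𝔼 F + 𝔼 G
  𝔼-+ F G = trans (cong (_* 1/ n !) (∑-+ (permutations n) F G)) (ℚ.*-distribʳ-+ (1/ n !) (∑ (permutations n) F) (∑ (permutations n) G))

  𝔼-* : (c : ℚ) (F : Permutation′ n → ℚ) → 𝔼 (λ σ → c * F σ) ≡ c * 𝔼 F
  𝔼-* c F = trans (cong (_* 1/ n !) (∑-*ˡ (permutations n) c F)) (ℚ.*-assoc c _ (1/ n !))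

  𝔼-const : (c : ℚ) → 𝔼 {n} (λ _ → c) ≡ c
  𝔼-const c = begin
    ∑ (permutations n) (λ _ → c) * 1/ n !               ≡⟨ cong (_* 1/ n !) (∑-const (permutations n) c) ⟩
    fromℕ (length (permutations n)) * c * 1/ n !        ≡⟨ cong (λ l → fromℕ l * c * 1/ n !) (length-permutations n) ⟩
    fromℕ (n !) * c * 1/ n !                            ≡⟨ S.solve 3 (λ a c b → a :* c :* b := c :* (a :* b)) refl (fromℕ (n !)) c (1/ n !) ⟩
    c * (fromℕ (n !) * 1/ n !)                          ≡⟨ cong (c *_) (n!*1/n!≡1 n) ⟩
    c * 1ℚ                                              ≡⟨ ℚ.*-identityʳ c ⟩
    c                                                   ∎
    where open ≡-Reasoning

  𝔼-∑ : (xs : List I) (F : I → Permutation′ n → ℚ) → 𝔼 (λ σ → ∑ xs (λ x → F x σ)) ≡ ∑ xs (λ x → 𝔼 (F x))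
  𝔼-∑ xs F = trans (cong (_* 1/ n !) (∑-swap (permutations n) xs (λ σ x → F x σ)))
    (sym (∑-*ʳ xs (1/ n !) (λ x → ∑ (permutations n) (F x))))

  𝔼-∘ₚ : (ρ : Permutation′ n) {F : Permutation′ n → ℚ} → Respects≈ F → 𝔼 (λ σ → F (ρ ∘ₚ σ)) ≡ 𝔼 F
  𝔼-∘ₚ ρ resp = cong (_* 1/ n !) (∑-∘ₚ ρ resp)

  𝔼-nonNeg : {F : Permutation′ n → ℚ} → (∀ σ → 0ℚ ≤ F σ) → 0ℚ ≤ 𝔼 F
  𝔼-nonNeg F≥0 = ℚ.≤-trans (ℚ.≤-reflexive (sym (𝔼-const 0ℚ))) (𝔼-mono F≥0)

𝔼-insert : (p : Fin (suc n)) {F : Permutation′ (suc n) → ℚ} → Respects≈ F →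
  ∑Fin (suc n) (λ v → 𝔼 (λ τ → F (insert p v τ))) ≡ fromℕ (suc n) * 𝔼 F
𝔼-insert {n} p {F} resp = begin
  ∑Fin (suc n) (λ v → 𝔼 (λ τ → F (insert p v τ)))
    ≡⟨ ∑-*ʳ (allFin (suc n)) (1/ n !) (λ v → ∑ (permutations n) (λ τ → F (insert p v τ))) ⟩
  ∑Fin (suc n) (λ v → ∑ (permutations n) (λ τ → F (insert p v τ))) * 1/ n !
    ≡⟨ cong₂ _*_ (∑-insert p resp) 1/n! ⟩
  total * (fromℕ (suc n) * 1/ suc n !)
    ≡⟨ S.solve 3 (λ a b c → a :* (b :* c) := b :* (a :* c)) refl total (fromℕ (suc n)) (1/ suc n !) ⟩
  fromℕ (suc n) * 𝔼 F ∎
  where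
  open ≡-Reasoning
  total = ∑ (permutations (suc n)) F
  1/n! : 1/ n ! ≡ fromℕ (suc n) * 1/ suc n !
  1/n! = begin
    1/ n !                                                      ≡⟨ ℚ.*-identityʳ _ ⟨
    1/ n ! * 1ℚ                                                 ≡⟨ cong (1/ n ! *_) (n!*1/n!≡1 (suc n)) ⟨
    1/ n ! * (fromℕ (suc n !) * 1/ suc n !)                     ≡⟨ cong (λ f → 1/ n ! * (f * 1/ suc n !)) (fromℕ-* (suc n) (n !)) ⟩
    1/ n ! * (fromℕ (suc n) * fromℕ (n !) * 1/ suc n !)         ≡⟨ S.solve 4 (λ a b c d → a :* (b :* c :* d) := (c :* a) :* (b :* d)) refl
                                                                     (1/ n !) (fromℕ (suc n)) (fromℕ (n !)) (1/ suc n !) ⟩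
    fromℕ (n !) * 1/ n ! * (fromℕ (suc n) * 1/ suc n !)         ≡⟨ cong (_* (fromℕ (suc n) * 1/ suc n !)) (n!*1/n!≡1 n) ⟩
    1ℚ * (fromℕ (suc n) * 1/ suc n !)                           ≡⟨ ℚ.*-identityˡ _ ⟩
    fromℕ (suc n) * 1/ suc n !                                  ∎

-- Patterns at given positions

Matches : Permutation′ k → (Fin k → Fin n) → Permutation′ n → Set
Matches π v σ = ∀ r s → (π ⟨$⟩ʳ r) Fin.< (π ⟨$⟩ʳ s) ⇔ (σ ⟨$⟩ʳ v r) Fin.< (σ ⟨$⟩ʳ v s)

matches? : (π : Permutation′ k) (v : Fin k → Fin n) (σ : Permutation′ n) → Dec (Matches π v σ)
matches? π v σ = Fin.all? λ r → Fin.all? λ s →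
  map′ (λ (f , g) → mk⇔ f g) (λ e → Equivalence.to e , Equivalence.from e)
    ((((π ⟨$⟩ʳ r) Fin.<? (π ⟨$⟩ʳ s)) →-dec ((σ ⟨$⟩ʳ v r) Fin.<? (σ ⟨$⟩ʳ v s)))
      ×-dec (((σ ⟨$⟩ʳ v r) Fin.<? (σ ⟨$⟩ʳ v s)) →-dec ((π ⟨$⟩ʳ r) Fin.<? (π ⟨$⟩ʳ s))))

opaque
  -- Opaque, so that the decision procedure for `Matches` does not unfold in later terms; the lemmas
  -- of this block are the interface.
  χ : Permutation′ k → (Fin k → Fin n) → Permutation′ n → ℚ
  χ π v σ = 𝟙 (matches? π v σ)

  χ-𝟙 : (π : Permutation′ k) (v : Fin k → Fin n) (σ : Permutation′ n) (d : Dec (Matches π v σ)) → χ π v σ ≡ 𝟙 d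
  χ-𝟙 π v σ d = 𝟙-cong (matches? π v σ) d id id

  0≤χ : (π : Permutation′ k) (v : Fin k → Fin n) (σ : Permutation′ n) → 0ℚ ≤ χ π v σ
  0≤χ π v σ = 0≤𝟙 (matches? π v σ)

  χ≤1 : (π : Permutation′ k) (v : Fin k → Fin n) (σ : Permutation′ n) → χ π v σ ≤ 1ℚ
  χ≤1 π v σ = 𝟙≤1 (matches? π v σ)

  χ-cong : {π : Permutation′ k} {v : Fin k → Fin m} {σ : Permutation′ m}
           {ρ : Permutation′ l} {w : Fin l → Fin n} {τ : Permutation′ n} →
           (Matches π v σ → Matches ρ w τ) → (Matches ρ w τ → Matches π v σ) → χ π v σ ≡ χ ρ w τ
  χ-cong {π = π} {v} {σ} {ρ} {w} {τ} = 𝟙-cong (matches? π v σ) (matches? ρ w τ)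

  χ-cong-* : {π : Permutation′ k} {v : Fin k → Fin n} {σ : Permutation′ n} {p q : ℚ} →
    (Matches π v σ → p ≡ q) → χ π v σ * p ≡ χ π v σ * q
  χ-cong-* {π = π} {v} {σ} = 𝟙-cong-* (matches? π v σ)

  χ-mono-* : {π : Permutation′ k} {v : Fin k → Fin n} {σ : Permutation′ n} {p q : ℚ} →
    (Matches π v σ → p ≤ q) → 0ℚ ≤ q → χ π v σ * p ≤ q
  χ-mono-* {π = π} {v} {σ} {p} p≤q q≥0 with matches? π v σ
  ... | yes m = ℚ.≤-trans (ℚ.≤-reflexive (ℚ.*-identityˡ p)) (p≤q m)
  ... | no  _ = ℚ.≤-trans (ℚ.≤-reflexive (ℚ.*-zeroˡ p)) q≥0

χ-cong-σ : (π : Permutation′ k) (v : Fin k → Fin n) → Respects≈ (χ π v)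
χ-cong-σ π v {σ} {τ} e = χ-cong (half {σ} {τ} e) (half {τ} {σ} (λ i → sym (e i)))
  where
  half : ∀ {σ τ} → σ ≈ τ → Matches π v σ → Matches π v τ
  half e m r s rewrite sym (e (v r)) | sym (e (v s)) = m r s

χ-cong-π : {π ρ : Permutation′ k} (v : Fin k → Fin n) (σ : Permutation′ n) → π ≈ ρ → χ π v σ ≡ χ ρ v σ
χ-cong-π {π = π} {ρ} v σ e = χ-cong (half {π} {ρ} e) (half {ρ} {π} (λ i → sym (e i)))
  where
  half : ∀ {π ρ} → π ≈ ρ → Matches π v σ → Matches ρ v σ
  half e m r s rewrite sym (e r) | sym (e s) = m r s

Injective : (Fin k → Fin n) → Set
Injective v = ∀ r s → v r ≡ v s → r ≡ s

transpose-left : (i j : Fin n) → transpose i j ⟨$⟩ʳ i ≡ j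
transpose-left i j rewrite dec-true (i Fin.≟ i) refl = refl

transpose-right : (i j : Fin n) → transpose i j ⟨$⟩ʳ j ≡ i
transpose-right i j with j Fin.≟ i
... | yes j≡i = j≡i
... | no  _ rewrite dec-true (j Fin.≟ j) refl = refl

transpose-other : {i j l : Fin n} → l ≢ i → l ≢ j → transpose i j ⟨$⟩ʳ l ≡ l
transpose-other {i = i} {j} {l} l≢i l≢j
  rewrite dec-false (l Fin.≟ i) l≢i | dec-false (l Fin.≟ j) l≢j = refl

transpose-image : {v : Fin k → Fin n} → Injective v → ∀ a b r →
  transpose (v a) (v b) ⟨$⟩ʳ v r ≡ v (transpose a b ⟨$⟩ʳ r)
transpose-image {v = v} inj a b r with r Fin.≟ a
... | yes refl = transpose-left (v r) (v b)
... | no r≢a with r Fin.≟ b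
...   | yes refl = transpose-right (v a) (v r)
...   | no r≢b   = transpose-other (r≢a ∘ inj r a) (r≢b ∘ inj r b)

-- On the positions `v` the permutation `ρ` acts as `t` does on the roles, so both sides compare the
-- same letters under renamed roles.
χ-transport : {v : Fin k → Fin n} (π t : Permutation′ k) (ρ σ : Permutation′ n) →
  (∀ r → ρ ⟨$⟩ʳ v r ≡ v (t ⟨$⟩ʳ r)) → χ (t ∘ₚ π) v (ρ ∘ₚ σ) ≡ χ π v σ
χ-transport {v = v} π t ρ σ e = χ-cong forth back
  where
  back : Matches π v σ → Matches (t ∘ₚ π) v (ρ ∘ₚ σ)
  back m r s rewrite e r | e s = m (t ⟨$⟩ʳ r) (t ⟨$⟩ʳ s)
  e⁻¹ : ∀ r → ρ ⟨$⟩ʳ v (t ⟨$⟩ˡ r) ≡ v r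
  e⁻¹ r = trans (e (t ⟨$⟩ˡ r)) (cong v (Perm.inverseʳ t))
  forth : Matches (t ∘ₚ π) v (ρ ∘ₚ σ) → Matches π v σ
  forth m r s with m (t ⟨$⟩ˡ r) (t ⟨$⟩ˡ s)
  ... | h rewrite e⁻¹ r | e⁻¹ s | Perm.inverseʳ t {r} | Perm.inverseʳ t {s} = h

-- Standardization

strictlyMonotone⇒≤ : (f : Fin k → Fin k) → (∀ {i j} → i Fin.< j → f i Fin.< f j) → ∀ i → toℕ i ℕ.≤ toℕ (f i)
strictlyMonotone⇒≤ f mono i = go (toℕ i) i refl
  where
  go : ∀ m i → toℕ i ≡ m → toℕ i ℕ.≤ toℕ (f i)
  go _       Fin.zero    _    = ℕ.z≤n
  go (suc m) (Fin.suc i) refl = ℕ.≤-<-trans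
    (subst (ℕ._≤ toℕ (f (Fin.inject₁ i))) (Fin.toℕ-inject₁ i) (go m (Fin.inject₁ i) (Fin.toℕ-inject₁ i)))
    (mono (ℕ.s≤s (ℕ.≤-reflexive (Fin.toℕ-inject₁ i))))

-- Both ρ π⁻¹ and π ρ⁻¹ are strictly increasing self-maps of a finite chain, hence lie above the
-- identity.
sameOrder⇒≈ : (π ρ : Permutation′ k) →
  (∀ r s → (π ⟨$⟩ʳ r) Fin.< (π ⟨$⟩ʳ s) ⇔ (ρ ⟨$⟩ʳ r) Fin.< (ρ ⟨$⟩ʳ s)) → π ≈ ρ
sameOrder⇒≈ π ρ same r = Fin.toℕ-injective (ℕ.≤-antisym
  (half π ρ (λ r s → Equivalence.to (same r s)) r) (half ρ π (λ r s → Equivalence.from (same r s)) r))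
  where
  half : ∀ π ρ → (∀ r s → (π ⟨$⟩ʳ r) Fin.< (π ⟨$⟩ʳ s) → (ρ ⟨$⟩ʳ r) Fin.< (ρ ⟨$⟩ʳ s)) →
         ∀ r → toℕ (π ⟨$⟩ʳ r) ℕ.≤ toℕ (ρ ⟨$⟩ʳ r)
  half π ρ h r = subst (λ s → toℕ (π ⟨$⟩ʳ r) ℕ.≤ toℕ (ρ ⟨$⟩ʳ s)) (Perm.inverseˡ π)
    (strictlyMonotone⇒≤ (λ i → ρ ⟨$⟩ʳ (π ⟨$⟩ˡ i))
      (λ {i} {j} i<j → h _ _ (subst₂ Fin._<_ (sym (Perm.inverseʳ π)) (sym (Perm.inverseʳ π)) i<j))
      (π ⟨$⟩ʳ r))

punchIn-<⇔ : (v : Fin (suc n)) (i j : Fin n) → i Fin.< j ⇔ punchIn v i Fin.< punchIn v j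
punchIn-<⇔ v i j = mk⇔
  (λ i<j → ℕ.≰⇒> (λ le → ℕ.<⇒≱ i<j (Fin.punchIn-cancel-≤ v j i le)))
  (λ lt → ℕ.≰⇒> (λ le → ℕ.<⇒≱ lt (Fin.punchIn-mono-≤ v j i le)))

punchIn<⇔ : (v : Fin (suc n)) (i : Fin n) → toℕ i ℕ.< toℕ v ⇔ punchIn v i Fin.< v
punchIn<⇔ Fin.zero    i           = mk⇔ (λ ()) (λ ())
punchIn<⇔ (Fin.suc v) Fin.zero    = mk⇔ (λ _ → ℕ.s≤s ℕ.z≤n) (λ _ → ℕ.s≤s ℕ.z≤n)
punchIn<⇔ (Fin.suc v) (Fin.suc i) = mk⇔
  (ℕ.s≤s ∘ Equivalence.to (punchIn<⇔ v i) ∘ ℕ.s≤s⁻¹)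
  (ℕ.s≤s ∘ Equivalence.from (punchIn<⇔ v i) ∘ ℕ.s≤s⁻¹)

threshold : {Q : Fin k → Set} → Decidable Q → (∀ {i j} → i Fin.≤ j → Q j → Q i) →
  ∃ λ (t : Fin (suc k)) → ∀ i → Q i ⇔ toℕ i ℕ.< toℕ t
threshold {zero}  Q? down = Fin.zero , λ ()
threshold {suc k} Q? down with Q? Fin.zero
... | no ¬q = Fin.zero , λ i → mk⇔ (λ q → contradiction (down ℕ.z≤n q) ¬q) (λ ())
... | yes q with threshold (Q? ∘ Fin.suc) (down ∘ ℕ.s≤s)
...   | t , h = Fin.suc t , λ
  { Fin.zero    → mk⇔ (λ _ → ℕ.s≤s ℕ.z≤n) (λ _ → q)
  ; (Fin.suc i) → mk⇔ (ℕ.s≤s ∘ Equivalence.to (h i)) (Equivalence.from (h i) ∘ ℕ.s≤s⁻¹) }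

-- The tail is standardized to `τ` first. The ranks of the tail values below `g Fin.zero` form an
-- initial segment, and its length `t` is the rank at which the first letter is inserted.
standardize : (g : Fin k → Fin n) → Injective g →
  ∃ λ (τ : Permutation′ k) → ∀ r s → (τ ⟨$⟩ʳ r) Fin.< (τ ⟨$⟩ʳ s) ⇔ g r Fin.< g s
standardize {zero}  g inj = Perm.id , λ ()
standardize {suc k} g inj = insert Fin.zero t τ , order
  where
  rest = standardize (g ∘ Fin.suc) (λ r s → Fin.suc-injective ∘ inj (Fin.suc r) (Fin.suc s))
  τ = proj₁ rest
  τ-order = proj₂ rest
  Below : Fin k → Set
  Below i = g (Fin.suc (τ ⟨$⟩ˡ i)) Fin.< g Fin.zero
  down : ∀ {i j} → i Fin.≤ j → Below j → Below i
  down {i} {j} i≤j q with i Fin.≟ j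
  ... | yes refl = q
  ... | no i≢j   = ℕ.<-trans (Equivalence.to (τ-order (τ ⟨$⟩ˡ i) (τ ⟨$⟩ˡ j))
    (subst₂ Fin._<_ (sym (Perm.inverseʳ τ)) (sym (Perm.inverseʳ τ)) (ℕ.≤∧≢⇒< i≤j (i≢j ∘ Fin.toℕ-injective)))) q
  split = threshold (λ i → g (Fin.suc (τ ⟨$⟩ˡ i)) Fin.<? g Fin.zero) down
  t = proj₁ split
  below : ∀ r → toℕ (τ ⟨$⟩ʳ r) ℕ.< toℕ t ⇔ g (Fin.suc r) Fin.< g Fin.zero
  below r = mk⇔
    (subst (λ r → g (Fin.suc r) Fin.< g Fin.zero) (Perm.inverseˡ τ) ∘ Equivalence.from (proj₂ split (τ ⟨$⟩ʳ r)))
    (Equivalence.to (proj₂ split (τ ⟨$⟩ʳ r)) ∘ subst (λ r → g (Fin.suc r) Fin.< g Fin.zero) (sym (Perm.inverseˡ τ)))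
  order : ∀ r s → (insert Fin.zero t τ ⟨$⟩ʳ r) Fin.< (insert Fin.zero t τ ⟨$⟩ʳ s) ⇔ g r Fin.< g s
  order Fin.zero    Fin.zero    = mk⇔ (λ lt → contradiction lt (ℕ.<-irrefl refl)) (λ lt → contradiction lt (ℕ.<-irrefl refl))
  order Fin.zero    (Fin.suc s) = mk⇔
    (λ lt → ℕ.≤∧≢⇒< (ℕ.≮⇒≥ (ℕ.<-asym lt ∘ Equivalence.to (punchIn<⇔ t (τ ⟨$⟩ʳ s)) ∘ Equivalence.from (below s)))
                    (λ e → case (inj _ _ (Fin.toℕ-injective e))))
    (λ lt → ℕ.≤∧≢⇒< (ℕ.≮⇒≥ (ℕ.<-asym lt ∘ Equivalence.to (below s) ∘ Equivalence.from (punchIn<⇔ t (τ ⟨$⟩ʳ s))))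
                    (λ e → Fin.punchInᵢ≢i t (τ ⟨$⟩ʳ s) (sym (Fin.toℕ-injective e))))
    where
    case : ∀ {s : Fin k} → ¬ (Fin.zero ≡ Fin.suc s)
    case ()
  order (Fin.suc r) Fin.zero    = mk⇔
    (Equivalence.to (below r) ∘ Equivalence.from (punchIn<⇔ t (τ ⟨$⟩ʳ r)))
    (Equivalence.to (punchIn<⇔ t (τ ⟨$⟩ʳ r)) ∘ Equivalence.from (below r))
  order (Fin.suc r) (Fin.suc s) = mk⇔
    (Equivalence.to (τ-order r s) ∘ Equivalence.from (punchIn-<⇔ t (τ ⟨$⟩ʳ r) (τ ⟨$⟩ʳ s)))
    (Equivalence.to (punchIn-<⇔ t (τ ⟨$⟩ʳ r) (τ ⟨$⟩ʳ s)) ∘ Equivalence.from (τ-order r s))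

-- The only pattern that matches is the standardization of the letters at `v`.
∑-χ≡1 : {v : Fin k → Fin n} → Injective v → ∀ σ → ∑ (permutations k) (λ π → χ π v σ) ≡ 1ℚ
∑-χ≡1 {k} {v = v} inj σ = trans
  (∑-cong (permutations k) (λ π → trans (χ-𝟙 π v σ (matches? π v σ))
    (𝟙-cong (matches? π v σ) (τ ≈? π) (λ m → unique π m) (exists π))))
  (∑-perm-unique τ)
  where
  std = standardize (λ r → σ ⟨$⟩ʳ v r) (λ r s e → inj r s (perm-injective σ e))
  τ = proj₁ std
  unique : ∀ π → Matches π v σ → τ ≈ π
  unique π m = sameOrder⇒≈ τ π (λ r s → mk⇔
    (Equivalence.from (m r s) ∘ Equivalence.to (proj₂ std r s))
    (Equivalence.from (proj₂ std r s) ∘ Equivalence.to (m r s)))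
  exists : ∀ π → τ ≈ π → Matches π v σ
  exists π e r s rewrite sym (e r) | sym (e s) = proj₂ std r s

-- The pattern at v is uniform and independent of every F that does not depend on
-- the order of the letters at v: permuting these letters transforms any pattern
-- into any other without changing F.
SymmetricOn : (Fin k → Fin n) → (Permutation′ n → ℚ) → Set
SymmetricOn v F = ∀ a b σ → F (transpose (v a) (v b) ∘ₚ σ) ≡ F σ

𝔼-χ-* : {v : Fin k → Fin n} → Injective v → {F : Permutation′ n → ℚ} → Respects≈ F → SymmetricOn v F →
  ∀ π → 𝔼 (λ σ → χ π v σ * F σ) ≡ 1/ k ! * 𝔼 F
𝔼-χ-* {k} {n} {v} inj {F} resp symm π = begin
  e π                                     ≡⟨ ℚ.*-identityˡ (e π) ⟨
  1ℚ * e π                                ≡⟨ cong (_* e π) (n!*1/n!≡1 k) ⟨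
  fromℕ (k !) * 1/ k ! * e π              ≡⟨ S.solve 3 (λ a b c → a :* b :* c := b :* (a :* c)) refl (fromℕ (k !)) (1/ k !) (e π) ⟩
  1/ k ! * (fromℕ (k !) * e π)            ≡⟨ cong (λ l → 1/ k ! * (fromℕ l * e π)) (length-permutations k) ⟨
  1/ k ! * (fromℕ (length (permutations k)) * e π) ≡⟨ cong (1/ k ! *_) (∑-const (permutations k) (e π)) ⟨
  1/ k ! * ∑ (permutations k) (λ _ → e π) ≡⟨ cong (1/ k ! *_) (∑-cong (permutations k) (λ ρ → trans (e≡e-id π) (sym (e≡e-id ρ)))) ⟩
  1/ k ! * ∑ (permutations k) e           ≡⟨ cong (1/ k ! *_) (𝔼-∑ (permutations k) (λ ρ σ → χ ρ v σ * F σ)) ⟨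
  1/ k ! * 𝔼 (λ σ → ∑ (permutations k) (λ ρ → χ ρ v σ * F σ)) ≡⟨ cong (1/ k ! *_) (𝔼-cong (λ σ →
                                               trans (∑-*ʳ (permutations k) (F σ) (λ ρ → χ ρ v σ))
                                               (trans (cong (_* F σ) (∑-χ≡1 inj σ)) (ℚ.*-identityˡ (F σ))))) ⟩
  1/ k ! * 𝔼 F                            ∎
  where
  open ≡-Reasoning
  e : Permutation′ k → ℚ
  e π = 𝔼 (λ σ → χ π v σ * F σ)
  e-transpose : ∀ a b π → e (transpose a b ∘ₚ π) ≡ e π
  e-transpose a b π = trans
    (sym (𝔼-∘ₚ ρ {λ σ → χ (t ∘ₚ π) v σ * F σ} (λ {σ} {τ} eq → cong₂ _*_ (χ-cong-σ (t ∘ₚ π) v {σ} {τ} eq) (resp {σ} {τ} eq))))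
    (𝔼-cong (λ σ → cong₂ _*_ (χ-transport π t ρ σ (transpose-image inj a b)) (symm a b σ)))
    where
    t = transpose a b
    ρ = transpose (v a) (v b)
  -- Transpositions generate all permutations, so `e` is constant; its k ! equal values add up to
  -- `𝔼 F` because some pattern always occurs at `v`.
  e-eval : ∀ ts → e (eval ts) ≡ e Perm.id
  e-eval []             = refl
  e-eval ((a , b) ∷ ts) = trans (e-transpose a b (eval ts)) (e-eval ts)
  e≡e-id : ∀ π → e π ≡ e Perm.id
  e≡e-id π = trans
    (𝔼-cong (λ σ → cong (_* F σ) (χ-cong-π v σ (≈-sym {σ = eval (decompose π)} {π} (eval-decompose π)))))
    (e-eval (decompose π))

𝔼-χ : {v : Fin k → Fin n} → Injective v → ∀ π → 𝔼 (χ π v) ≡ 1/ k !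
𝔼-χ {k} {n} {v} inj π = trans (𝔼-cong (λ σ → sym (ℚ.*-identityʳ (χ π v σ))))
  (trans (𝔼-χ-* inj {λ _ → 1ℚ} (λ _ → refl) (λ _ _ _ → refl) π)
  (trans (cong (1/ k ! *_) (𝔼-const {n} 1ℚ)) (ℚ.*-identityʳ (1/ k !))))

-- Transpositions of positions in `v` fix every letter at `w`, so the indicator at `w` is an
-- admissible factor in `𝔼-χ-*`.
𝔼-χ-χ : {v : Fin k → Fin n} {w : Fin l → Fin n} → Injective v → Injective w →
  (∀ r s → v r ≢ w s) → ∀ π ρ → 𝔼 (λ σ → χ π v σ * χ ρ w σ) ≡ 1/ k ! * 1/ l !
𝔼-χ-χ {k} {v = v} {w} v-inj w-inj disjoint π ρ = trans
  (𝔼-χ-* v-inj {χ ρ w} (χ-cong-σ ρ w) fixed π)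
  (cong (1/ k ! *_) (𝔼-χ w-inj ρ))
  where
  fixed : SymmetricOn v (χ ρ w)
  fixed a b σ = χ-cong
    (λ m r s → subst₂ (λ i j → _ ⇔ (σ ⟨$⟩ʳ i) Fin.< (σ ⟨$⟩ʳ j)) (t-fixes r) (t-fixes s) (m r s))
    (λ m r s → subst₂ (λ i j → _ ⇔ (σ ⟨$⟩ʳ i) Fin.< (σ ⟨$⟩ʳ j)) (sym (t-fixes r)) (sym (t-fixes s)) (m r s))
    where
    t-fixes : ∀ s → transpose (v a) (v b) ⟨$⟩ʳ w s ≡ w s
    t-fixes s = transpose-other (disjoint a s ∘ sym) (disjoint b s ∘ sym)

χ-insert : (π : Permutation′ k) {v : Fin k → Fin (suc n)} {w : Fin k → Fin n} (p i : Fin (suc n)) (τ : Permutation′ n) →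
  (∀ r → v r ≡ punchIn p (w r)) → χ π v (insert p i τ) ≡ χ π w τ
χ-insert π {v} {w} p i τ e = χ-cong
  (λ m r s → mk⇔
    (Equivalence.from (order r s) ∘ Equivalence.to (m r s))
    (Equivalence.from (m r s) ∘ Equivalence.to (order r s)))
  (λ m r s → mk⇔
    (Equivalence.to (order r s) ∘ Equivalence.to (m r s))
    (Equivalence.from (m r s) ∘ Equivalence.from (order r s)))
  where
  value : ∀ r → insert p i τ ⟨$⟩ʳ v r ≡ punchIn i (τ ⟨$⟩ʳ w r)
  value r = trans (cong (insert p i τ ⟨$⟩ʳ_) (e r)) (Perm.insert-punchIn p i τ (w r))
  order : ∀ r s → (τ ⟨$⟩ʳ w r) Fin.< (τ ⟨$⟩ʳ w s) ⇔ (insert p i τ ⟨$⟩ʳ v r) Fin.< (insert p i τ ⟨$⟩ʳ v s)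
  order r s rewrite value r | value s = punchIn-<⇔ i (τ ⟨$⟩ʳ w r) (τ ⟨$⟩ʳ w s)

cancel-fromℕ : ∀ n {p q} → fromℕ (suc n) * p ≡ fromℕ (suc n) * q → p ≡ q
cancel-fromℕ n {p} {q} e = ℚ.≤-antisym (half e) (half (sym e))
  where
  half : ∀ {p q} → fromℕ (suc n) * p ≡ fromℕ (suc n) * q → p ≤ q
  half e = ℚ.*-cancelˡ-≤-pos (fromℕ (suc n)) {{ℚ.positive (0<fromℕ {suc n})}} (ℚ.≤-reflexive e)

-- Neither pattern looks at position `p`. Conditioned on any value of the letter there, the rest is
-- a uniform permutation one size smaller in which both patterns keep their relative order.
𝔼-χ-punchIn : (π : Permutation′ k) (ρ : Permutation′ l) (p : Fin (suc n))
  {v : Fin k → Fin (suc n)} {w : Fin k → Fin n} {v′ : Fin l → Fin (suc n)} {w′ : Fin l → Fin n} →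
  (∀ r → v r ≡ punchIn p (w r)) → (∀ r → v′ r ≡ punchIn p (w′ r)) →
  𝔼 (λ σ → χ π v σ * χ ρ v′ σ) ≡ 𝔼 (λ τ → χ π w τ * χ ρ w′ τ)
𝔼-χ-punchIn {n = n} π ρ p {v} {w} {v′} {w′} e e′ = cancel-fromℕ n (begin
  fromℕ (suc n) * 𝔼 F                             ≡⟨ 𝔼-insert p {F} (λ {σ} {τ} e → cong₂ _*_ (χ-cong-σ π v {σ} {τ} e) (χ-cong-σ ρ v′ {σ} {τ} e)) ⟨
  ∑Fin (suc n) (λ i → 𝔼 (λ τ → F (insert p i τ))) ≡⟨ ∑-cong (allFin (suc n)) (λ i → 𝔼-cong (λ τ → cong₂ _*_ (χ-insert π p i τ e) (χ-insert ρ p i τ e′))) ⟩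
  ∑Fin (suc n) (λ _ → 𝔼 G)                        ≡⟨ ∑Fin-const (suc n) (𝔼 G) ⟩
  fromℕ (suc n) * 𝔼 G                             ∎)
  where
  open ≡-Reasoning
  F = λ σ → χ π v σ * χ ρ v′ σ
  G = λ τ → χ π w τ * χ ρ w′ τ

∑-cong-All : {R : I → Set} {xs : List I} → All R xs → {f g : I → ℚ} → (∀ x → R x → f x ≡ g x) → ∑ xs f ≡ ∑ xs g
∑-cong-All []       f≡g = refl
∑-cong-All (r ∷ rs) f≡g = cong₂ _+_ (f≡g _ r) (∑-cong-All rs f≡g)

∑-mono-All : {R : I → Set} {xs : List I} → All R xs → {f g : I → ℚ} → (∀ x → R x → f x ≤ g x) → ∑ xs f ≤ ∑ xs g
∑-mono-All []       f≤g = ℚ.≤-refl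
∑-mono-All (r ∷ rs) f≤g = ℚ.+-mono-≤ (f≤g _ r) (∑-mono-All rs f≤g)

-- Increasing position vectors

-- The entries of bs say which of the k positions are forced to be adjacent to their
-- predecessors (for the first entry: to be 0).
shift : Vec (Fin n) k → Vec (Fin (suc n)) k
shift = Vec.map Fin.suc

zero∷ : Vec (Fin n) k → Vec (Fin (suc n)) (suc k)
zero∷ v = Fin.zero ∷ shift v

-- Recursion on n strips position 0, which is taken by the first entry or, if that entry is free,
-- possibly skipped. Once an entry has been placed, the frame begins right behind it, so being
-- adjacent to the predecessor becomes being 0.
positions : Vec Bool k → ∀ n → List (Vec (Fin n) k)
positions []           n       = [] ∷ []
positions (b ∷ bs)     zero    = []
positions (true ∷ bs)  (suc n) = map zero∷ (positions bs n)
positions (false ∷ bs) (suc n) = map shift (positions (false ∷ bs) n) ++ map zero∷ (positions bs n)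

∑-positions-forced : (bs : Vec Bool k) (f : Vec (Fin (suc n)) (suc k) → ℚ) →
  ∑ (positions (true ∷ bs) (suc n)) f ≡ ∑ (positions bs n) (f ∘ zero∷)
∑-positions-forced {n = n} bs f = ∑-map zero∷ (positions bs n) f

∑-positions-free : (bs : Vec Bool k) (f : Vec (Fin (suc n)) (suc k) → ℚ) →
  ∑ (positions (false ∷ bs) (suc n)) f ≡ ∑ (positions (false ∷ bs) n) (f ∘ shift) + ∑ (positions bs n) (f ∘ zero∷)
∑-positions-free {n = n} bs f = trans
  (∑-++ (map shift (positions (false ∷ bs) n)) (map zero∷ (positions bs n)) f)
  (cong₂ _+_ (∑-map shift (positions (false ∷ bs) n) f) (∑-map zero∷ (positions bs n) f))

InjectiveVec : Vec (Fin n) k → Set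
InjectiveVec v = Injective (lookup v)

shift-injective : (v : Vec (Fin n) k) → InjectiveVec v → InjectiveVec (shift v)
shift-injective v inj r s e rewrite Vec.lookup-map r Fin.suc v | Vec.lookup-map s Fin.suc v =
  inj r s (Fin.suc-injective e)

zero≢shift : (v : Vec (Fin n) k) (r : Fin k) → Fin.zero ≢ lookup (shift v) r
zero≢shift v r e rewrite Vec.lookup-map r Fin.suc v with () ← e

zero∷-injective : (v : Vec (Fin n) k) → InjectiveVec v → InjectiveVec (zero∷ v)
zero∷-injective v inj Fin.zero    Fin.zero    e = refl
zero∷-injective v inj Fin.zero    (Fin.suc s) e = contradiction e (zero≢shift v s)
zero∷-injective v inj (Fin.suc r) Fin.zero    e = contradiction (sym e) (zero≢shift v r)
zero∷-injective v inj (Fin.suc r) (Fin.suc s) e = cong Fin.suc (shift-injective v inj r s e)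

positions-injective : (bs : Vec Bool k) (n : ℕ) → All InjectiveVec (positions bs n)
positions-injective []           n       = (λ ()) ∷ []
positions-injective (b ∷ bs)     zero    = []
positions-injective (true ∷ bs)  (suc n) = All.map⁺ (All.map (λ {v} → zero∷-injective v) (positions-injective bs n))
positions-injective (false ∷ bs) (suc n) = All.++⁺
  (All.map⁺ (All.map (λ {v} → shift-injective v) (positions-injective (false ∷ bs) n)))
  (All.map⁺ (All.map (λ {v} → zero∷-injective v) (positions-injective bs n)))

-- Pairs of position vectors

Family : ℕ → ℕ → Set
Family k l = ∀ n → Vec (Fin n) k → Vec (Fin n) l → ℚ

-- Encodes dependence on the relative order of the two vectors only, as invariance under creating a
-- position `p` that neither of them uses.
Stable : Family k l → Set
Stable F = ∀ {n} (p : Fin (suc n)) v w → F (suc n) (Vec.map (punchIn p) v) (Vec.map (punchIn p) w) ≡ F n v w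

VanishesOnDisjoint : Family k l → Set
VanishesOnDisjoint F = ∀ {n} v w → InjectiveVec v → InjectiveVec w → (∀ r s → lookup v r ≢ lookup w s) → F n v w ≡ 0ℚ

-- These three derived families describe the pairs in which position 0 is used by the left vector,
-- by the right one, or by both.
∂ˡ : Family (suc k) l → Family k l
∂ˡ F n v w = F (suc n) (zero∷ v) (shift w)

∂ʳ : Family k (suc l) → Family k l
∂ʳ F n v w = F (suc n) (shift v) (zero∷ w)

∂ᵇ : Family (suc k) (suc l) → Family k l
∂ᵇ F n v w = F (suc n) (zero∷ v) (zero∷ w)

shift-punchIn : (p : Fin (suc n)) (v : Vec (Fin n) k) →
  shift (Vec.map (punchIn p) v) ≡ Vec.map (punchIn (Fin.suc p)) (shift v)
shift-punchIn p v = trans (sym (Vec.map-∘ Fin.suc (punchIn p) v)) (Vec.map-∘ (punchIn (Fin.suc p)) Fin.suc v)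

zero∷-punchIn : (p : Fin (suc n)) (v : Vec (Fin n) k) →
  zero∷ (Vec.map (punchIn p) v) ≡ Vec.map (punchIn (Fin.suc p)) (zero∷ v)
zero∷-punchIn p v = cong (Fin.zero ∷_) (shift-punchIn p v)

module _ {F : Family (suc k) l} where

  ∂ˡ-stable : Stable F → Stable (∂ˡ F)
  ∂ˡ-stable stable p v w = trans (cong₂ (F _) (zero∷-punchIn p v) (shift-punchIn p w)) (stable (Fin.suc p) (zero∷ v) (shift w))

  ∂ˡ-vanishes : VanishesOnDisjoint F → VanishesOnDisjoint (∂ˡ F)
  ∂ˡ-vanishes vanishes v w v-inj w-inj disjoint = vanishes (zero∷ v) (shift w)
    (zero∷-injective v v-inj) (shift-injective w w-inj)
    λ { Fin.zero    s e → zero≢shift w s e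
      ; (Fin.suc r) s e → disjoint r s (Fin.suc-injective
          (trans (sym (Vec.lookup-map r Fin.suc v)) (trans e (Vec.lookup-map s Fin.suc w)))) }

module _ {F : Family k (suc l)} where

  ∂ʳ-stable : Stable F → Stable (∂ʳ F)
  ∂ʳ-stable stable p v w = trans (cong₂ (F _) (shift-punchIn p v) (zero∷-punchIn p w)) (stable (Fin.suc p) (shift v) (zero∷ w))

  ∂ʳ-vanishes : VanishesOnDisjoint F → VanishesOnDisjoint (∂ʳ F)
  ∂ʳ-vanishes vanishes v w v-inj w-inj disjoint = vanishes (shift v) (zero∷ w)
    (shift-injective v v-inj) (zero∷-injective w w-inj)
    λ { r Fin.zero    e → zero≢shift v r (sym e)
      ; r (Fin.suc s) e → disjoint r s (Fin.suc-injective
          (trans (sym (Vec.lookup-map r Fin.suc v)) (trans e (Vec.lookup-map s Fin.suc w)))) }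

∂ᵇ-stable : {F : Family (suc k) (suc l)} → Stable F → Stable (∂ᵇ F)
∂ᵇ-stable {F = F} stable p v w = trans (cong₂ (F _) (zero∷-punchIn p v) (zero∷-punchIn p w)) (stable (Fin.suc p) (zero∷ v) (zero∷ w))

-- Double sums over position vectors as eventually polynomial sequences

PairSum : Family k l → Vec Bool k → Vec Bool l → ℕ → ℚ
PairSum F bs cs n = ∑ (positions bs n) (λ v → ∑ (positions cs n) (F n v))

module _ {F : Family k (suc l)} (bs : Vec Bool k) (cs : Vec Bool l) (n : ℕ) where

  ∑-right-free : (xs : List I) (g : I → Vec (Fin (suc n)) k) →
    ∑ xs (λ x → ∑ (positions (false ∷ cs) (suc n)) (F (suc n) (g x)))
    ≡ ∑ xs (λ x → ∑ (positions (false ∷ cs) n) (F (suc n) (g x) ∘ shift)) + ∑ xs (λ x → ∑ (positions cs n) (F (suc n) (g x) ∘ zero∷))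
  ∑-right-free xs g = trans
    (∑-cong xs (λ x → ∑-positions-free cs (F (suc n) (g x))))
    (∑-+ xs (λ x → ∑ (positions (false ∷ cs) n) (F (suc n) (g x) ∘ shift)) (λ x → ∑ (positions cs n) (F (suc n) (g x) ∘ zero∷)))

module _ {F : Family k l} (stable : Stable F) where

  ∑-shift-shift : (bs : Vec Bool k) (cs : Vec Bool l) (n : ℕ) →
    ∑ (positions bs n) (λ v → ∑ (positions cs n) (λ w → F (suc n) (shift v) (shift w))) ≡ PairSum F bs cs n
  ∑-shift-shift bs cs n = ∑-cong (positions bs n) (λ v → ∑-cong (positions cs n) (λ w → stable Fin.zero v w))

module _ {F : Family 0 (suc l)} (cs : Vec Bool l) (n : ℕ) where

  step-[]-free : Stable F → PairSum F [] (false ∷ cs) (suc n) ≡ PairSum F [] (false ∷ cs) n + PairSum (∂ʳ F) [] cs n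
  step-[]-free stable = trans
    (∑-right-free {F = F} [] cs n ([] ∷ []) id)
    (cong (_+ PairSum (∂ʳ F) [] cs n) (∑-shift-shift {F = F} stable [] (false ∷ cs) n))

  step-[]-forced : PairSum F [] (true ∷ cs) (suc n) ≡ PairSum (∂ʳ F) [] cs n
  step-[]-forced = cong (_+ 0ℚ) (∑-positions-forced cs (F (suc n) []))

module _ {F : Family (suc k) 0} (bs : Vec Bool k) (n : ℕ) where

  step-free-[] : Stable F → PairSum F (false ∷ bs) [] (suc n) ≡ PairSum F (false ∷ bs) [] n + PairSum (∂ˡ F) bs [] n
  step-free-[] stable = trans
    (∑-positions-free bs (λ v → F (suc n) v [] + 0ℚ))
    (cong (_+ PairSum (∂ˡ F) bs [] n) (∑-shift-shift {F = F} stable (false ∷ bs) [] n))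

  step-forced-[] : PairSum F (true ∷ bs) [] (suc n) ≡ PairSum (∂ˡ F) bs [] n
  step-forced-[] = ∑-positions-forced bs (λ v → F (suc n) v [] + 0ℚ)

module _ {F : Family (suc k) (suc l)} (bs : Vec Bool k) (cs : Vec Bool l) (n : ℕ) where

  -- The pairs are classified by the use of position 0. If neither vector uses it, stability removes
  -- it and the sum for n reappears, which makes this a difference equation.
  step-free-free : Stable F → PairSum F (false ∷ bs) (false ∷ cs) (suc n)
    ≡ PairSum F (false ∷ bs) (false ∷ cs) n
      + (PairSum (∂ʳ F) (false ∷ bs) cs n + (PairSum (∂ˡ F) bs (false ∷ cs) n + PairSum (∂ᵇ F) bs cs n))
  step-free-free stable = begin
    PairSum F (false ∷ bs) (false ∷ cs) (suc n)
      ≡⟨ ∑-positions-free bs (λ v → ∑ (positions (false ∷ cs) (suc n)) (F (suc n) v)) ⟩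
    ∑ (positions (false ∷ bs) n) (λ v → ∑ (positions (false ∷ cs) (suc n)) (F (suc n) (shift v)))
      + ∑ (positions bs n) (λ v → ∑ (positions (false ∷ cs) (suc n)) (F (suc n) (zero∷ v)))
      ≡⟨ cong₂ _+_ (∑-right-free {F = F} (false ∷ bs) cs n (positions (false ∷ bs) n) shift)
                   (∑-right-free {F = F} (false ∷ bs) cs n (positions bs n) zero∷) ⟩
    (∑ (positions (false ∷ bs) n) (λ v → ∑ (positions (false ∷ cs) n) (λ w → F (suc n) (shift v) (shift w))) + R) + (L + B)
      ≡⟨ cong (λ s → (s + R) + (L + B)) (∑-shift-shift {F = F} stable (false ∷ bs) (false ∷ cs) n) ⟩
    (PairSum F (false ∷ bs) (false ∷ cs) n + R) + (L + B)
      ≡⟨ ℚ.+-assoc (PairSum F (false ∷ bs) (false ∷ cs) n) R (L + B) ⟩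
    PairSum F (false ∷ bs) (false ∷ cs) n + (R + (L + B)) ∎
    where
    open ≡-Reasoning
    R = PairSum (∂ʳ F) (false ∷ bs) cs n
    L = PairSum (∂ˡ F) bs (false ∷ cs) n
    B = PairSum (∂ᵇ F) bs cs n

  step-free-forced : PairSum F (false ∷ bs) (true ∷ cs) (suc n)
    ≡ PairSum (∂ʳ F) (false ∷ bs) cs n + PairSum (∂ᵇ F) bs cs n
  step-free-forced = trans
    (∑-cong (positions (false ∷ bs) (suc n)) (λ v → ∑-positions-forced cs (F (suc n) v)))
    (∑-positions-free bs (λ v → ∑ (positions cs n) (F (suc n) v ∘ zero∷)))

  step-forced-free : PairSum F (true ∷ bs) (false ∷ cs) (suc n)
    ≡ PairSum (∂ˡ F) bs (false ∷ cs) n + PairSum (∂ᵇ F) bs cs n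
  step-forced-free = trans
    (∑-positions-forced bs (λ v → ∑ (positions (false ∷ cs) (suc n)) (F (suc n) v)))
    (∑-right-free {F = F} (true ∷ bs) cs n (positions bs n) zero∷)

  step-forced-forced : PairSum F (true ∷ bs) (true ∷ cs) (suc n) ≡ PairSum (∂ᵇ F) bs cs n
  step-forced-forced = trans
    (∑-positions-forced bs (λ v → ∑ (positions (true ∷ cs) (suc n)) (F (suc n) v)))
    (∑-cong (positions bs n) (λ v → ∑-positions-forced cs (F (suc n) (zero∷ v))))

-- For `false ∷ A` this is the number j of blocks.
free : Vec Bool k → ℕ
free []           = 0
free (true ∷ bs)  = free bs
free (false ∷ bs) = suc (free bs)

-- A forced entry leads to a recursion without the term `f n`. It shifts the argument instead of
-- summing, and so adds no degree.
Degree-step : ∀ {p c f g} → (∀ n → f (suc n) ≡ g n) → Degree p c g → Degree p c f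
Degree-step step h = Degree-unshift (Degree-resp (sym ∘ step) refl h)

Degree-zeros : ∀ {p f g} → Degree p 0ℚ f → Degree p 0ℚ g → Degree p 0ℚ (λ n → f n + g n)
Degree-zeros = Degree-+

Degree-subst : ∀ {p q c f} → p ≡ q → Degree p c f → Degree q c f
Degree-subst refl h = h

-- Each free entry amounts to one summation over n. A common use of position 0 consumes two entries
-- at once; in the presence of a free entry such pairs are of lower order, whence `Degree-raise`.
PairSum-degree : {F : Family k l} → Stable F → (bs : Vec Bool k) (cs : Vec Bool l) →
  ∃ λ c → Degree (free bs ℕ.+ free cs) c (PairSum F bs cs)
PairSum-degree {F = F} stable [] [] = F 0 [] [] , constant 0 (λ n _ → trans (ℚ.+-identityʳ _) (trans (ℚ.+-identityʳ _) (stays n)))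
  where
  stays : ∀ n → F n [] [] ≡ F 0 [] []
  stays zero    = refl
  stays (suc n) = trans (stable Fin.zero [] []) (stays n)
PairSum-degree {F = F} stable [] (false ∷ cs) =
  let _ , r = PairSum-degree (∂ʳ-stable {F = F} stable) [] cs
  in _ , Degree-sum (λ n → step-[]-free {F = F} cs n stable) r
PairSum-degree {F = F} stable [] (true ∷ cs) =
  let _ , r = PairSum-degree (∂ʳ-stable {F = F} stable) [] cs
  in _ , Degree-step (λ n → step-[]-forced {F = F} cs n) r
PairSum-degree {F = F} stable (false ∷ bs) [] =
  let _ , l = PairSum-degree (∂ˡ-stable {F = F} stable) bs []
  in _ , Degree-sum (λ n → step-free-[] {F = F} bs n stable) l
PairSum-degree {F = F} stable (true ∷ bs) [] =
  let _ , l = PairSum-degree (∂ˡ-stable {F = F} stable) bs []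
  in _ , Degree-step (λ n → step-forced-[] {F = F} bs n) l
PairSum-degree {F = F} stable (false ∷ bs) (false ∷ cs) =
  let _ , r = PairSum-degree (∂ʳ-stable {F = F} stable) (false ∷ bs) cs
      _ , l = PairSum-degree (∂ˡ-stable {F = F} stable) bs (false ∷ cs)
      _ , b = PairSum-degree (∂ᵇ-stable {F = F} stable) bs cs
  in _ , Degree-sum (λ n → step-free-free {F = F} bs cs n stable)
           (Degree-subst (sym (ℕ.+-suc (free bs) (free cs)))
             (Degree-+ r (Degree-+ (Degree-subst (ℕ.+-suc (free bs) (free cs)) l) (Degree-raise b))))
PairSum-degree {F = F} stable (false ∷ bs) (true ∷ cs) =
  let _ , r = PairSum-degree (∂ʳ-stable {F = F} stable) (false ∷ bs) cs
      _ , b = PairSum-degree (∂ᵇ-stable {F = F} stable) bs cs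
  in _ , Degree-step (λ n → step-free-forced {F = F} bs cs n) (Degree-+ r (Degree-raise b))
PairSum-degree {F = F} stable (true ∷ bs) (false ∷ cs) =
  let _ , l = PairSum-degree (∂ˡ-stable {F = F} stable) bs (false ∷ cs)
      _ , b = PairSum-degree (∂ᵇ-stable {F = F} stable) bs cs
  in _ , Degree-step (λ n → step-forced-free {F = F} bs cs n)
           (Degree-+ l (Degree-subst (sym (ℕ.+-suc (free bs) (free cs))) (Degree-raise b)))
PairSum-degree {F = F} stable (true ∷ bs) (true ∷ cs) =
  let _ , b = PairSum-degree (∂ᵇ-stable {F = F} stable) bs cs
  in _ , Degree-step (λ n → step-forced-forced {F = F} bs cs n) b

-- In this case both vectors start at 0, so every pair overlaps and the top coefficient need not
-- vanish. It is the case to be excluded below.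
BothForced : Vec Bool k → Vec Bool l → Set
BothForced (true ∷ _) (true ∷ _) = ⊤
BothForced _          _          = ⊥

¬BothForced-freeˡ : (bs : Vec Bool k) (cs : Vec Bool l) → ¬ BothForced (false ∷ bs) cs
¬BothForced-freeˡ bs []      ()
¬BothForced-freeˡ bs (_ ∷ _) ()

¬BothForced-freeʳ : (bs : Vec Bool k) (cs : Vec Bool l) → ¬ BothForced bs (false ∷ cs)
¬BothForced-freeʳ []           cs ()
¬BothForced-freeʳ (true  ∷ bs) cs ()
¬BothForced-freeʳ (false ∷ bs) cs ()

¬BothForced-[]ʳ : (bs : Vec Bool k) → ¬ BothForced bs []
¬BothForced-[]ʳ []           ()
¬BothForced-[]ʳ (true  ∷ bs) ()
¬BothForced-[]ʳ (false ∷ bs) ()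

-- Every pair that contributes overlaps, and each overlap costs a degree of freedom.
PairSum-vanishing : {F : Family k l} → Stable F → VanishesOnDisjoint F → (bs : Vec Bool k) (cs : Vec Bool l) →
  ¬ BothForced bs cs → Degree (free bs ℕ.+ free cs) 0ℚ (PairSum F bs cs)
PairSum-vanishing {F = F} stable vanishes [] [] _ = constant 0 (λ n _ → trans (ℚ.+-identityʳ _)
  (trans (ℚ.+-identityʳ _) (vanishes [] [] (λ ()) (λ ()) (λ ()))))
PairSum-vanishing {F = F} stable vanishes [] (false ∷ cs) _ =
  Degree-sum (λ n → step-[]-free {F = F} cs n stable)
    (PairSum-vanishing (∂ʳ-stable {F = F} stable) (∂ʳ-vanishes {F = F} vanishes) [] cs (λ ()))
PairSum-vanishing {F = F} stable vanishes [] (true ∷ cs) _ =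
  Degree-step (λ n → step-[]-forced {F = F} cs n)
    (PairSum-vanishing (∂ʳ-stable {F = F} stable) (∂ʳ-vanishes {F = F} vanishes) [] cs (λ ()))
PairSum-vanishing {F = F} stable vanishes (false ∷ bs) [] _ =
  Degree-sum (λ n → step-free-[] {F = F} bs n stable)
    (PairSum-vanishing (∂ˡ-stable {F = F} stable) (∂ˡ-vanishes {F = F} vanishes) bs [] (¬BothForced-[]ʳ bs))
PairSum-vanishing {F = F} stable vanishes (true ∷ bs) [] _ =
  Degree-step (λ n → step-forced-[] {F = F} bs n)
    (PairSum-vanishing (∂ˡ-stable {F = F} stable) (∂ˡ-vanishes {F = F} vanishes) bs [] (¬BothForced-[]ʳ bs))
PairSum-vanishing {F = F} stable vanishes (false ∷ bs) (false ∷ cs) _ =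
  let r = PairSum-vanishing (∂ʳ-stable {F = F} stable) (∂ʳ-vanishes {F = F} vanishes) (false ∷ bs) cs (¬BothForced-freeˡ bs cs)
      l = PairSum-vanishing (∂ˡ-stable {F = F} stable) (∂ˡ-vanishes {F = F} vanishes) bs (false ∷ cs) (¬BothForced-freeʳ bs cs)
      _ , b = PairSum-degree (∂ᵇ-stable {F = F} stable) bs cs
  in Degree-sum (λ n → step-free-free {F = F} bs cs n stable)
       (Degree-subst (sym (ℕ.+-suc (free bs) (free cs)))
         (Degree-zeros r (Degree-zeros (Degree-subst (ℕ.+-suc (free bs) (free cs)) l) (Degree-raise b))))
PairSum-vanishing {F = F} stable vanishes (false ∷ bs) (true ∷ cs) _ =
  let r = PairSum-vanishing (∂ʳ-stable {F = F} stable) (∂ʳ-vanishes {F = F} vanishes) (false ∷ bs) cs (¬BothForced-freeˡ bs cs)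
      _ , b = PairSum-degree (∂ᵇ-stable {F = F} stable) bs cs
  in Degree-step (λ n → step-free-forced {F = F} bs cs n) (Degree-zeros r (Degree-raise b))
PairSum-vanishing {F = F} stable vanishes (true ∷ bs) (false ∷ cs) _ =
  let l = PairSum-vanishing (∂ˡ-stable {F = F} stable) (∂ˡ-vanishes {F = F} vanishes) bs (false ∷ cs) (¬BothForced-freeʳ bs cs)
      _ , b = PairSum-degree (∂ᵇ-stable {F = F} stable) bs cs
  in Degree-step (λ n → step-forced-free {F = F} bs cs n)
       (Degree-zeros l (Degree-subst (sym (ℕ.+-suc (free bs) (free cs))) (Degree-raise b)))
PairSum-vanishing stable vanishes (true ∷ bs) (true ∷ cs) open′ = contradiction tt open′

-- Occurrences as admissible position vectors

HasAdjacency : Vec (Fin n) k → Fin k → Set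
HasAdjacency v Fin.zero    = toℕ (lookup v Fin.zero) ≡ 0
HasAdjacency v (Fin.suc a) = toℕ (lookup v (Fin.suc a)) ≡ suc (toℕ (lookup v (Fin.inject₁ a)))

record Admissible (bs : Vec Bool k) (v : Vec (Fin n) k) : Set where
  constructor admissible
  field
    increasing : ∀ r s → r Fin.< s → lookup v r Fin.< lookup v s
    adjacency  : ∀ r → lookup bs r ≡ true → HasAdjacency v r
open Admissible

toℕ-shift : (v : Vec (Fin n) k) (r : Fin k) → toℕ (lookup (shift v) r) ≡ suc (toℕ (lookup v r))
toℕ-shift v r = cong toℕ (Vec.lookup-map r Fin.suc v)

module _ {v : Vec (Fin n) k} where

  shift-increasing⁺ : ∀ {r s} → lookup v r Fin.< lookup v s → lookup (shift v) r Fin.< lookup (shift v) s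
  shift-increasing⁺ {r} {s} lt rewrite toℕ-shift v r | toℕ-shift v s = ℕ.s≤s lt

  shift-increasing⁻ : ∀ {r s} → lookup (shift v) r Fin.< lookup (shift v) s → lookup v r Fin.< lookup v s
  shift-increasing⁻ {r} {s} lt rewrite toℕ-shift v r | toℕ-shift v s = ℕ.s≤s⁻¹ lt

  shift-adjacent⁺ : ∀ {r s} → toℕ (lookup v r) ≡ suc (toℕ (lookup v s)) → toℕ (lookup (shift v) r) ≡ suc (toℕ (lookup (shift v) s))
  shift-adjacent⁺ {r} {s} e rewrite toℕ-shift v r | toℕ-shift v s = cong suc e

  shift-adjacent⁻ : ∀ {r s} → toℕ (lookup (shift v) r) ≡ suc (toℕ (lookup (shift v) s)) → toℕ (lookup v r) ≡ suc (toℕ (lookup v s))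
  shift-adjacent⁻ {r} {s} e rewrite toℕ-shift v r | toℕ-shift v s = ℕ.suc-injective e

admissible-zero∷⁻ : ∀ {b} {bs : Vec Bool k} {v : Vec (Fin n) k} → Admissible (b ∷ bs) (zero∷ v) → Admissible bs v
admissible-zero∷⁻ {v = v} (admissible inc adj) = admissible
  (λ r s r<s → shift-increasing⁻ {v = v} (inc (Fin.suc r) (Fin.suc s) (ℕ.s≤s r<s)))
  λ { Fin.zero    e → ℕ.suc-injective (trans (sym (toℕ-shift v Fin.zero)) (adj (Fin.suc Fin.zero) e))
    ; (Fin.suc r) e → shift-adjacent⁻ {v = v} (adj (Fin.suc (Fin.suc r)) e) }

admissible-zero∷⁺ : ∀ {b} {bs : Vec Bool k} {v : Vec (Fin n) k} → Admissible bs v → Admissible (b ∷ bs) (zero∷ v)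
admissible-zero∷⁺ {v = v} (admissible inc adj) = admissible
  (λ { Fin.zero    (Fin.suc s) _   → subst (1 ℕ.≤_) (sym (toℕ-shift v s)) (ℕ.s≤s ℕ.z≤n)
     ; (Fin.suc r) (Fin.suc s) r<s → shift-increasing⁺ {v = v} (inc r s (ℕ.s≤s⁻¹ r<s)) })
  λ { Fin.zero              e → refl
    ; (Fin.suc Fin.zero)    e → trans (toℕ-shift v Fin.zero) (cong suc (adj Fin.zero e))
    ; (Fin.suc (Fin.suc r)) e → shift-adjacent⁺ {v = v} (adj (Fin.suc r) e) }

admissible-shift⁻ : {bs : Vec Bool k} {v : Vec (Fin n) (suc k)} → Admissible (false ∷ bs) (shift v) → Admissible (false ∷ bs) v
admissible-shift⁻ {v = v} (admissible inc adj) = admissible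
  (λ r s r<s → shift-increasing⁻ {v = v} (inc r s r<s))
  λ { Fin.zero () ; (Fin.suc r) e → shift-adjacent⁻ {v = v} (adj (Fin.suc r) e) }

admissible-shift⁺ : {bs : Vec Bool k} {v : Vec (Fin n) (suc k)} → Admissible (false ∷ bs) v → Admissible (false ∷ bs) (shift v)
admissible-shift⁺ {v = v} (admissible inc adj) = admissible
  (λ r s r<s → shift-increasing⁺ {v = v} (inc r s r<s))
  λ { Fin.zero () ; (Fin.suc r) e → shift-adjacent⁺ {v = v} (adj (Fin.suc r) e) }

positions-admissible : (bs : Vec Bool k) (n : ℕ) → All (Admissible bs) (positions bs n)
positions-admissible []           n       = admissible (λ ()) (λ ()) ∷ []
positions-admissible (b ∷ bs)     zero    = []
positions-admissible (true ∷ bs)  (suc n) = All.map⁺ (All.map admissible-zero∷⁺ (positions-admissible bs n))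
positions-admissible (false ∷ bs) (suc n) = All.++⁺
  (All.map⁺ (All.map admissible-shift⁺ (positions-admissible (false ∷ bs) n)))
  (All.map⁺ (All.map admissible-zero∷⁺ (positions-admissible bs n)))

∑-tuples-suc : (g : Vec (Fin n) (suc k) → ℚ) → ∑ (tuples n (suc k)) g ≡ ∑Fin n (λ i → ∑ (tuples n k) (λ v → g (i ∷ v)))
∑-tuples-suc {n} {k} g = ∑-cartesianProductWith _∷_ (allFin n) (tuples n k) g

∑-tuples-shift : (g : Vec (Fin (suc n)) k → ℚ) → (∀ v r → lookup v r ≡ Fin.zero → g v ≡ 0ℚ) →
  ∑ (tuples (suc n) k) g ≡ ∑ (tuples n k) (g ∘ shift)
∑-tuples-shift {k = zero}  g g≡0 = refl
∑-tuples-shift {n} {suc k} g g≡0 = begin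
  ∑ (tuples (suc n) (suc k)) g
    ≡⟨ ∑-tuples-suc g ⟩
  ∑Fin (suc n) (λ i → ∑ (tuples (suc n) k) (λ v → g (i ∷ v)))
    ≡⟨ ∑Fin-suc (λ i → ∑ (tuples (suc n) k) (λ v → g (i ∷ v))) ⟩
  ∑ (tuples (suc n) k) (λ v → g (Fin.zero ∷ v)) + ∑Fin n (λ i → ∑ (tuples (suc n) k) (λ v → g (Fin.suc i ∷ v)))
    ≡⟨ cong₂ _+_ (∑-zero (tuples (suc n) k) (λ v → g≡0 (Fin.zero ∷ v) Fin.zero refl))
                 (∑-cong (allFin n) (λ i → ∑-tuples-shift (λ v → g (Fin.suc i ∷ v)) (λ v r → g≡0 (Fin.suc i ∷ v) (Fin.suc r)))) ⟩
  0ℚ + ∑Fin n (λ i → ∑ (tuples n k) (λ v → g (Fin.suc i ∷ shift v)))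
    ≡⟨ ℚ.+-identityˡ _ ⟩
  ∑Fin n (λ i → ∑ (tuples n k) (λ v → g (Fin.suc i ∷ shift v)))
    ≡⟨ ∑-tuples-suc (g ∘ shift) ⟨
  ∑ (tuples n (suc k)) (g ∘ shift) ∎
  where open ≡-Reasoning

-- Admissible vectors are increasing, so only the first entry can be 0 and the others may be
-- shifted. What remains is the case distinction that defines `positions`.
∑-tuples≡∑-positions : (bs : Vec Bool k) (g : Vec (Fin n) k → ℚ) → (∀ v → ¬ Admissible bs v → g v ≡ 0ℚ) →
  ∑ (tuples n k) g ≡ ∑ (positions bs n) g
∑-tuples≡∑-positions []                   g g≡0 = refl
∑-tuples≡∑-positions {n = zero}  (b ∷ bs) g g≡0 = refl
∑-tuples≡∑-positions {suc k} {suc n} (b ∷ bs) g g≡0 = begin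
  ∑ (tuples (suc n) (suc k)) g
    ≡⟨ ∑-tuples-suc g ⟩
  ∑Fin (suc n) (λ i → ∑ (tuples (suc n) k) (λ v → g (i ∷ v)))
    ≡⟨ ∑-cong (allFin (suc n)) (λ i → ∑-tuples-shift (λ v → g (i ∷ v)) (λ v r e → g≡0 (i ∷ v) (later-positive i v r e))) ⟩
  ∑Fin (suc n) (λ i → ∑ (tuples n k) (λ v → g (i ∷ shift v)))
    ≡⟨ ∑Fin-suc (λ i → ∑ (tuples n k) (λ v → g (i ∷ shift v))) ⟩
  ∑ (tuples n k) (g ∘ zero∷) + ∑Fin n (λ i → ∑ (tuples n k) (λ v → g (Fin.suc i ∷ shift v)))
    ≡⟨ cong₂ _+_ (∑-tuples≡∑-positions bs (g ∘ zero∷) (λ v → g≡0 (zero∷ v) ∘ (_∘ admissible-zero∷⁻)))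
                 (sym (∑-tuples-suc (g ∘ shift))) ⟩
  ∑ (positions bs n) (g ∘ zero∷) + ∑ (tuples n (suc k)) (g ∘ shift)
    ≡⟨ rest b g≡0 ⟩
  ∑ (positions (b ∷ bs) (suc n)) g ∎
  where
  open ≡-Reasoning
  later-positive : ∀ i v r → lookup v r ≡ Fin.zero → ¬ Admissible (b ∷ bs) (i ∷ v)
  later-positive i v r e adm with increasing adm Fin.zero (Fin.suc r) (ℕ.s≤s ℕ.z≤n)
  ... | lt rewrite e with () ← lt
  rest : ∀ b → (∀ v → ¬ Admissible (b ∷ bs) v → g v ≡ 0ℚ) →
    ∑ (positions bs n) (g ∘ zero∷) + ∑ (tuples n (suc k)) (g ∘ shift) ≡ ∑ (positions (b ∷ bs) (suc n)) g
  rest true g≡0 = trans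
    (cong (∑ (positions bs n) (g ∘ zero∷) +_) (∑-zero (tuples n (suc k)) (λ { (i ∷ v) →
      g≡0 (Fin.suc i ∷ shift v) (λ adm → case (adjacency adm Fin.zero refl)) })))
    (trans (ℚ.+-identityʳ _) (sym (∑-positions-forced bs g)))
    where
    case : ∀ {m} → suc m ≢ 0
    case ()
  rest false g≡0 = trans
    (ℚ.+-comm (∑ (positions bs n) (g ∘ zero∷)) (∑ (tuples n (suc k)) (g ∘ shift)))
    (trans (cong (_+ ∑ (positions bs n) (g ∘ zero∷))
             (∑-tuples≡∑-positions (false ∷ bs) (g ∘ shift) (λ v → g≡0 (shift v) ∘ (_∘ admissible-shift⁻))))
           (sym (∑-positions-free bs g)))

module _ (π : Permutation′ (suc k)) (A : Subset k) (σ : Permutation′ n) where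

  isOccurrence⇒admissible : ∀ v → IsOccurrence π A σ v → Admissible (false ∷ A) v
  isOccurrence⇒admissible v (inc , _ , adj) = admissible inc
    λ { Fin.zero () ; (Fin.suc a) e → adj a (Vec.lookup⇒[]= a A e) }

  admissible⇒isOccurrence : ∀ v → Admissible (false ∷ A) v → Matches π (lookup v) σ → IsOccurrence π A σ v
  admissible⇒isOccurrence v adm m = increasing adm , m , λ a a∈A → adjacency adm (Fin.suc a) (Vec.[]=⇒lookup a∈A)

  occurrences≡∑χ : fromℕ (occurrences π A σ) ≡ ∑ (positions (false ∷ A) n) (λ v → χ π (lookup v) σ)
  occurrences≡∑χ = begin
    fromℕ (occurrences π A σ)
      ≡⟨ ∑-filter (isOccurrence? π A σ) (tuples n (suc k)) ⟩
    ∑ (tuples n (suc k)) (λ v → 𝟙 (isOccurrence? π A σ v))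
      ≡⟨ ∑-tuples≡∑-positions (false ∷ A) (λ v → 𝟙 (isOccurrence? π A σ v))
           (λ v ¬adm → 𝟙-false (isOccurrence? π A σ v) (¬adm ∘ isOccurrence⇒admissible v)) ⟩
    ∑ (positions (false ∷ A) n) (λ v → 𝟙 (isOccurrence? π A σ v))
      ≡⟨ ∑-cong-All (positions-admissible (false ∷ A) n) (λ v adm → trans
           (𝟙-cong (isOccurrence? π A σ v) (matches? π (lookup v) σ) (λ (_ , m , _) → m) (admissible⇒isOccurrence v adm))
           (sym (χ-𝟙 π (lookup v) σ (matches? π (lookup v) σ)))) ⟩
    ∑ (positions (false ∷ A) n) (λ v → χ π (lookup v) σ) ∎
    where open ≡-Reasoning

-- Covariance

opaque
  cov : (F G : Permutation′ n → ℚ) → ℚ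
  cov F G = 𝔼 (λ σ → F σ * G σ) - 𝔼 F * 𝔼 G

  cov-def : (F G : Permutation′ n → ℚ) → cov F G ≡ 𝔼 (λ σ → F σ * G σ) - 𝔼 F * 𝔼 G
  cov-def F G = refl

module _ {n : ℕ} where

  cov-cong : {F F′ G G′ : Permutation′ n → ℚ} → (∀ σ → F σ ≡ F′ σ) → (∀ σ → G σ ≡ G′ σ) → cov F G ≡ cov F′ G′
  cov-cong {F} {F′} {G} {G′} e e′ = trans (cov-def F G) (trans
    (cong₂ _-_ (𝔼-cong (λ σ → cong₂ _*_ (e σ) (e′ σ))) (cong₂ _*_ (𝔼-cong e) (𝔼-cong e′)))
    (sym (cov-def F′ G′)))

  cov-comm : (F G : Permutation′ n → ℚ) → cov F G ≡ cov G F
  cov-comm F G = trans (cov-def F G) (trans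
    (cong₂ _-_ (𝔼-cong (λ σ → ℚ.*-comm (F σ) (G σ))) (ℚ.*-comm (𝔼 F) (𝔼 G)))
    (sym (cov-def G F)))

  cov-+ˡ : (F F′ G : Permutation′ n → ℚ) → cov (λ σ → F σ + F′ σ) G ≡ cov F G + cov F′ G
  cov-+ˡ F F′ G = begin
    cov (λ σ → F σ + F′ σ) G
      ≡⟨ cov-def (λ σ → F σ + F′ σ) G ⟩
    𝔼 (λ σ → (F σ + F′ σ) * G σ) - 𝔼 (λ σ → F σ + F′ σ) * 𝔼 G
      ≡⟨ cong₂ (λ a b → a - b * 𝔼 G) (trans (𝔼-cong (λ σ → ℚ.*-distribʳ-+ (G σ) (F σ) (F′ σ))) (𝔼-+ (λ σ → F σ * G σ) (λ σ → F′ σ * G σ))) (𝔼-+ F F′) ⟩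
    a + b - (𝔼 F + 𝔼 F′) * 𝔼 G
      ≡⟨ S.solve 5 (λ a b f f′ g → a :+ b :- (f :+ f′) :* g := (a :- f :* g) :+ (b :- f′ :* g)) refl a b (𝔼 F) (𝔼 F′) (𝔼 G) ⟩
    (a - 𝔼 F * 𝔼 G) + (b - 𝔼 F′ * 𝔼 G)
      ≡⟨ cong₂ _+_ (cov-def F G) (cov-def F′ G) ⟨
    cov F G + cov F′ G ∎
    where
    open ≡-Reasoning
    a = 𝔼 (λ σ → F σ * G σ)
    b = 𝔼 (λ σ → F′ σ * G σ)

  cov-*ˡ : (c : ℚ) (F G : Permutation′ n → ℚ) → cov (λ σ → c * F σ) G ≡ c * cov F G
  cov-*ˡ c F G = begin
    cov (λ σ → c * F σ) G
      ≡⟨ cov-def (λ σ → c * F σ) G ⟩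
    𝔼 (λ σ → c * F σ * G σ) - 𝔼 (λ σ → c * F σ) * 𝔼 G
      ≡⟨ cong₂ (λ a b → a - b * 𝔼 G) (trans (𝔼-cong (λ σ → ℚ.*-assoc c (F σ) (G σ))) (𝔼-* c (λ σ → F σ * G σ))) (𝔼-* c F) ⟩
    c * a - c * 𝔼 F * 𝔼 G
      ≡⟨ S.solve 4 (λ c a f g → c :* a :- c :* f :* g := c :* (a :- f :* g)) refl c a (𝔼 F) (𝔼 G) ⟩
    c * (a - 𝔼 F * 𝔼 G)
      ≡⟨ cong (c *_) (cov-def F G) ⟨
    c * cov F G ∎
    where
    open ≡-Reasoning
    a = 𝔼 (λ σ → F σ * G σ)

  variance : (F : Permutation′ n → ℚ) → 𝔼 (λ σ → (F σ - 𝔼 F) * (F σ - 𝔼 F)) ≡ cov F F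
  variance F = begin
    𝔼 (λ σ → (F σ - μ) * (F σ - μ))
      ≡⟨ 𝔼-cong (λ σ → S.solve 2 (λ f m → (f :- m) :* (f :- m) := f :* f :+ ((:- (m :+ m)) :* f :+ m :* m)) refl (F σ) μ) ⟩
    𝔼 (λ σ → F σ * F σ + (- (μ + μ) * F σ + μ * μ))
      ≡⟨ 𝔼-+ (λ σ → F σ * F σ) (λ σ → - (μ + μ) * F σ + μ * μ) ⟩
    a + 𝔼 (λ σ → - (μ + μ) * F σ + μ * μ)
      ≡⟨ cong (a +_) (𝔼-+ (λ σ → - (μ + μ) * F σ) (λ _ → μ * μ)) ⟩
    a + (𝔼 (λ σ → - (μ + μ) * F σ) + 𝔼 {n} (λ _ → μ * μ))
      ≡⟨ cong (a +_) (cong₂ _+_ (𝔼-* (- (μ + μ)) F) (𝔼-const {n} (μ * μ))) ⟩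
    a + (- (μ + μ) * μ + μ * μ)
      ≡⟨ S.solve 2 (λ a m → a :+ ((:- (m :+ m)) :* m :+ m :* m) := a :- m :* m) refl a μ ⟩
    a - μ * μ
      ≡⟨ cov-def F F ⟨
    cov F F ∎
    where
    open ≡-Reasoning
    μ = 𝔼 F
    a = 𝔼 (λ σ → F σ * F σ)

  cov-zeroˡ : (G : Permutation′ n → ℚ) → cov (λ _ → 0ℚ) G ≡ 0ℚ
  cov-zeroˡ G = trans (cov-*ˡ 0ℚ (λ _ → 0ℚ) G) (ℚ.*-zeroˡ (cov (λ _ → 0ℚ) G))

  cov-∑ˡ : (xs : List I) (F : I → Permutation′ n → ℚ) (G : Permutation′ n → ℚ) →
    cov (λ σ → ∑ xs (λ x → F x σ)) G ≡ ∑ xs (λ x → cov (F x) G)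
  cov-∑ˡ []       F G = cov-zeroˡ G
  cov-∑ˡ (x ∷ xs) F G = trans (cov-+ˡ (F x) (λ σ → ∑ xs (λ x → F x σ)) G) (cong (cov (F x) G +_) (cov-∑ˡ xs F G))

  cov-∑ʳ : (xs : List I) (F : Permutation′ n → ℚ) (G : I → Permutation′ n → ℚ) →
    cov F (λ σ → ∑ xs (λ x → G x σ)) ≡ ∑ xs (λ x → cov F (G x))
  cov-∑ʳ xs F G = trans (cov-comm F (λ σ → ∑ xs (λ x → G x σ)))
    (trans (cov-∑ˡ xs G F) (∑-cong xs (λ x → cov-comm (G x) F)))

  0≤variance : (F : Permutation′ n → ℚ) → 0ℚ ≤ cov F F
  0≤variance F = subst (0ℚ ≤_) (variance F) (𝔼-nonNeg (λ σ → square-nonNeg (F σ - 𝔼 F)))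

  -- The variance of F - t G is nonnegative.
  cauchy-schwarz : (F G : Permutation′ n → ℚ) (t : ℚ) → t * cov F G + t * cov F G - t * t * cov G G ≤ cov F F
  cauchy-schwarz F G t = ≤-by (cov D D) (0≤variance D) (begin
    t * c + t * c - t * t * g + cov D D
      ≡⟨ cong (t * c + t * c - t * t * g +_) expand ⟩
    t * c + t * c - t * t * g + ((f + - t * c) + - t * (c + - t * g))
      ≡⟨ S.solve 4 (λ t c f g → t :* c :+ t :* c :- t :* t :* g :+ ((f :+ (:- t) :* c) :+ (:- t) :* (c :+ (:- t) :* g)) := f) refl t c f g ⟩
    f ∎)
    where
    open ≡-Reasoning
    D : Permutation′ n → ℚ
    D σ = F σ + - t * G σ
    c = cov F G
    f = cov F F
    g = cov G G
    expandʳ : (H : Permutation′ n → ℚ) → cov H D ≡ cov H F + - t * cov H G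
    expandʳ H = trans (cov-comm H D) (trans (cov-+ˡ F (λ σ → - t * G σ) H)
      (cong₂ _+_ (cov-comm F H) (trans (cov-*ˡ (- t) G H) (cong (- t *_) (cov-comm G H)))))
    expand : cov D D ≡ (f + - t * c) + - t * (c + - t * g)
    expand = trans (cov-+ˡ F (λ σ → - t * G σ) D) (cong₂ _+_ (expandʳ F)
      (trans (cov-*ˡ (- t) G D) (cong (- t *_) (trans (expandʳ G) (cong (_+ - t * g) (cov-comm G F))))))

-- The product of the means is replaced by its value for injective vectors. Thus stability and the
-- lower bound `pairCov-≥` concern the joint expectation only and hold for all vectors; `cov-χ`
-- makes the link to the covariance.
pairCov : Permutation′ k → Family k k
pairCov {k} π n v w = 𝔼 (λ σ → χ π (lookup v) σ * χ π (lookup w) σ) - 1/ k ! * 1/ k !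

cov-χ : (π : Permutation′ k) (v w : Vec (Fin n) k) → InjectiveVec v → InjectiveVec w →
  cov (χ π (lookup v)) (χ π (lookup w)) ≡ pairCov π n v w
cov-χ π v w v-inj w-inj = trans (cov-def (χ π (lookup v)) (χ π (lookup w)))
  (cong (λ e → 𝔼 (λ σ → χ π (lookup v) σ * χ π (lookup w) σ) - e) (cong₂ _*_ (𝔼-χ v-inj π) (𝔼-χ w-inj π)))

pairCov-stable : (π : Permutation′ k) → Stable (pairCov π)
pairCov-stable {k} π p v w = cong (_- 1/ k ! * 1/ k !)
  (𝔼-χ-punchIn π π p (λ r → Vec.lookup-map r (punchIn p) v) (λ r → Vec.lookup-map r (punchIn p) w))

pairCov-vanishes : (π : Permutation′ k) → VanishesOnDisjoint (pairCov π)
pairCov-vanishes {k} π v w v-inj w-inj disjoint = trans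
  (cong (_- 1/ k ! * 1/ k !) (𝔼-χ-χ v-inj w-inj disjoint π π))
  (ℚ.+-inverseʳ (1/ k ! * 1/ k !))

module _ (π : Permutation′ (suc k)) (A : Subset k) where

  count : Permutation′ n → ℚ
  count {n} σ = ∑ (positions (false ∷ A) n) (λ v → χ π (lookup v) σ)

  Var≡cov : ∀ n → Var {n} (occurrences π A) ≡ cov (count {n}) (count {n})
  Var≡cov n = trans (variance {n} (fromℕ ∘ occurrences π A)) (cov-cong {n} (occurrences≡∑χ π A) (occurrences≡∑χ π A))

  Var≡PairSum : ∀ n → Var {n} (occurrences π A) ≡ PairSum (pairCov π) (false ∷ A) (false ∷ A) n
  Var≡PairSum n = trans (Var≡cov n) (trans
    (cov-∑ˡ (positions (false ∷ A) n) (λ v → χ π (lookup v)) (count {n}))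
    (∑-cong-All (positions-injective (false ∷ A) n) (λ v v-inj → trans
      (cov-∑ʳ (positions (false ∷ A) n) (χ π (lookup v)) (λ w → χ π (lookup w)))
      (∑-cong-All (positions-injective (false ∷ A) n) (λ w w-inj → cov-χ π v w v-inj w-inj)))))

  -- The first entry is free, so the coefficient in degree 2j = 2 (`free A` + 1) vanishes and the
  -- degree drops by one.
  Var-degree : ∃ λ c → Degree (suc (free A ℕ.+ free A)) c (λ n → Var {n} (occurrences π A))
  Var-degree =
    let c , h = Degree-lower (Degree-subst (cong suc (ℕ.+-suc (free A) (free A)))
                  (PairSum-vanishing {F = pairCov π} (pairCov-stable π) (pairCov-vanishes π) (false ∷ A) (false ∷ A) (λ ())))
    in c , Degree-resp (λ n → sym (Var≡PairSum n)) refl h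

-- From the leading coefficient to the limit

BoundedBy : ℕ → (ℕ → ℚ) → Set
BoundedBy d V = ∃ λ K → ∃ λ N → ∀ n → N ℕ.≤ n → V n ≤ K * fromℕ (n ^ d)

leading-nonPos⇒BoundedBy : ∀ {d c V} → Degree (suc d) c V → c ≤ 0ℚ → BoundedBy d V
leading-nonPos⇒BoundedBy {d} {c} {V} h c≤0 =
  let K , _ , N , bound = Degree⇒leading h
  in K , N , λ n n≥N → let P = fromℕ (n ^ suc d) in begin
    V n                        ≡⟨ S.solve 2 (λ v x → v := x :+ (v :- x)) refl (V n) (C * P) ⟩
    C * P + (V n - C * P)      ≤⟨ ℚ.+-mono-≤ (*-monoʳ P (0≤fromℕ (n ^ suc d)) C≤0) (ℚ.≤-trans (p≤∣p∣ _) (bound n n≥N)) ⟩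
    0ℚ * P + K * fromℕ (n ^ d) ≡⟨ S.solve 2 (λ p k → con 0ℚ :* p :+ k := k) refl P (K * fromℕ (n ^ d)) ⟩
    K * fromℕ (n ^ d)          ∎
  where
  open ℚ.≤-Reasoning
  C = c * inv (fromℕ (suc d !))
  C≤0 : C ≤ 0ℚ
  C≤0 = ℚ.≤-trans (*-monoʳ (inv (fromℕ (suc d !))) (ℚ.<⇒≤ (inv-pos (0<fromℕ {{(suc d) ℕ.!≢0}}))) c≤0)
    (ℚ.≤-reflexive (ℚ.*-zeroˡ (inv (fromℕ (suc d !)))))

AsymptoticTo : (ℕ → ℚ) → ℕ → Set
AsymptoticTo V p = Σ[ C ∈ ℝ ] Σ[ C>0 ∈ 0ℝ <ℝ C ]
  (λ n → fromℚ (V n) ÷ℝ (C *ℝ pow n p) ⟨ *ℝ-pos C (pow n p) C>0 (pow-pos n p) ⟩) ⟶ 1ℝ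

leading-pos⇒AsymptoticTo : ∀ {d c V} → Degree (suc d) c V → 0ℚ < c → AsymptoticTo V (suc d)
leading-pos⇒AsymptoticTo {d} {c} {V} h c>0 =
  fromℚ C , C>0ℝ , limit
  where
  C = c * inv (fromℕ (suc d !))
  C>0 : 0ℚ < C
  C>0 = *-pos c>0 (inv-pos (0<fromℕ {{(suc d) ℕ.!≢0}}))
  leading = Degree⇒leading h
  K = proj₁ leading
  N₀ = proj₁ (proj₂ (proj₂ leading))
  bound = proj₂ (proj₂ (proj₂ leading))
  ½>0 : 0ℚ < ½
  ½>0 = ℚ.positive⁻¹ ½

  relative-error : ∀ δ N → K < fromℕ N * (½ * δ * C) → 0ℚ < δ → ∀ n → .{{_ : ℕ.NonZero n}} → N₀ ℕ.≤ n → N ℕ.≤ n →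
    ∣ V n * inv (C * fromℕ (n ^ suc d)) - 1ℚ ∣ ≤ ½ * δ
  relative-error δ N K< δ>0 n n≥N₀ n≥N = begin
    ∣ V n * i - 1ℚ ∣             ≡⟨ cong (λ u → ∣ V n * i - u ∣) (inv-inverseʳ D>0) ⟨
    ∣ V n * i - D * i ∣          ≡⟨ cong ∣_∣ (S.solve 3 (λ v d i → v :* i :- d :* i := (v :- d) :* i) refl (V n) D i) ⟩
    ∣ (V n - D) * i ∣            ≡⟨ ℚ.∣p*q∣≡∣p∣*∣q∣ (V n - D) i ⟩
    ∣ V n - D ∣ * ∣ i ∣          ≡⟨ cong (∣ V n - D ∣ *_) (ℚ.0≤p⇒∣p∣≡p i≥0) ⟩
    ∣ V n - D ∣ * i              ≤⟨ *-monoʳ i i≥0 (bound n n≥N₀) ⟩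
    K * fromℕ (n ^ d) * i        ≤⟨ *-monoʳ i i≥0 (*-monoʳ (fromℕ (n ^ d)) (0≤fromℕ (n ^ d))
                                      (ℚ.≤-trans (ℚ.<⇒≤ K<) (*-monoʳ (½ * δ * C) (ℚ.<⇒≤ (*-pos (*-pos ½>0 δ>0) C>0)) (fromℕ-mono-≤ n≥N)))) ⟩
    fromℕ n * (½ * δ * C) * fromℕ (n ^ d) * i   ≡⟨ S.solve 5 (λ n h c m i → n :* (h :* c) :* m :* i := h :* (c :* (n :* m) :* i)) refl
                                                     (fromℕ n) (½ * δ) C (fromℕ (n ^ d)) i ⟩
    ½ * δ * (C * (fromℕ n * fromℕ (n ^ d)) * i) ≡⟨ cong (λ m → ½ * δ * (C * m * i)) (fromℕ-* n (n ^ d)) ⟨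
    ½ * δ * (D * i)              ≡⟨ cong (½ * δ *_) (inv-inverseʳ D>0) ⟩
    ½ * δ * 1ℚ                   ≡⟨ ℚ.*-identityʳ (½ * δ) ⟩
    ½ * δ                        ∎
    where
    open ℚ.≤-Reasoning
    D = C * fromℕ (n ^ suc d)
    i = inv D
    D>0 : 0ℚ < D
    D>0 = *-pos C>0 (0<fromℕ {{ℕ.m^n≢0 n (suc d)}})
    i≥0 : 0ℚ ≤ i
    i≥0 = ℚ.<⇒≤ (inv-pos D>0)

  C>0ℝ : 0ℝ <ℝ fromℚ C
  C>0ℝ = C , C>0 , 0 , λ _ _ → ℚ.≤-reflexive (ℚ.+-identityˡ C)

  limit : (λ n → fromℚ (V n) ÷ℝ (fromℚ C *ℝ pow n (suc d)) ⟨ *ℝ-pos (fromℚ C) (pow n (suc d)) C>0ℝ (pow-pos n (suc d)) ⟩) ⟶ 1ℝ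
  limit ε (δ , δ>0 , M , ε≥δ) =
    -- One half of δ bounds the error; the other half is the uniform gap that `_<ℝ_` demands.
    let N , K< = archimedean-* K (*-pos (*-pos ½>0 δ>0) C>0)
    in N₀ ℕ.⊔ N , λ n n≥ → ½ * δ , *-pos ½>0 δ>0 , M , λ m m≥M → begin
      ∣ V n * inv (C * fromℕ (n ^ suc d)) - 1ℚ ∣ + ½ * δ ≤⟨ ℚ.+-monoˡ-≤ (½ * δ)
        (relative-error δ N K< δ>0 n (ℕ.m⊔n≤o⇒m≤o N₀ N n≥) (ℕ.m⊔n≤o⇒n≤o N₀ N n≥)) ⟩
      ½ * δ + ½ * δ                                  ≡⟨ S.solve 1 (λ δ → con ½ :* δ :+ con ½ :* δ := con 0ℚ :+ δ) refl δ ⟩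
      0ℚ + δ                                         ≤⟨ ε≥δ m m≥M ⟩
      seq ε m                                        ∎
    where open ℚ.≤-Reasoning

-- The order of ℚ is decidable, so the leading coefficient is shown to be positive by contradiction,
-- without knowing its value.
unbounded⇒AsymptoticTo : ∀ {d c V} → Degree (suc d) c V → ¬ BoundedBy d V → AsymptoticTo V (suc d)
unbounded⇒AsymptoticTo {c = c} h unbounded with 0ℚ ℚ.<? c
... | yes c>0 = leading-pos⇒AsymptoticTo h c>0
... | no  c≯0 = contradiction (leading-nonPos⇒BoundedBy h (ℚ.≮⇒≥ c≯0)) unbounded

free+∣A∣≡k : (A : Subset k) → free A ℕ.+ Subset.∣ A ∣ ≡ k
free+∣A∣≡k []          = refl
free+∣A∣≡k (true ∷ A)  = trans (ℕ.+-suc (free A) Subset.∣ A ∣) (cong suc (free+∣A∣≡k A))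
free+∣A∣≡k (false ∷ A) = cong suc (free+∣A∣≡k A)

exponent : (A : Subset k) → 2 ℕ.* blocks (suc k) A ∸ 1 ≡ suc (free A ℕ.+ free A)
exponent {k} A = trans (cong (λ j → 2 ℕ.* j ∸ 1) blocks≡) (trans
  (ℕ.+-suc (free A) (free A ℕ.+ 0)) (cong (λ f → suc (free A ℕ.+ f)) (ℕ.+-identityʳ (free A))))
  where
  blocks≡ : blocks (suc k) A ≡ suc (free A)
  blocks≡ = trans (cong (λ k → suc k ∸ Subset.∣ A ∣) (sym (free+∣A∣≡k A))) (ℕ.m+n∸n≡m (suc (free A)) Subset.∣ A ∣)

-- Consecutive patterns

growing⇒unbounded : ∀ {V δ} → 0ℚ < δ → ∀ N → (∀ n → N ℕ.≤ n → V n + δ ≤ V (suc n)) → ¬ BoundedBy 0 V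
growing⇒unbounded {V} {δ} δ>0 N grows (K , M , bound) =
  let i , K< = archimedean-* (K - V (N ℕ.⊔ M)) δ>0
      n = i ℕ.+ (N ℕ.⊔ M)
  in ≤⇒≯ (ℚ.≤-trans (climbs i) (ℚ.≤-trans (bound n (ℕ.≤-trans (ℕ.m≤n⊔m N M) (ℕ.m≤n+m (N ℕ.⊔ M) i))) (ℚ.≤-reflexive (ℚ.*-identityʳ K))))
         (ℚ.≤-<-trans (ℚ.≤-reflexive (S.solve 2 (λ k v → k := v :+ (k :- v)) refl K (V (N ℕ.⊔ M)))) (ℚ.+-monoʳ-< (V (N ℕ.⊔ M)) K<))
  where
  climbs : ∀ i → V (N ℕ.⊔ M) + fromℕ i * δ ≤ V (i ℕ.+ (N ℕ.⊔ M))
  climbs zero    = ℚ.≤-reflexive (trans (cong (V (N ℕ.⊔ M) +_) (ℚ.*-zeroˡ δ)) (ℚ.+-identityʳ _))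
  climbs (suc i) = begin
    V (N ℕ.⊔ M) + fromℕ (suc i) * δ      ≡⟨ cong (λ s → V (N ℕ.⊔ M) + s * δ) (fromℕ-suc i) ⟩
    V (N ℕ.⊔ M) + (1ℚ + fromℕ i) * δ     ≡⟨ S.solve 3 (λ v i d → v :+ (con 1ℚ :+ i) :* d := v :+ i :* d :+ d) refl (V (N ℕ.⊔ M)) (fromℕ i) δ ⟩
    V (N ℕ.⊔ M) + fromℕ i * δ + δ        ≤⟨ ℚ.+-monoˡ-≤ δ (climbs i) ⟩
    V (i ℕ.+ (N ℕ.⊔ M)) + δ              ≤⟨ grows (i ℕ.+ (N ℕ.⊔ M)) (ℕ.≤-trans (ℕ.m≤m⊔n N M) (ℕ.m≤n+m (N ℕ.⊔ M) i)) ⟩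
    V (suc i ℕ.+ (N ℕ.⊔ M))              ∎
    where open ℚ.≤-Reasoning

positions-forced : (bs : Vec Bool k) → free bs ≡ 0 → ∀ n → (positions bs n ≡ []) ⊎ ∃ λ v → positions bs n ≡ v ∷ []
positions-forced []          e n       = inj₂ ([] , refl)
positions-forced (true ∷ bs) e zero    = inj₁ refl
positions-forced (true ∷ bs) e (suc n) with positions-forced bs e n
... | inj₁ eq       = inj₁ (cong (map zero∷) eq)
... | inj₂ (v , eq) = inj₂ (zero∷ v , cong (map zero∷) eq)

positions-forced-long : (bs : Vec Bool k) → free bs ≡ 0 → ∀ n → k ℕ.≤ n → ∃ λ v → positions bs n ≡ v ∷ []
positions-forced-long []          e n       k≤n           = [] , refl
positions-forced-long (true ∷ bs) e (suc n) (ℕ.s≤s k≤n) with positions-forced-long bs e n k≤n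
... | v , eq = zero∷ v , cong (map zero∷) eq

-- A fully forced vector can only be 0, 1, 2, ..., so the sum has at most one term; if n is too
-- small it is empty, which is why a ≥ 0 is required.
forced-∑-≥ : ∀ {a} → 0ℚ ≤ a → (bs : Vec Bool k) → free bs ≡ 0 → (f : Vec (Fin n) k → ℚ) → (∀ v → - a ≤ f v) →
  - a ≤ ∑ (positions bs n) f
forced-∑-≥ {n = n} a≥0 bs e f f≥ with positions bs n | positions-forced bs e n
... | _ | inj₁ refl       = ℚ.neg-antimono-≤ a≥0
... | _ | inj₂ (v , refl) = ℚ.≤-trans (f≥ v) (ℚ.≤-reflexive (sym (ℚ.+-identityʳ (f v))))

PairSum-[]ˡ : {G : Family 0 l} → VanishesOnDisjoint G → (cs : Vec Bool l) → ∀ n → PairSum G [] cs n ≡ 0ℚ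
PairSum-[]ˡ {G = G} vanishes cs n = trans (ℚ.+-identityʳ _) (trans
  (∑-cong-All (positions-injective cs n) {G n []} {λ _ → 0ℚ} (λ w w-inj → vanishes [] w (λ ()) w-inj (λ ())))
  (∑-zero (positions cs n) (λ _ → refl)))

-- One of the two occurrences starts at 0 and each of its letters meets the start of
-- at most one occurrence of the other kind.
PairSum-forced-≥ : ∀ {a} → 0ℚ ≤ a → {G : Family k (suc l)} → VanishesOnDisjoint G → (∀ n v w → - a ≤ G n v w) →
  (bs : Vec Bool k) (cs : Vec Bool l) → free bs ≡ 0 → free cs ≡ 0 → ∀ n →
  - (fromℕ k * a) ≤ PairSum G bs (false ∷ cs) n
PairSum-forced-≥ {a = a} a≥0 {G} vanishes G≥ [] cs _ _ n = ℚ.≤-reflexive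
  (trans (cong -_ (ℚ.*-zeroˡ a)) (sym (PairSum-[]ˡ {G = G} vanishes (false ∷ cs) n)))
PairSum-forced-≥ {suc k} {a = a} a≥0 vanishes G≥ (true ∷ bs) cs _ _ zero = ℚ.neg-antimono-≤ (*-nonNeg (0≤fromℕ (suc k)) a≥0)
PairSum-forced-≥ {suc k} {a = a} a≥0 {G} vanishes G≥ (true ∷ bs) cs e e′ (suc n) = begin
  - (fromℕ (suc k) * a)       ≡⟨ cong (λ s → - (s * a)) (fromℕ-suc k) ⟩
  - ((1ℚ + fromℕ k) * a)      ≡⟨ S.solve 2 (λ k a → :- ((con 1ℚ :+ k) :* a) := (:- (k :* a)) :+ (:- a)) refl (fromℕ k) a ⟩
  - (fromℕ k * a) + - a       ≤⟨ ℚ.+-mono-≤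
                                   (PairSum-forced-≥ a≥0 {∂ˡ G} (∂ˡ-vanishes {F = G} vanishes) (λ n v w → G≥ (suc n) (zero∷ v) (shift w)) bs cs e e′ n)
                                   (forced-∑-≥ a≥0 bs e _ (λ v → forced-∑-≥ a≥0 cs e′ _ (λ w → G≥ (suc n) (zero∷ v) (zero∷ w)))) ⟩
  PairSum (∂ˡ G) bs (false ∷ cs) n + PairSum (∂ᵇ G) bs cs n ≡⟨ step-forced-free {F = G} bs cs n ⟨
  PairSum G (true ∷ bs) (false ∷ cs) (suc n) ∎
  where open ℚ.≤-Reasoning

χ-idempotent : (π : Permutation′ k) (v : Fin k → Fin n) (σ : Permutation′ n) → χ π v σ * χ π v σ ≡ χ π v σ
χ-idempotent π v σ = trans (χ-cong-* {p = χ π v σ} {1ℚ} (λ m → trans (χ-𝟙 π v σ (yes m)) refl)) (ℚ.*-identityʳ _)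

pairCov-comm : (π : Permutation′ k) (v w : Vec (Fin n) k) → pairCov π n v w ≡ pairCov π n w v
pairCov-comm {k} π v w = cong (_- 1/ k ! * 1/ k !) (𝔼-cong (λ σ → ℚ.*-comm (χ π (lookup v) σ) (χ π (lookup w) σ)))

pairCov-diagonal : (π : Permutation′ k) (v : Vec (Fin n) k) → InjectiveVec v → pairCov π n v v ≡ 1/ k ! - 1/ k ! * 1/ k !
pairCov-diagonal {k} π v v-inj = cong (_- 1/ k ! * 1/ k !) (trans (𝔼-cong (χ-idempotent π (lookup v))) (𝔼-χ v-inj π))

pairCov-≥ : (π : Permutation′ k) → ∀ n v w → - (1/ k ! * 1/ k !) ≤ pairCov π n v w
pairCov-≥ {k} π n v w = ℚ.≤-trans (ℚ.≤-reflexive (sym (ℚ.+-identityˡ _)))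
  (ℚ.+-monoˡ-≤ (- (1/ k ! * 1/ k !)) (𝔼-nonNeg (λ σ → *-nonNeg (0≤χ π (lookup v) σ) (0≤χ π (lookup w) σ))))

module _ (π : Permutation′ (suc k)) (A : Subset k) (consecutive : free A ≡ 0) where

  private
    F : Family (suc k) (suc k)
    F = pairCov π
    u = 1/ suc k !
    L : ℕ → ℚ
    L n = PairSum (∂ˡ F) A (false ∷ A) n

    R≡L : ∀ n → PairSum (∂ʳ F) (false ∷ A) A n ≡ L n
    R≡L n = trans (∑-swap (positions (false ∷ A) n) (positions A n) (∂ʳ F n))
      (∑-cong (positions A n) (λ w → ∑-cong (positions (false ∷ A) n) (λ v → pairCov-comm π (shift v) (zero∷ w))))

    -- Both vectors are forced to be 0, 1, ..., k, and for k ≤ n there is room for them. A single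
    -- variance remains.
    B≡ : ∀ n → k ℕ.≤ n → PairSum (∂ᵇ F) A A n ≡ u - u * u
    B≡ n k≤n = let v , eq = positions-forced-long A consecutive n k≤n in
      begin
        PairSum (∂ᵇ F) A A n                      ≡⟨ cong (λ xs → ∑ xs (λ v → ∑ xs (∂ᵇ F n v))) eq ⟩
        F (suc n) (zero∷ v) (zero∷ v) + 0ℚ + 0ℚ   ≡⟨ trans (ℚ.+-identityʳ _) (ℚ.+-identityʳ _) ⟩
        F (suc n) (zero∷ v) (zero∷ v)             ≡⟨ pairCov-diagonal π (zero∷ v) (zero∷-injective v
                                                       (All.head (subst (All InjectiveVec) eq (positions-injective A n)))) ⟩
        u - u * u                                 ∎
      where open ≡-Reasoning

  -- The variance grows from n to n + 1 by the pairs that use position 0: two mirror images of `L`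
  -- and the diagonal term. Hence it suffices that a lower bound `a` of `L`, counted twice, does not
  -- outweigh the diagonal.
  consecutive-unbounded : ∀ a N → 0ℚ < a + (a + (u - u * u)) → k ℕ.≤ N → (∀ n → N ℕ.≤ n → a ≤ L n) →
    ¬ BoundedBy 0 (λ n → Var {n} (occurrences π A))
  consecutive-unbounded a N δ>0 k≤N L≥ = growing⇒unbounded δ>0 N λ n n≥N →
    subst₂ (λ x y → x + (a + (a + (u - u * u))) ≤ y) (sym (Var≡PairSum π A n)) (sym (Var≡PairSum π A (suc n))) (begin
      S₀ n + (a + (a + (u - u * u)))   ≤⟨ ℚ.+-monoʳ-≤ (S₀ n) (ℚ.+-mono-≤ (L≥ n n≥N) (ℚ.+-monoˡ-≤ (u - u * u) (L≥ n n≥N))) ⟩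
      S₀ n + (L n + (L n + (u - u * u))) ≡⟨ cong₂ (λ r b → S₀ n + (r + (L n + b))) (R≡L n) (B≡ n (ℕ.≤-trans k≤N n≥N)) ⟨
      S₀ n + (PairSum (∂ʳ F) (false ∷ A) A n + (L n + PairSum (∂ᵇ F) A A n)) ≡⟨ step-free-free {F = F} A A n (pairCov-stable π) ⟨
      S₀ (suc n)                       ∎)
    where
    open ℚ.≤-Reasoning
    S₀ : ℕ → ℚ
    S₀ = PairSum F (false ∷ A) (false ∷ A)

  -- Each of at most k overlaps on either side costs at most u², so the increment is at least u²
  -- ((k+1)! - (2k+1)). For k ≥ 2 this is positive because (k+1)! ≥ 2 (k+1).
  consecutive-unbounded-long : 2 ℕ.≤ k → ¬ BoundedBy 0 (λ n → Var {n} (occurrences π A))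
  consecutive-unbounded-long k≥2 = consecutive-unbounded (- (fromℕ k * (u * u))) k positive ℕ.≤-refl
    (λ n _ → PairSum-forced-≥ (square-nonNeg u) {∂ˡ F} (∂ˡ-vanishes {F = F} (pairCov-vanishes π))
      (λ n v w → pairCov-≥ π (suc n) (zero∷ v) (shift w)) A A consecutive consecutive n)
    where
    2k+1<[1+k]! : suc k ℕ.+ k ℕ.< suc k !
    2k+1<[1+k]! = ℕ.<-≤-trans (ℕ.≤-reflexive (cong suc (trans (sym (ℕ.+-suc k k)) (cong (k ℕ.+_) (sym (ℕ.+-identityʳ (suc k)))))))
      (ℕ.≤-trans (ℕ.≤-reflexive (ℕ.*-comm 2 (suc k))) (ℕ.*-monoʳ-≤ (suc k) (ℕ.≤-trans k≥2 (k≤k! k))))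
      where
      k≤k! : ∀ k → k ℕ.≤ k !
      k≤k! zero    = ℕ.z≤n
      k≤k! (suc k) = ℕ.m≤m*n (suc k) (k !) {{k ℕ.!≢0}}
    positive : 0ℚ < - (fromℕ k * (u * u)) + (- (fromℕ k * (u * u)) + (u - u * u))
    positive = subst (0ℚ <_) (begin
        u * u * (fromℕ (suc k !) - fromℕ (suc k ℕ.+ k))
          ≡⟨ cong (λ s → u * u * (fromℕ (suc k !) - s)) (trans (fromℕ-suc (k ℕ.+ k)) (cong (1ℚ +_) (fromℕ-+ k k))) ⟩
        u * u * (fromℕ (suc k !) - (1ℚ + (fromℕ k + fromℕ k)))
          ≡⟨ S.solve 3 (λ u f k → u :* u :* (f :- (con 1ℚ :+ (k :+ k))) := (:- (k :* (u :* u))) :+ ((:- (k :* (u :* u))) :+ (u :* (f :* u) :- u :* u)))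
               refl u (fromℕ (suc k !)) (fromℕ k) ⟩
        - (fromℕ k * (u * u)) + (- (fromℕ k * (u * u)) + (u * (fromℕ (suc k !) * u) - u * u))
          ≡⟨ cong (λ x → - (fromℕ k * (u * u)) + (- (fromℕ k * (u * u)) + (x - u * u)))
               (trans (cong (u *_) (n!*1/n!≡1 (suc k))) (ℚ.*-identityʳ u)) ⟩
        - (fromℕ k * (u * u)) + (- (fromℕ k * (u * u)) + (u - u * u)) ∎)
      (*-pos (*-pos (0<1/n! (suc k)) (0<1/n! (suc k))) (0<-diff (fromℕ-mono-< 2k+1<[1+k]!)))
      where open ≡-Reasoning

-- For k = 2 the bound pairCov-≥ is too weak; two consecutive ascents (or descents)
-- form a monotone pattern of length 3, of probability 1/6.
matches-restrict : {π : Permutation′ k} {ρ : Permutation′ l} (f : Fin k → Fin l) {v : Fin k → Fin n} {w : Fin l → Fin n} {σ : Permutation′ n} →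
  (∀ r → w (f r) ≡ v r) → (∀ r s → (π ⟨$⟩ʳ r) Fin.< (π ⟨$⟩ʳ s) ⇔ (ρ ⟨$⟩ʳ f r) Fin.< (ρ ⟨$⟩ʳ f s)) →
  Matches ρ w σ → Matches π v σ
matches-restrict f {σ = σ} wf≡v order m r s = mk⇔
  (λ lt → subst₂ (λ i j → (σ ⟨$⟩ʳ i) Fin.< (σ ⟨$⟩ʳ j)) (wf≡v r) (wf≡v s) (Equivalence.to (m (f r) (f s)) (Equivalence.to (order r s) lt)))
  (λ lt → Equivalence.from (order r s) (Equivalence.from (m (f r) (f s))
    (subst₂ (λ i j → (σ ⟨$⟩ʳ i) Fin.< (σ ⟨$⟩ʳ j)) (sym (wf≡v r)) (sym (wf≡v s)) lt)))

-- Both pairs of neighbours in a monotone word have the order of the word: `ρ` is the identity if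
-- `π` is increasing and the reversal otherwise.
monotoneExtension : (π : Permutation′ 2) → ∃ λ (ρ : Permutation′ 3) →
  (∀ r s → (π ⟨$⟩ʳ r) Fin.< (π ⟨$⟩ʳ s) ⇔ (ρ ⟨$⟩ʳ Fin.inject₁ r) Fin.< (ρ ⟨$⟩ʳ Fin.inject₁ s))
  × (∀ r s → (π ⟨$⟩ʳ r) Fin.< (π ⟨$⟩ʳ s) ⇔ (ρ ⟨$⟩ʳ Fin.suc r) Fin.< (ρ ⟨$⟩ʳ Fin.suc s))
monotoneExtension π with (π ⟨$⟩ʳ Fin.zero) Fin.<? (π ⟨$⟩ʳ Fin.suc Fin.zero)
... | yes lt = Perm.id , order inject₁-id , order suc-id
  where
  order : {Q : Fin 2 → Fin 2 → Set} → (∀ r s → r Fin.< s ⇔ Q r s) → ∀ r s → (π ⟨$⟩ʳ r) Fin.< (π ⟨$⟩ʳ s) ⇔ Q r s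
  order h r@Fin.zero           s@Fin.zero           = mk⇔ (λ e → contradiction e (ℕ.<-irrefl refl)) (λ q → contradiction (Equivalence.from (h r s) q) (ℕ.<-irrefl refl))
  order h r@Fin.zero           s@(Fin.suc Fin.zero) = mk⇔ (λ _ → Equivalence.to (h r s) (ℕ.s≤s ℕ.z≤n)) (λ _ → lt)
  order h r@(Fin.suc Fin.zero) s@Fin.zero           = mk⇔ (λ e → contradiction e (ℕ.<-asym lt)) (λ q → contradiction (Equivalence.from (h r s) q) λ ())
  order h r@(Fin.suc Fin.zero) s@(Fin.suc Fin.zero) = mk⇔ (λ e → contradiction e (ℕ.<-irrefl refl)) (λ q → contradiction (Equivalence.from (h r s) q) (ℕ.<-irrefl refl))
  inject₁-id : ∀ (r s : Fin 2) → r Fin.< s ⇔ Fin.inject₁ r Fin.< Fin.inject₁ s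
  inject₁-id r s rewrite Fin.toℕ-inject₁ r | Fin.toℕ-inject₁ s = mk⇔ id id
  suc-id : ∀ (r s : Fin 2) → r Fin.< s ⇔ Fin.suc r Fin.< Fin.suc s
  suc-id r s = mk⇔ ℕ.s≤s ℕ.s≤s⁻¹
... | no ≮ = Perm.reverse , order inject₁-reverse , order suc-reverse
  where
  gt : (π ⟨$⟩ʳ Fin.suc Fin.zero) Fin.< (π ⟨$⟩ʳ Fin.zero)
  gt = ℕ.≤∧≢⇒< (ℕ.≮⇒≥ ≮) (λ e → case (perm-injective π (Fin.toℕ-injective e)))
    where
    case : ¬ (Fin.suc Fin.zero ≡ Fin.zero {1})
    case ()
  order : {Q : Fin 2 → Fin 2 → Set} → (∀ r s → s Fin.< r ⇔ Q r s) → ∀ r s → (π ⟨$⟩ʳ r) Fin.< (π ⟨$⟩ʳ s) ⇔ Q r s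
  order h r@Fin.zero           s@Fin.zero           = mk⇔ (λ e → contradiction e (ℕ.<-irrefl refl)) (λ q → contradiction (Equivalence.from (h r s) q) (ℕ.<-irrefl refl))
  order h r@Fin.zero           s@(Fin.suc Fin.zero) = mk⇔ (λ e → contradiction e ≮) (λ q → contradiction (Equivalence.from (h r s) q) λ ())
  order h r@(Fin.suc Fin.zero) s@Fin.zero           = mk⇔ (λ _ → Equivalence.to (h r s) (ℕ.s≤s ℕ.z≤n)) (λ _ → gt)
  order h r@(Fin.suc Fin.zero) s@(Fin.suc Fin.zero) = mk⇔ (λ e → contradiction e (ℕ.<-irrefl refl)) (λ q → contradiction (Equivalence.from (h r s) q) (ℕ.<-irrefl refl))
  opposite-< : ∀ (r s : Fin n) → s Fin.< r → Fin.opposite r Fin.< Fin.opposite s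
  opposite-< r s s<r rewrite Fin.opposite-prop r | Fin.opposite-prop s = ℕ.∸-monoʳ-< (ℕ.s≤s s<r) (Fin.toℕ<n r)
  opposite-⇔ : ∀ (r s : Fin n) → s Fin.< r ⇔ Fin.opposite r Fin.< Fin.opposite s
  opposite-⇔ r s = mk⇔ (opposite-< r s) (λ lt → subst₂ Fin._<_ (Fin.opposite-involutive s) (Fin.opposite-involutive r)
    (opposite-< (Fin.opposite s) (Fin.opposite r) lt))
  inject₁-reverse : ∀ (r s : Fin 2) → s Fin.< r ⇔ Fin.opposite (Fin.inject₁ r) Fin.< Fin.opposite (Fin.inject₁ s)
  inject₁-reverse r s = mk⇔
    (λ lt → Equivalence.to (opposite-⇔ (Fin.inject₁ r) (Fin.inject₁ s)) (subst₂ ℕ._<_ (sym (Fin.toℕ-inject₁ s)) (sym (Fin.toℕ-inject₁ r)) lt))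
    (λ lt → subst₂ ℕ._<_ (Fin.toℕ-inject₁ s) (Fin.toℕ-inject₁ r) (Equivalence.from (opposite-⇔ (Fin.inject₁ r) (Fin.inject₁ s)) lt))
  suc-reverse : ∀ (r s : Fin 2) → s Fin.< r ⇔ Fin.opposite (Fin.suc r) Fin.< Fin.opposite (Fin.suc s)
  suc-reverse r s = mk⇔
    (λ lt → Equivalence.to (opposite-⇔ (Fin.suc r) (Fin.suc s)) (ℕ.s≤s lt))
    (λ lt → ℕ.s≤s⁻¹ (Equivalence.from (opposite-⇔ (Fin.suc r) (Fin.suc s)) lt))

module _ (π : Permutation′ 2) where

  pairCov-overlap-≥ : (v : Vec (Fin n) 3) → InjectiveVec v →
    1/ 3 ! - 1/ 2 ! * 1/ 2 ! ≤ pairCov π n (lookup v Fin.zero ∷ lookup v (Fin.suc Fin.zero) ∷ [])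
                                           (lookup v (Fin.suc Fin.zero) ∷ lookup v (Fin.suc (Fin.suc Fin.zero)) ∷ [])
  pairCov-overlap-≥ {n} v v-inj = ℚ.+-monoˡ-≤ (- (1/ 2 ! * 1/ 2 !)) (ℚ.≤-trans (ℚ.≤-reflexive (sym (𝔼-χ v-inj ρ)))
    (𝔼-mono pointwise))
    where
    ρ = proj₁ (monotoneExtension π)
    w₁ w₂ : Vec (Fin n) 2
    w₁ = lookup v Fin.zero ∷ lookup v (Fin.suc Fin.zero) ∷ []
    w₂ = lookup v (Fin.suc Fin.zero) ∷ lookup v (Fin.suc (Fin.suc Fin.zero)) ∷ []
    pointwise : ∀ σ → χ ρ (lookup v) σ ≤ χ π (lookup w₁) σ * χ π (lookup w₂) σ
    pointwise σ = ℚ.≤-trans (ℚ.≤-reflexive (trans (sym (ℚ.*-identityʳ _)) (χ-cong-* {p = 1ℚ} (λ m → sym (both m)))))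
      (ℚ.≤-trans (*-monoʳ p p≥0 (χ≤1 ρ (lookup v) σ)) (ℚ.≤-reflexive (ℚ.*-identityˡ p)))
      where
      p = χ π (lookup w₁) σ * χ π (lookup w₂) σ
      p≥0 = *-nonNeg (0≤χ π (lookup w₁) σ) (0≤χ π (lookup w₂) σ)
      both : Matches ρ (lookup v) σ → p ≡ 1ℚ
      both m = cong₂ _*_
        (χ-𝟙 π (lookup w₁) σ (yes (matches-restrict {π = π} {ρ} Fin.inject₁ {lookup w₁} {lookup v} {σ}
          (λ { Fin.zero → refl ; (Fin.suc Fin.zero) → refl }) (proj₁ (proj₂ (monotoneExtension π))) m)))
        (χ-𝟙 π (lookup w₂) σ (yes (matches-restrict {π = π} {ρ} Fin.suc {lookup w₂} {lookup v} {σ}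
          (λ { Fin.zero → refl ; (Fin.suc Fin.zero) → refl }) (proj₂ (proj₂ (monotoneExtension π))) m)))

  consecutive-unbounded-short : ¬ BoundedBy 0 (λ n → Var {n} (occurrences π (true ∷ [])))
  -- The increment is at least 2 (1/6 - 1/4) + (1/2 - 1/4) = 1/12, whose sign is found by
  -- evaluation. From n = 2 on, `Fin (suc n)` has room for the positions 0, 1, 2; the windows 01 and
  -- 12 are the only overlap counted by `L`.
  consecutive-unbounded-short = consecutive-unbounded π (true ∷ []) refl (1/ 3 ! - 1/ 2 ! * 1/ 2 !) 2 (ℚ.positive⁻¹ _) (ℕ.s≤s ℕ.z≤n)
    λ { (suc zero) (ℕ.s≤s ()) ; (suc (suc n)) _ → begin
      1/ 3 ! - 1/ 2 ! * 1/ 2 !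
        ≤⟨ pairCov-overlap-≥ (zero∷ (zero∷ (zero∷ []))) (zero∷-injective {n = suc (suc n)} (zero∷ (zero∷ [])) (zero∷-injective (zero∷ []) (zero∷-injective [] λ ()))) ⟩
      G (suc n) [] (Fin.zero ∷ [])
        ≡⟨ trans (ℚ.+-identityʳ _) (ℚ.+-identityʳ _) ⟨
      PairSum G [] (true ∷ []) (suc n)
        ≡⟨ ℚ.+-identityˡ _ ⟨
      0ℚ + PairSum G [] (true ∷ []) (suc n)
        ≡⟨ cong (_+ PairSum G [] (true ∷ []) (suc n)) (PairSum-[]ˡ {G = ∂ˡ (∂ˡ F)}
             (∂ˡ-vanishes {F = ∂ˡ F} (∂ˡ-vanishes {F = F} (pairCov-vanishes π))) (false ∷ true ∷ []) (suc n)) ⟨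
      PairSum (∂ˡ (∂ˡ F)) [] (false ∷ true ∷ []) (suc n) + PairSum G [] (true ∷ []) (suc n)
        ≡⟨ step-forced-free {F = ∂ˡ F} [] (true ∷ []) (suc n) ⟨
      PairSum (∂ˡ F) (true ∷ []) (false ∷ true ∷ []) (suc (suc n)) ∎ }
    where
    open ℚ.≤-Reasoning
    F = pairCov π
    G = ∂ᵇ (∂ˡ F)

-- Small letters

small : ℕ → Fin n → Permutation′ n → ℚ
small t i σ = 𝟙 (toℕ (σ ⟨$⟩ʳ i) ℕ.<? t)

0≤small : ∀ t (i : Fin n) (σ : Permutation′ n) → 0ℚ ≤ small t i σ
0≤small t i σ = 0≤𝟙 (toℕ (σ ⟨$⟩ʳ i) ℕ.<? t)

small-resp : ∀ t (i : Fin n) → Respects≈ (small t i)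
small-resp t i e = cong (λ j → 𝟙 (toℕ j ℕ.<? t)) (e i)

∑Fin-<? : ∀ {t} → t ℕ.≤ n → ∑Fin n (λ i → 𝟙 (toℕ i ℕ.<? t)) ≡ fromℕ t
∑Fin-<? {n} {zero} _ = ∑-zero (allFin n) (λ i → 𝟙-false (toℕ i ℕ.<? 0) (λ ()))
∑Fin-<? {suc n} {suc t} (ℕ.s≤s t≤n) = begin
  ∑Fin (suc n) (λ i → 𝟙 (toℕ i ℕ.<? suc t))                 ≡⟨ ∑Fin-suc {n} (λ i → 𝟙 (toℕ i ℕ.<? suc t)) ⟩
  𝟙 (0 ℕ.<? suc t) + ∑Fin n (λ i → 𝟙 (suc (toℕ i) ℕ.<? suc t)) ≡⟨ cong₂ _+_ (𝟙-true (0 ℕ.<? suc t) (ℕ.s≤s ℕ.z≤n))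
                                                                 (∑-cong (allFin n) (λ i → 𝟙-cong (suc (toℕ i) ℕ.<? suc t) (toℕ i ℕ.<? t) ℕ.s≤s⁻¹ ℕ.s≤s)) ⟩
  1ℚ + ∑Fin n (λ i → 𝟙 (toℕ i ℕ.<? t))                      ≡⟨ cong (1ℚ +_) (∑Fin-<? t≤n) ⟩
  1ℚ + fromℕ t                                              ≡⟨ fromℕ-suc t ⟨
  fromℕ (suc t)                                             ∎
  where open ≡-Reasoning

n*𝔼-small : ∀ {t} → t ℕ.≤ n → (i : Fin n) → fromℕ n * 𝔼 (small t i) ≡ fromℕ t
n*𝔼-small {suc n} {t} t≤n i = begin
  fromℕ (suc n) * 𝔼 (small t i)                             ≡⟨ 𝔼-insert i (λ {σ} {τ} → small-resp t i {σ} {τ}) ⟨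
  ∑Fin (suc n) (λ v → 𝔼 (λ τ → small t i (insert i v τ)))   ≡⟨ ∑-cong (allFin (suc n)) (λ v → trans
                                                                 (𝔼-cong (λ τ → cong (λ j → 𝟙 (toℕ j ℕ.<? t)) (insert-at i v τ)))
                                                                 (𝔼-const {n} (𝟙 (toℕ v ℕ.<? t)))) ⟩
  ∑Fin (suc n) (λ v → 𝟙 (toℕ v ℕ.<? t))                     ≡⟨ ∑Fin-<? t≤n ⟩
  fromℕ t                                                   ∎
  where open ≡-Reasoning

-- The inserted value occupies one of the `suc t` small values, so only t of them are left for the
-- other letters.
punchIn-small : ∀ t (v : Fin (suc n)) (w : Fin n) → toℕ v ℕ.< suc t → toℕ (punchIn v w) ℕ.< suc t → toℕ w ℕ.< t
punchIn-small t       Fin.zero    w           _             lt            = ℕ.s≤s⁻¹ lt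
punchIn-small (suc t) (Fin.suc v) Fin.zero    _             _             = ℕ.s≤s ℕ.z≤n
punchIn-small (suc t) (Fin.suc v) (Fin.suc w) (ℕ.s≤s lt-v) (ℕ.s≤s lt-w) = ℕ.s≤s (punchIn-small t v w lt-v lt-w)
punchIn-small zero    (Fin.suc v) w           (ℕ.s≤s ())    _

module _ {n t : ℕ} {q : ℚ} (t≤n : t ℕ.≤ n) (q≤1 : q ≤ 1ℚ) (nq≡t : fromℕ n * q ≡ fromℕ t) where

  𝔼-small : (i : Fin n) → 𝔼 (small t i) ≡ q
  𝔼-small i = cancel i (trans (n*𝔼-small t≤n i) (sym nq≡t))
    where
    cancel : ∀ {n p q} → Fin n → fromℕ n * p ≡ fromℕ n * q → p ≡ q
    cancel {suc n} _ = cancel-fromℕ n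

-- Sampling without replacement: once one letter is known to be small, a smaller proportion of small
-- values is left for the other.
𝔼-small-small : ∀ {n t q} → t ℕ.≤ n → q ≤ 1ℚ → fromℕ n * q ≡ fromℕ t → (i j : Fin n) → i ≢ j →
  𝔼 (λ σ → small t i σ * small t j σ) ≤ q * q
𝔼-small-small {n} {zero} {q} t≤n q≤1 nq≡t i j i≢j = ℚ.≤-trans
  (ℚ.≤-reflexive (trans (𝔼-cong (λ σ → trans (cong (_* small 0 j σ) (𝟙-false (toℕ (σ ⟨$⟩ʳ i) ℕ.<? 0) (λ ()))) (ℚ.*-zeroˡ (small 0 j σ)))) (𝔼-const {n} 0ℚ)))
  (square-nonNeg q)
𝔼-small-small {suc n} {suc t} {q} (ℕ.s≤s t≤n) q≤1 nq≡t i j i≢j with punchedView i j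
... | here      = contradiction refl i≢j
... | punched l = *-cancel n (begin
  fromℕ (suc n) * 𝔼 F
    ≡⟨ 𝔼-insert i {F} (λ {σ} {τ} e → cong₂ _*_ (small-resp (suc t) i {σ} {τ} e) (small-resp (suc t) (punchIn i l) {σ} {τ} e)) ⟨
  ∑Fin (suc n) (λ v → 𝔼 (λ τ → F (insert i v τ)))
    ≤⟨ ∑-mono (allFin (suc n)) (λ v → ℚ.≤-trans (𝔼-mono (λ τ → bound v τ)) (ℚ.≤-reflexive (𝔼-* (𝟙 (toℕ v ℕ.<? suc t)) (small t l)))) ⟩
  ∑Fin (suc n) (λ v → 𝟙 (toℕ v ℕ.<? suc t) * q′)
    ≡⟨ ∑-*ʳ (allFin (suc n)) q′ (λ v → 𝟙 (toℕ v ℕ.<? suc t)) ⟩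
  ∑Fin (suc n) (λ v → 𝟙 (toℕ v ℕ.<? suc t)) * q′
    ≡⟨ cong (_* q′) (trans (∑Fin-<? (ℕ.s≤s t≤n)) (sym nq≡t)) ⟩
  fromℕ (suc n) * q * q′
    ≤⟨ *-monoˡ (fromℕ (suc n) * q) (subst (0ℚ ≤_) (sym nq≡t) (0≤fromℕ (suc t))) (q′≤q l (n*𝔼-small t≤n l) nq≡t) ⟩
  fromℕ (suc n) * q * q
    ≡⟨ ℚ.*-assoc (fromℕ (suc n)) q q ⟩
  fromℕ (suc n) * (q * q) ∎)
  where
  open ℚ.≤-Reasoning
  *-cancel : ∀ n {p q} → fromℕ (suc n) * p ≤ fromℕ (suc n) * q → p ≤ q
  *-cancel n = ℚ.*-cancelˡ-≤-pos (fromℕ (suc n)) {{ℚ.positive (0<fromℕ {suc n})}}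
  F : Permutation′ (suc n) → ℚ
  F σ = small (suc t) i σ * small (suc t) (punchIn i l) σ
  q′ = 𝔼 (small t l)
  bound : ∀ v τ → F (insert i v τ) ≤ 𝟙 (toℕ v ℕ.<? suc t) * small t l τ
  bound v τ rewrite insert-at i v τ | Perm.insert-punchIn i v τ l with toℕ v ℕ.<? suc t
  ... | yes v<t = *-monoˡ 1ℚ 0≤1 (𝟙-mono (toℕ (punchIn v (τ ⟨$⟩ʳ l)) ℕ.<? suc t) (toℕ (τ ⟨$⟩ʳ l) ℕ.<? t) (punchIn-small t v (τ ⟨$⟩ʳ l) v<t))
  ... | no  _   = ℚ.≤-reflexive (trans
    (ℚ.*-zeroˡ (𝟙 (toℕ (punchIn v (τ ⟨$⟩ʳ l)) ℕ.<? suc t)))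
    (sym (ℚ.*-zeroˡ (small t l τ))))
  -- This is t/n ≤ (t+1)/(n+1), which uses `q` ≤ 1: removing a whole unit from numerator and
  -- denominator lowers a fraction that is at most 1.
  q′≤q : ∀ {n} → Fin n → fromℕ n * q′ ≡ fromℕ t → fromℕ (suc n) * q ≡ fromℕ (suc t) → q′ ≤ q
  q′≤q {suc n} _ nq′ nq = *-cancel n (begin
    fromℕ (suc n) * q′              ≡⟨ nq′ ⟩
    fromℕ t                         ≡⟨ S.solve 1 (λ t → t := (con 1ℚ :+ t) :- con 1ℚ) refl (fromℕ t) ⟩
    1ℚ + fromℕ t - 1ℚ               ≡⟨ cong (_- 1ℚ) (trans (sym (fromℕ-suc t)) (sym nq)) ⟩
    fromℕ (suc (suc n)) * q - 1ℚ    ≤⟨ ℚ.+-monoʳ-≤ (fromℕ (suc (suc n)) * q) (ℚ.neg-antimono-≤ q≤1) ⟩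
    fromℕ (suc (suc n)) * q - q     ≡⟨ cong (λ s → s * q - q) (fromℕ-suc (suc n)) ⟩
    (1ℚ + fromℕ (suc n)) * q - q    ≡⟨ S.solve 2 (λ n q → (con 1ℚ :+ n) :* q :- q := n :* q) refl (fromℕ (suc n)) q ⟩
    fromℕ (suc n) * q               ∎)

𝟙-≤-* : (d : Dec P) (e : Dec Q) → (P → Q) → 𝟙 d ≤ 𝟙 d * 𝟙 e
𝟙-≤-* (yes p) e       p→q = ℚ.≤-reflexive (sym (trans (ℚ.*-identityˡ (𝟙 e)) (𝟙-true e (p→q p))))
𝟙-≤-* (no _)  e       p→q = ℚ.≤-reflexive (sym (ℚ.*-zeroˡ (𝟙 e)))

∑Fin-permute : (ρ : Permutation′ n) (f : Fin n → ℚ) → ∑Fin n (λ i → f (ρ ⟨$⟩ʳ i)) ≡ ∑Fin n f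
∑Fin-permute {n} ρ f = ∑-transport (allFin n) (allFin n) (λ i j → 𝟙 ((ρ ⟨$⟩ʳ i) Fin.≟ j))
  (λ i → ∑Fin-delta (ρ ⟨$⟩ʳ i) f)
  (λ j → trans
    (∑-cong (allFin n) (λ i → trans
      (𝟙-cong ((ρ ⟨$⟩ʳ i) Fin.≟ j) ((ρ ⟨$⟩ˡ j) Fin.≟ i)
        (λ e → trans (cong (ρ ⟨$⟩ˡ_) (sym e)) (Perm.inverseˡ ρ))
        (λ e → trans (cong (ρ ⟨$⟩ʳ_) (sym e)) (Perm.inverseʳ ρ)))
      (sym (ℚ.*-identityʳ (𝟙 ((ρ ⟨$⟩ˡ j) Fin.≟ i))))))
    (∑Fin-delta (ρ ⟨$⟩ˡ j) (λ _ → 1ℚ)))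

cov-*ʳ : (c : ℚ) (F G : Permutation′ n → ℚ) → cov F (λ σ → c * G σ) ≡ c * cov F G
cov-*ʳ c F G = trans (cov-comm F (λ σ → c * G σ)) (trans (cov-*ˡ c G F) (cong (c *_) (cov-comm G F)))

-- To be applied with `f` the covariances of an occurrence at `v` with single letters, which vanish
-- off `v`.
∑Fin-image : {v : Fin k → Fin n} → Injective v → (g f : Fin n → ℚ) → (∀ i → (∀ r → v r ≢ i) → f i ≡ 0ℚ) →
  ∑Fin n (λ i → g i * f i) ≡ ∑Fin k (λ r → g (v r) * f (v r))
∑Fin-image {k} {n} {v} inj g f outside = begin
  ∑Fin n (λ i → g i * f i)
    ≡⟨ ∑-cong (allFin n) expand ⟩
  ∑Fin n (λ i → ∑Fin k (λ r → 𝟙 (v r Fin.≟ i) * (g i * f i)))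
    ≡⟨ ∑-swap (allFin n) (allFin k) (λ i r → 𝟙 (v r Fin.≟ i) * (g i * f i)) ⟩
  ∑Fin k (λ r → ∑Fin n (λ i → 𝟙 (v r Fin.≟ i) * (g i * f i)))
    ≡⟨ ∑-cong (allFin k) (λ r → ∑Fin-delta (v r) (λ i → g i * f i)) ⟩
  ∑Fin k (λ r → g (v r) * f (v r)) ∎
  where
  open ≡-Reasoning
  expand : ∀ i → g i * f i ≡ ∑Fin k (λ r → 𝟙 (v r Fin.≟ i) * (g i * f i))
  expand i with Fin.any? (λ r → v r Fin.≟ i)
  ... | yes (s , refl) = sym (trans
    (∑-cong (allFin k) (λ r → cong (_* (g (v s) * f (v s))) (𝟙-cong (v r Fin.≟ v s) (r Fin.≟ s) (inj r s) (cong v))))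
    (∑Fin-delta′ s (λ _ → g (v s) * f (v s))))
  ... | no ∄ = trans gf≡0 (sym (∑-zero (allFin k) (λ r → trans (cong (𝟙 (v r Fin.≟ i) *_) gf≡0) (ℚ.*-zeroʳ (𝟙 (v r Fin.≟ i))))))
    where
    gf≡0 : g i * f i ≡ 0ℚ
    gf≡0 = trans (cong (g i *_) (outside i (λ r e → ∄ (r , e)))) (ℚ.*-zeroʳ (g i))

-- Covariances of a pattern with small letters: given a small letter, the pattern occurs
-- mostly with this letter in the role of its minimum r₀.
module SmallLetters {n t : ℕ} {q : ℚ} (t≤n : t ℕ.≤ n) (q≤1 : q ≤ 1ℚ) (nq≡t : fromℕ n * q ≡ fromℕ t) where

  initialSmall : ℕ → Permutation′ n → ℚ
  initialSmall m σ = ∑Fin n (λ i → 𝟙 (toℕ i ℕ.<? m) * small t i σ)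

  cov-small-≤0 : (i j : Fin n) → i ≢ j → cov (small t i) (small t j) ≤ 0ℚ
  cov-small-≤0 i j i≢j = begin
    cov (small t i) (small t j)                            ≡⟨ cov-def (small t i) (small t j) ⟩
    𝔼 (λ σ → small t i σ * small t j σ) - 𝔼 (small t i) * 𝔼 (small t j)
                                                           ≡⟨ cong (λ e → 𝔼 (λ σ → small t i σ * small t j σ) - e) (cong₂ _*_ (𝔼-small t≤n q≤1 nq≡t i) (𝔼-small t≤n q≤1 nq≡t j)) ⟩
    𝔼 (λ σ → small t i σ * small t j σ) - q * q            ≤⟨ ℚ.+-monoˡ-≤ (- (q * q)) (𝔼-small-small t≤n q≤1 nq≡t i j i≢j) ⟩
    q * q - q * q                                          ≡⟨ ℚ.+-inverseʳ (q * q) ⟩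
    0ℚ                                                     ∎
    where open ℚ.≤-Reasoning

  cov-small-≤1 : (i : Fin n) → cov (small t i) (small t i) ≤ 1ℚ
  cov-small-≤1 i = begin
    cov (small t i) (small t i)                                          ≡⟨ cov-def (small t i) (small t i) ⟩
    𝔼 (λ σ → small t i σ * small t i σ) - 𝔼 (small t i) * 𝔼 (small t i)  ≤⟨ ℚ.+-mono-≤
      (𝔼-mono (λ σ → *-mono (0≤small t i σ) 0≤1 (𝟙≤1 (toℕ (σ ⟨$⟩ʳ i) ℕ.<? t)) (𝟙≤1 (toℕ (σ ⟨$⟩ʳ i) ℕ.<? t))))
      (ℚ.neg-antimono-≤ (square-nonNeg (𝔼 (small t i)))) ⟩
    𝔼 {n} (λ _ → 1ℚ) - 0ℚ                                                ≡⟨ cong (_- 0ℚ) (𝔼-const {n} 1ℚ) ⟩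
    1ℚ                                                                   ∎
    where open ℚ.≤-Reasoning

  cov-initialSmall : (F : Permutation′ n → ℚ) → ∀ m →
    cov F (initialSmall m) ≡ ∑Fin n (λ i → 𝟙 (toℕ i ℕ.<? m) * cov F (small t i))
  cov-initialSmall F m = trans
    (cov-∑ʳ (allFin n) F (λ i σ → 𝟙 (toℕ i ℕ.<? m) * small t i σ))
    (∑-cong (allFin n) (λ i → cov-*ʳ (𝟙 (toℕ i ℕ.<? m)) F (small t i)))

  -- Distinct letters are nonpositively correlated, so only the m diagonal terms count, and each is
  -- at most 1.
  variance-initialSmall : ∀ {m} → m ℕ.≤ n → cov (initialSmall m) (initialSmall m) ≤ fromℕ m
  variance-initialSmall {m} m≤n = begin
    cov (initialSmall m) (initialSmall m)
      ≡⟨ trans (cov-initialSmall (initialSmall m) m) (∑-cong (allFin n) (λ i → cong (g i *_)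
           (trans (cov-comm (initialSmall m) (small t i)) (cov-initialSmall (small t i) m)))) ⟩
    ∑Fin n (λ i → g i * ∑Fin n (λ j → g j * cov (small t i) (small t j)))
      ≤⟨ ∑-mono (allFin n) (λ i → *-monoˡ (g i) (0≤𝟙 (toℕ i ℕ.<? m)) (∑-mono (allFin n) (λ j → entry i j))) ⟩
    ∑Fin n (λ i → g i * ∑Fin n (λ j → 𝟙 (i Fin.≟ j) * 1ℚ))
      ≡⟨ ∑-cong (allFin n) (λ i → trans (cong (g i *_) (∑Fin-delta i (λ _ → 1ℚ))) (ℚ.*-identityʳ (g i))) ⟩
    ∑Fin n g
      ≡⟨ ∑Fin-<? m≤n ⟩
    fromℕ m ∎
    where
    open ℚ.≤-Reasoning
    g : Fin n → ℚ
    g i = 𝟙 (toℕ i ℕ.<? m)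
    entry : ∀ i j → g j * cov (small t i) (small t j) ≤ 𝟙 (i Fin.≟ j) * 1ℚ
    entry i j with i Fin.≟ j
    ... | yes refl = ℚ.≤-trans (*-monoˡ (g i) (0≤𝟙 (toℕ i ℕ.<? m)) (cov-small-≤1 i)) (*-monoʳ 1ℚ 0≤1 (𝟙≤1 (toℕ i ℕ.<? m)))
    ... | no i≢j   = ℚ.≤-trans (*-monoˡ (g j) (0≤𝟙 (toℕ j ℕ.<? m)) (cov-small-≤0 i j i≢j)) (ℚ.≤-reflexive (ℚ.*-zeroʳ (g j)))

  module _ (π : Permutation′ (suc k)) {v : Fin (suc k) → Fin n} (inj : Injective v) where

    private
      K = fromℕ (suc k)
      u = 1/ suc k !
      r₀ = π ⟨$⟩ˡ Fin.zero
      -- The joint expectation of an occurrence and the number of small letters in it (`∑e≡total`).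
      -- `B` bounds what falls to the letters other than the minimum, at most q² each.
      total = u * (K * q)
      B = K * (q * q)
      e : Fin (suc k) → ℚ
      e r = 𝔼 (λ σ → χ π v σ * small t (v r) σ)

      q²≥0 : 0ℚ ≤ q * q
      q²≥0 = square-nonNeg q

      B≥0 : 0ℚ ≤ B
      B≥0 = *-nonNeg (0≤fromℕ (suc k)) q²≥0

      q²≤B : q * q ≤ B
      q²≤B = ℚ.≤-trans (ℚ.≤-reflexive (sym (ℚ.*-identityˡ (q * q)))) (*-monoʳ (q * q) q²≥0 (fromℕ-mono-≤ {1} {suc k} (ℕ.s≤s ℕ.z≤n)))

      e≥0 : ∀ r → 0ℚ ≤ e r
      e≥0 r = 𝔼-nonNeg (λ σ → *-nonNeg (0≤χ π v σ) (0≤small t (v r) σ))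

      -- If the letter in role `r` of an occurrence is small, then so is its minimum: two given
      -- letters are small, an event of second order.
      e≤q² : ∀ r → r ≢ r₀ → e r ≤ q * q
      e≤q² r r≢r₀ = ℚ.≤-trans (𝔼-mono pointwise) (𝔼-small-small t≤n q≤1 nq≡t (v r) (v r₀) (r≢r₀ ∘ inj r r₀))
        where
        π₀<π : (π ⟨$⟩ʳ r₀) Fin.< (π ⟨$⟩ʳ r)
        π₀<π = ℕ.≤∧≢⇒< (subst (λ i → toℕ i ℕ.≤ toℕ (π ⟨$⟩ʳ r)) (sym (Perm.inverseʳ π)) ℕ.z≤n)
          (λ eq → r≢r₀ (sym (perm-injective π (Fin.toℕ-injective eq))))
        pointwise : ∀ σ → χ π v σ * small t (v r) σ ≤ small t (v r) σ * small t (v r₀) σ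
        pointwise σ = χ-mono-*
          (λ m → 𝟙-≤-* (toℕ (σ ⟨$⟩ʳ v r) ℕ.<? t) (toℕ (σ ⟨$⟩ʳ v r₀) ℕ.<? t) (ℕ.<-trans (Equivalence.to (m r₀ r) π₀<π)))
          (*-nonNeg (0≤small t (v r) σ) (0≤small t (v r₀) σ))

      -- The number `Z` of small letters at `v` is unchanged when these letters are permuted, hence
      -- independent of their pattern.
      ∑e≡total : ∑Fin (suc k) e ≡ total
      ∑e≡total = begin
        ∑Fin (suc k) e
          ≡⟨ 𝔼-∑ (allFin (suc k)) (λ r σ → χ π v σ * small t (v r) σ) ⟨
        𝔼 (λ σ → ∑Fin (suc k) (λ r → χ π v σ * small t (v r) σ))
          ≡⟨ 𝔼-cong (λ σ → ∑-*ˡ (allFin (suc k)) (χ π v σ) (λ r → small t (v r) σ)) ⟩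
        𝔼 (λ σ → χ π v σ * Z σ)
          ≡⟨ 𝔼-χ-* inj {Z} (λ {σ} {τ} e → ∑-cong (allFin (suc k)) (λ r → small-resp t (v r) {σ} {τ} e)) symmetric π ⟩
        u * 𝔼 Z
          ≡⟨ cong (u *_) (trans (𝔼-∑ (allFin (suc k)) (λ r → small t (v r))) (trans
               (∑-cong (allFin (suc k)) (λ r → 𝔼-small t≤n q≤1 nq≡t (v r)))
               (∑Fin-const (suc k) q))) ⟩
        total ∎
        where
        open ≡-Reasoning
        Z : Permutation′ n → ℚ
        Z σ = ∑Fin (suc k) (λ r → small t (v r) σ)
        symmetric : SymmetricOn v Z
        symmetric a b σ = trans
          (∑-cong (allFin (suc k)) (λ r → cong (λ i → small t i σ) (transpose-image inj a b r)))
          (∑Fin-permute (transpose a b) (λ r → small t (v r) σ))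

      e₀≤total : e r₀ ≤ total
      e₀≤total = begin
        e r₀                                           ≡⟨ ∑Fin-delta′ r₀ e ⟨
        ∑Fin (suc k) (λ r → 𝟙 (r Fin.≟ r₀) * e r)      ≤⟨ ∑-mono (allFin (suc k)) (λ r → ℚ.≤-trans
                                                            (*-monoʳ (e r) (e≥0 r) (𝟙≤1 (r Fin.≟ r₀))) (ℚ.≤-reflexive (ℚ.*-identityˡ (e r)))) ⟩
        ∑Fin (suc k) e                                 ≡⟨ ∑e≡total ⟩
        total                                          ∎
        where open ℚ.≤-Reasoning

      total≤e₀+B : total ≤ e r₀ + B
      total≤e₀+B = begin
        total                                                            ≡⟨ ∑e≡total ⟨
        ∑Fin (suc k) e                                                   ≤⟨ ∑-mono (allFin (suc k)) split ⟩
        ∑Fin (suc k) (λ r → 𝟙 (r Fin.≟ r₀) * e r + q * q)                ≡⟨ ∑-+ (allFin (suc k)) (λ r → 𝟙 (r Fin.≟ r₀) * e r) (λ _ → q * q) ⟩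
        ∑Fin (suc k) (λ r → 𝟙 (r Fin.≟ r₀) * e r) + ∑Fin (suc k) (λ _ → q * q) ≡⟨ cong₂ _+_ (∑Fin-delta′ r₀ e) (∑Fin-const (suc k) (q * q)) ⟩
        e r₀ + B                                                         ∎
        where
        open ℚ.≤-Reasoning
        split : ∀ r → e r ≤ 𝟙 (r Fin.≟ r₀) * e r + q * q
        split r with r Fin.≟ r₀
        ... | yes refl = ≤-by (q * q) q²≥0 (cong (_+ q * q) (sym (ℚ.*-identityˡ (e r))))
        ... | no r≢r₀  = ℚ.≤-trans (e≤q² r r≢r₀) (ℚ.≤-reflexive (sym (trans (cong (_+ q * q) (ℚ.*-zeroˡ (e r))) (ℚ.+-identityˡ (q * q)))))

      e-bounds : ∀ r → (e r ≤ total * 𝟙 (r Fin.≟ r₀) + B) × (total * 𝟙 (r Fin.≟ r₀) ≤ e r + B)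
      e-bounds r with r Fin.≟ r₀
      ... | yes refl =
          ℚ.≤-trans e₀≤total (≤-by B B≥0 (cong (_+ B) (sym (ℚ.*-identityʳ total))))
        , ℚ.≤-trans (ℚ.≤-reflexive (ℚ.*-identityʳ total)) total≤e₀+B
      ... | no r≢r₀ =
          ℚ.≤-trans (e≤q² r r≢r₀) (ℚ.≤-trans q²≤B (ℚ.≤-reflexive (sym (trans (cong (_+ B) (ℚ.*-zeroʳ total)) (ℚ.+-identityˡ B)))))
        , ℚ.≤-trans (ℚ.≤-reflexive (ℚ.*-zeroʳ total)) (+-nonNeg (e≥0 r) B≥0)

      cov≡ : ∀ i → cov (χ π v) (small t i) ≡ 𝔼 (λ σ → χ π v σ * small t i σ) - u * q
      cov≡ i = trans (cov-def (χ π v) (small t i))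
        (cong (λ x → 𝔼 (λ σ → χ π v σ * small t i σ) - x) (cong₂ _*_ (𝔼-χ inj π) (𝔼-small t≤n q≤1 nq≡t i)))

    -- Together with `cov-χ-small-≤` this determines the covariance up to `B`: it is u q (K - 1) for
    -- the minimum and -u q for every other letter.
    cov-χ-small-≥ : ∀ r → total * 𝟙 (r Fin.≟ r₀) + - (u * q + B) ≤ cov (χ π v) (small t (v r))
    cov-χ-small-≥ r = begin
      total * 𝟙 (r Fin.≟ r₀) + - (u * q + B)  ≤⟨ ℚ.+-monoˡ-≤ (- (u * q + B)) (proj₂ (e-bounds r)) ⟩
      e r + B + - (u * q + B)                 ≡⟨ S.solve 3 (λ e b x → e :+ b :+ (:- (x :+ b)) := e :- x) refl (e r) B (u * q) ⟩
      e r - u * q                             ≡⟨ cov≡ (v r) ⟨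
      cov (χ π v) (small t (v r))             ∎
      where open ℚ.≤-Reasoning

    cov-χ-small-≤ : ∀ r → - total * 𝟙 (r Fin.≟ r₀) + (u * q - B) ≤ - cov (χ π v) (small t (v r))
    cov-χ-small-≤ r = begin
      - total * 𝟙 (r Fin.≟ r₀) + (u * q - B)    ≡⟨ S.solve 4 (λ t d x b → (:- t) :* d :+ (x :- b) := (:- (t :* d :+ b)) :+ x) refl
                                                     total (𝟙 (r Fin.≟ r₀)) (u * q) B ⟩
      - (total * 𝟙 (r Fin.≟ r₀) + B) + u * q    ≤⟨ ℚ.+-monoˡ-≤ (u * q) (ℚ.neg-antimono-≤ (proj₁ (e-bounds r))) ⟩
      - e r + u * q                             ≡⟨ S.solve 2 (λ e x → (:- e) :+ x := :- (e :- x)) refl (e r) (u * q) ⟩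
      - (e r - u * q)                           ≡⟨ cong -_ (cov≡ (v r)) ⟨
      - cov (χ π v) (small t (v r))             ∎
      where open ℚ.≤-Reasoning

    -- A letter outside `v` is fixed by all transpositions inside `v`, hence independent of the
    -- pattern there.
    cov-χ-small-outside : ∀ i → (∀ r → v r ≢ i) → cov (χ π v) (small t i) ≡ 0ℚ
    cov-χ-small-outside i i∉v = begin
      cov (χ π v) (small t i)                       ≡⟨ cov≡ i ⟩
      𝔼 (λ σ → χ π v σ * small t i σ) - u * q       ≡⟨ cong (_- u * q) (𝔼-χ-* inj (λ {σ} {τ} → small-resp t i {σ} {τ}) fixed π) ⟩
      u * 𝔼 (small t i) - u * q                     ≡⟨ cong (λ x → u * x - u * q) (𝔼-small t≤n q≤1 nq≡t i) ⟩
      u * q - u * q                                 ≡⟨ ℚ.+-inverseʳ (u * q) ⟩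
      0ℚ                                            ∎
      where
      open ≡-Reasoning
      fixed : SymmetricOn v (small t i)
      fixed a b σ = cong (λ j → small t j σ) (transpose-other (λ e → i∉v a (sym e)) (λ e → i∉v b (sym e)))

    cov-χ-initialSmall : ∀ m → cov (χ π v) (initialSmall m) ≡ ∑Fin (suc k) (λ r → 𝟙 (toℕ (v r) ℕ.<? m) * cov (χ π v) (small t (v r)))
    cov-χ-initialSmall m = trans (cov-initialSmall (χ π v) m)
      (∑Fin-image inj (λ i → 𝟙 (toℕ i ℕ.<? m)) (λ i → cov (χ π v) (small t i)) cov-χ-small-outside)

-- Sums of weights over the letters in an initial window

windowWeight : ℕ → ℚ → (Fin k → ℚ) → Vec (Fin n) k → ℚ
windowWeight {k} m g w v = g + ∑Fin k (λ r → 𝟙 (toℕ (lookup v r) ℕ.<? m) * w r)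

windowWeight-zero : (g : ℚ) (w : Fin k → ℚ) (v : Vec (Fin n) k) → windowWeight 0 g w v ≡ g
windowWeight-zero {k} g w v = trans (cong (g +_) (∑-zero (allFin k) (λ r →
  trans (cong (_* w r) (𝟙-false (toℕ (lookup v r) ℕ.<? 0) (λ ()))) (ℚ.*-zeroˡ (w r))))) (ℚ.+-identityʳ g)

windowWeight-shift : ∀ m (g : ℚ) (w : Fin k → ℚ) (v : Vec (Fin n) k) → windowWeight (suc m) g w (shift v) ≡ windowWeight m g w v
windowWeight-shift {k} m g w v = cong (g +_) (∑-cong (allFin k) (λ r → cong (_* w r)
  (𝟙-cong (toℕ (lookup (shift v) r) ℕ.<? suc m) (toℕ (lookup v r) ℕ.<? m)
    (λ lt → ℕ.s≤s⁻¹ (subst (ℕ._< suc m) (toℕ-shift v r) lt))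
    (λ lt → subst (ℕ._< suc m) (sym (toℕ-shift v r)) (ℕ.s≤s lt)))))

windowWeight-zero∷ : ∀ m (g : ℚ) (w : Fin (suc k) → ℚ) (v : Vec (Fin n) k) →
  windowWeight (suc m) g w (zero∷ v) ≡ windowWeight m (g + w Fin.zero) (w ∘ Fin.suc) v
windowWeight-zero∷ {k} m g w v = begin
  g + ∑Fin (suc k) (λ r → 𝟙 (toℕ (lookup (zero∷ v) r) ℕ.<? suc m) * w r)
    ≡⟨ cong (g +_) (∑Fin-suc (λ r → 𝟙 (toℕ (lookup (zero∷ v) r) ℕ.<? suc m) * w r)) ⟩
  g + (𝟙 (0 ℕ.<? suc m) * w Fin.zero + rest)
    ≡⟨ cong (λ x → g + (x + rest)) (trans (cong (_* w Fin.zero) (𝟙-true (0 ℕ.<? suc m) (ℕ.s≤s ℕ.z≤n))) (ℚ.*-identityˡ (w Fin.zero))) ⟩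
  g + (w Fin.zero + rest)
    ≡⟨ ℚ.+-assoc g (w Fin.zero) rest ⟨
  windowWeight (suc m) (g + w Fin.zero) (w ∘ Fin.suc) (shift v)
    ≡⟨ windowWeight-shift m (g + w Fin.zero) (w ∘ Fin.suc) v ⟩
  windowWeight m (g + w Fin.zero) (w ∘ Fin.suc) v ∎
  where
  open ≡-Reasoning
  rest = ∑Fin k (λ r → 𝟙 (toℕ (lookup (shift v) r) ℕ.<? suc m) * w (Fin.suc r))

-- The total length is written `m ℕ.+ n`, so that stripping position 0 shortens the window and
-- leaves n alone. The number `g` accumulates the weights of the letters already placed.
windowSum : ℕ → ℚ → Vec Bool k → (Fin k → ℚ) → ℕ → ℚ
windowSum m g bs w n = ∑ (positions bs (m ℕ.+ n)) (windowWeight m g w)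

windowSum-[] : ∀ m g (w : Fin 0 → ℚ) n → windowSum m g [] w n ≡ g
windowSum-[] m g w n = trans (ℚ.+-identityʳ (g + 0ℚ)) (ℚ.+-identityʳ g)

windowSum-forced : ∀ m g (bs : Vec Bool k) (w : Fin (suc k) → ℚ) n →
  windowSum (suc m) g (true ∷ bs) w n ≡ windowSum m (g + w Fin.zero) bs (w ∘ Fin.suc) n
windowSum-forced m g bs w n = trans
  (∑-positions-forced {n = m ℕ.+ n} bs (windowWeight (suc m) g w))
  (∑-cong (positions bs (m ℕ.+ n)) (windowWeight-zero∷ m g w))

windowSum-free : ∀ m g (bs : Vec Bool k) (w : Fin (suc k) → ℚ) n →
  windowSum (suc m) g (false ∷ bs) w n ≡ windowSum m g (false ∷ bs) w n + windowSum m (g + w Fin.zero) bs (w ∘ Fin.suc) n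
windowSum-free m g bs w n = trans
  (∑-positions-free {n = m ℕ.+ n} bs (windowWeight (suc m) g w))
  (cong₂ _+_ (∑-cong (positions (false ∷ bs) (m ℕ.+ n)) (windowWeight-shift m g w))
             (∑-cong (positions bs (m ℕ.+ n)) (windowWeight-zero∷ m g w)))

-- The total weight of those of the first m letters that are forced to be adjacent.
leadSum : ℕ → Vec Bool k → (Fin k → ℚ) → ℚ
leadSum zero    bs           w = 0ℚ
leadSum (suc m) []           w = 0ℚ
leadSum (suc m) (false ∷ bs) w = 0ℚ
leadSum (suc m) (true ∷ bs)  w = w Fin.zero + leadSum m bs (w ∘ Fin.suc)

Degree-0 : ∀ p → Degree p 0ℚ (λ _ → 0ℚ)
Degree-0 zero    = constant 0 (λ _ _ → refl)
Degree-0 (suc p) = difference (Degree-resp (λ _ → refl) refl (Degree-0 p))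

∑-positions-const-degree : (bs : Vec Bool k) (g : ℚ) → Degree (free bs) g (λ n → ∑ (positions bs n) (λ _ → g))
∑-positions-const-degree []           g = constant 0 (λ _ _ → ℚ.+-identityʳ g)
∑-positions-const-degree (true ∷ bs)  g = Degree-step (λ n → ∑-positions-forced {n = n} bs (λ _ → g)) (∑-positions-const-degree bs g)
∑-positions-const-degree (false ∷ bs) g = Degree-sum (λ n → ∑-positions-free {n = n} bs (λ _ → g)) (∑-positions-const-degree bs g)

-- A free entry inside the window has boundedly many choices and loses a degree. In top degree only
-- the entries forced next to those already placed fall into the window.
windowSum-degree : ∀ m g (bs : Vec Bool k) (w : Fin k → ℚ) → Degree (free bs) (g + leadSum m bs w) (windowSum m g bs w)
windowSum-degree zero g bs w = Degree-resp
  (λ n → ∑-cong (positions bs n) (λ v → sym (windowWeight-zero g w v))) (sym (ℚ.+-identityʳ g))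
  (∑-positions-const-degree bs g)
windowSum-degree (suc m) g []           w = Degree-resp (λ n → sym (windowSum-[] (suc m) g w n)) (sym (ℚ.+-identityʳ g)) (constant 0 (λ _ _ → refl))
windowSum-degree (suc m) g (true ∷ bs)  w = Degree-resp
  (λ n → sym (windowSum-forced m g bs w n)) (ℚ.+-assoc g (w Fin.zero) (leadSum m bs (w ∘ Fin.suc)))
  (windowSum-degree m (g + w Fin.zero) bs (w ∘ Fin.suc))
windowSum-degree (suc m) g (false ∷ bs) w = Degree-resp
  (λ n → sym (windowSum-free m g bs w n)) (trans (ℚ.+-identityʳ _) (cong (g +_) (leadSum-false m)))
  (Degree-+ (windowSum-degree m g (false ∷ bs) w) (Degree-raise (windowSum-degree m (g + w Fin.zero) bs (w ∘ Fin.suc))))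
  where
  leadSum-false : ∀ m → leadSum m (false ∷ bs) w ≡ 0ℚ
  leadSum-false zero    = refl
  leadSum-false (suc m) = refl

-- The sum over the m starting points of the first block inside the window. A block that starts with
-- m′ window positions behind its first letter collects that letter and at most m′ forced ones.
windowLeading : ℕ → Vec Bool k → (Fin (suc k) → ℚ) → ℚ
windowLeading zero    bs w = 0ℚ
windowLeading (suc m) bs w = windowLeading m bs w + (w Fin.zero + leadSum m bs (w ∘ Fin.suc))

-- With g = 0 only vectors that meet the window contribute, which costs a degree.
windowSum₀-degree : ∀ m (bs : Vec Bool k) (w : Fin (suc k) → ℚ) → Degree (free bs) (windowLeading m bs w) (windowSum m 0ℚ (false ∷ bs) w)
windowSum₀-degree zero bs w = Degree-resp
  (λ n → sym (∑-zero (positions (false ∷ bs) n) (windowWeight-zero 0ℚ w))) refl (Degree-0 (free bs))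
windowSum₀-degree (suc m) bs w = Degree-resp
  (λ n → sym (windowSum-free m 0ℚ bs w n))
  (cong (λ x → windowLeading m bs w + (x + leadSum m bs (w ∘ Fin.suc))) (ℚ.+-identityˡ (w Fin.zero)))
  (Degree-+ (windowSum₀-degree m bs w) (windowSum-degree m (0ℚ + w Fin.zero) bs (w ∘ Fin.suc)))

lead : Vec Bool k → ℕ
lead []           = 0
lead (true ∷ bs)  = suc (lead bs)
lead (false ∷ bs) = 0

-- The first block has `suc (lead bs)` letters; a further free entry begins a second block and lies
-- outside it.
1+lead≤k : (bs : Vec Bool k) → 1 ℕ.≤ free bs → suc (lead bs) ℕ.≤ k
1+lead≤k (true ∷ bs)  h = ℕ.s≤s (1+lead≤k bs h)
1+lead≤k (false ∷ bs) h = ℕ.s≤s ℕ.z≤n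

blockSum : Vec Bool k → (Fin (suc k) → ℚ) → ℚ
blockSum bs w = w Fin.zero + leadSum (lead bs) bs (w ∘ Fin.suc)

leadSum-stable : (bs : Vec Bool k) (w : Fin k → ℚ) → ∀ m → lead bs ℕ.≤ m → leadSum m bs w ≡ leadSum (lead bs) bs w
leadSum-stable []           w zero    _           = refl
leadSum-stable []           w (suc m) _           = refl
leadSum-stable (false ∷ bs) w zero    _           = refl
leadSum-stable (false ∷ bs) w (suc m) _           = refl
leadSum-stable (true ∷ bs)  w (suc m) (ℕ.s≤s le) = cong (w Fin.zero +_) (leadSum-stable bs (w ∘ Fin.suc) m le)

-- All starting points but the last `lead bs` leave room for the entire first block, and each of
-- these contributes the same `blockSum`.
windowLeading-lead : (bs : Vec Bool k) (w : Fin (suc k) → ℚ) → ∀ i →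
  windowLeading (i ℕ.+ lead bs) bs w ≡ windowLeading (lead bs) bs w + fromℕ i * blockSum bs w
windowLeading-lead bs w zero    = sym (trans (cong (windowLeading (lead bs) bs w +_) (ℚ.*-zeroˡ (blockSum bs w))) (ℚ.+-identityʳ _))
windowLeading-lead bs w (suc i) = begin
  windowLeading (i ℕ.+ lead bs) bs w + (w Fin.zero + leadSum (i ℕ.+ lead bs) bs (w ∘ Fin.suc))
    ≡⟨ cong₂ _+_ (windowLeading-lead bs w i) (cong (w Fin.zero +_) (leadSum-stable bs (w ∘ Fin.suc) (i ℕ.+ lead bs) (ℕ.m≤n+m (lead bs) i))) ⟩
  κ + fromℕ i * s + s
    ≡⟨ S.solve 3 (λ κ i s → κ :+ i :* s :+ s := κ :+ (con 1ℚ :+ i) :* s) refl κ (fromℕ i) s ⟩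
  κ + (1ℚ + fromℕ i) * s
    ≡⟨ cong (λ x → κ + x * s) (fromℕ-suc i) ⟨
  κ + fromℕ (suc i) * s ∎
  where
  open ≡-Reasoning
  κ = windowLeading (lead bs) bs w
  s = blockSum bs w

leadSum-affine : (bs : Vec Bool k) (a b : ℚ) (δ : Fin k → ℚ) →
  leadSum (lead bs) bs (λ r → a * δ r + b) ≡ a * leadSum (lead bs) bs δ + fromℕ (lead bs) * b
leadSum-affine []           a b δ = S.solve 2 (λ a b → con 0ℚ := a :* con 0ℚ :+ con 0ℚ :* b) refl a b
leadSum-affine (false ∷ bs) a b δ = S.solve 2 (λ a b → con 0ℚ := a :* con 0ℚ :+ con 0ℚ :* b) refl a b
leadSum-affine (true ∷ bs)  a b δ = begin
  (a * δ₀ + b) + leadSum (lead bs) bs (λ r → a * δ (Fin.suc r) + b)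
    ≡⟨ cong (a * δ₀ + b +_) (leadSum-affine bs a b (δ ∘ Fin.suc)) ⟩
  (a * δ₀ + b) + (a * rest + fromℕ (lead bs) * b)
    ≡⟨ S.solve 5 (λ a b d r l → (a :* d :+ b) :+ (a :* r :+ l :* b) := a :* (d :+ r) :+ (con 1ℚ :+ l) :* b) refl a b δ₀ rest (fromℕ (lead bs)) ⟩
  a * (δ₀ + rest) + (1ℚ + fromℕ (lead bs)) * b
    ≡⟨ cong (λ l → a * (δ₀ + rest) + l * b) (fromℕ-suc (lead bs)) ⟨
  a * (δ₀ + rest) + fromℕ (suc (lead bs)) * b ∎
  where
  open ≡-Reasoning
  δ₀ = δ Fin.zero
  rest = leadSum (lead bs) bs (δ ∘ Fin.suc)

blockSum-affine : (bs : Vec Bool k) (a b : ℚ) (δ : Fin (suc k) → ℚ) →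
  blockSum bs (λ r → a * δ r + b) ≡ a * blockSum bs δ + fromℕ (suc (lead bs)) * b
blockSum-affine bs a b δ = leadSum-affine (true ∷ bs) a b δ

leadSum-zero : (bs : Vec Bool k) {w : Fin k → ℚ} → (∀ r → w r ≡ 0ℚ) → leadSum (lead bs) bs w ≡ 0ℚ
leadSum-zero []           w≡0 = refl
leadSum-zero (false ∷ bs) w≡0 = refl
leadSum-zero (true ∷ bs)  w≡0 = cong₂ _+_ (w≡0 Fin.zero) (leadSum-zero bs (w≡0 ∘ Fin.suc))

leadSum-resp : (bs : Vec Bool k) {w w′ : Fin k → ℚ} → (∀ r → w r ≡ w′ r) → leadSum (lead bs) bs w ≡ leadSum (lead bs) bs w′
leadSum-resp []           e = refl
leadSum-resp (false ∷ bs) e = refl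
leadSum-resp (true ∷ bs)  e = cong₂ _+_ (e Fin.zero) (leadSum-resp bs (e ∘ Fin.suc))

leadSum-indicator : (bs : Vec Bool k) (r₀ : Fin k) →
  (leadSum (lead bs) bs (λ r → 𝟙 (r Fin.≟ r₀)) ≡ 0ℚ) ⊎ (leadSum (lead bs) bs (λ r → 𝟙 (r Fin.≟ r₀)) ≡ 1ℚ)
leadSum-indicator (false ∷ bs) r₀           = inj₁ refl
leadSum-indicator (true ∷ bs)  Fin.zero     = inj₂ (cong (1ℚ +_) (leadSum-zero bs (λ r → refl)))
leadSum-indicator (true ∷ bs)  (Fin.suc r₀) with leadSum-indicator bs r₀
... | inj₁ e = inj₁ (cong (0ℚ +_) (trans (leadSum-resp bs (λ r → 𝟙-cong (Fin.suc r Fin.≟ Fin.suc r₀) (r Fin.≟ r₀) Fin.suc-injective (cong Fin.suc))) e))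
... | inj₂ e = inj₂ (cong (0ℚ +_) (trans (leadSum-resp bs (λ r → 𝟙-cong (Fin.suc r Fin.≟ Fin.suc r₀) (r Fin.≟ r₀) Fin.suc-injective (cong Fin.suc))) e))

blockSum-indicator : (bs : Vec Bool k) (r₀ : Fin (suc k)) →
  (blockSum bs (λ r → 𝟙 (r Fin.≟ r₀)) ≡ 0ℚ) ⊎ (blockSum bs (λ r → 𝟙 (r Fin.≟ r₀)) ≡ 1ℚ)
blockSum-indicator bs = leadSum-indicator (true ∷ bs)

^-distribʳ-* : ∀ m n o → (m ℕ.* n) ^ o ≡ m ^ o ℕ.* n ^ o
^-distribʳ-* m n zero    = refl
^-distribʳ-* m n (suc o) = trans (cong (m ℕ.* n ℕ.*_) (^-distribʳ-* m n o)) (ℕ.[m*n]*[o*p]≡[m*o]*[n*p] m n (m ^ o) (n ^ o))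

-- Test statistics T m, correlated with a sequence of variance V, force V to grow: the
-- correlation is of order m n^f, while the variance of the test statistic is at most m.
module _ (V : ℕ → ℚ) (T : ℕ → ℕ → ℚ) (κ : ℕ → ℚ) (f D ℓ : ℕ) (s : ℚ)
  (D≥1 : 1 ℕ.≤ D) (s>0 : 0ℚ < s)
  (T-degree : ∀ m → Degree (suc f) (κ m) (T m))
  (κ-linear : ∀ i → κ (i ℕ.+ ℓ) ≡ κ ℓ + fromℕ i * s)
  (correlated : ∀ m n t → m ℕ.+ n ≡ D ℕ.* t → ∀ x → 0ℚ ≤ x → x * T m n + x * T m n - x * x * fromℕ m ≤ V (m ℕ.+ n))
  where

  correlated⇒unbounded : ¬ BoundedBy (suc f ℕ.+ suc f) V
  correlated⇒unbounded (Kᵥ , Nᵥ , bound) = ≤⇒≯ upper lower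
    where
    iF = inv (fromℕ (suc f !))
    iF>0 : 0ℚ < iF
    iF>0 = inv-pos (0<fromℕ {{(suc f) ℕ.!≢0}})
    ⅛ : ℚ
    ⅛ = (ℤ.+ 1) ℚ./ 8
    -- With this unit the leading coefficient of `T w` is `c₀` + 8 `W` `θ`. At least 4 `W` `θ`
    -- survives the constant `c₀`, and 2 `W` `θ` survives the lower-order remainder (`T-large`).
    θ = ⅛ * (s * iF)
    θ>0 : 0ℚ < θ
    θ>0 = *-pos (ℚ.positive⁻¹ ⅛) (*-pos s>0 iF>0)
    c₀ = κ ℓ * iF
    -- The power of 2 accounts for w + N ≤ 2 N when the supposed bound at w + N is compared with a
    -- power of `N`.
    M = ∣ Kᵥ ∣ * fromℕ (2 ^ (suc f ℕ.+ suc f))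
    arch₁ = archimedean-* ∣ c₀ ∣ θ>0
    arch₂ = archimedean-* M (*-pos θ>0 θ>0)
    i₁ = proj₁ arch₁
    i₂ = proj₁ arch₂
    -- `i₁` absorbs the constant `c₀`, `i₂` outgrows the supposed bound, and `ℓ` gives w ≤ 2 i.
    i = suc (i₁ ℕ.+ i₂ ℕ.+ ℓ)
    w = i ℕ.+ ℓ
    leading = Degree⇒leading (T-degree w)
    Kₘ = proj₁ leading
    Nₘ = proj₁ (proj₂ (proj₂ leading))
    arch₃ = archimedean-* Kₘ θ>0
    j = proj₁ arch₃
    slack = suc (Nₘ ℕ.+ Nᵥ ℕ.+ j ℕ.+ w)
    t = slack ℕ.+ w
    -- The total length w + `N` has to be a multiple of `D`. `N` is fixed after the window, since
    -- `Kₘ` and `Nₘ` depend on `w`; `slack` makes it exceed all thresholds.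
    N = D ℕ.* t ∸ w
    t≤Dt : t ℕ.≤ D ℕ.* t
    t≤Dt = ℕ.m≤n*m t D {{ℕ.>-nonZero D≥1}}
    slack≤n : slack ℕ.≤ N
    slack≤n = ℕ.≤-trans (ℕ.≤-reflexive (sym (ℕ.m+n∸n≡m slack w))) (ℕ.∸-monoˡ-≤ w t≤Dt)
    m+n≡Dt : w ℕ.+ N ≡ D ℕ.* t
    m+n≡Dt = ℕ.m+[n∸m]≡n (ℕ.≤-trans (ℕ.m≤n+m w slack) t≤Dt)
    n≥Nₘ : Nₘ ℕ.≤ N
    n≥Nₘ = ℕ.≤-trans (ℕ.≤-trans (ℕ.m≤m+n Nₘ Nᵥ) (ℕ.≤-trans (ℕ.m≤m+n (Nₘ ℕ.+ Nᵥ) j) (ℕ.m≤m+n (Nₘ ℕ.+ Nᵥ ℕ.+ j) w))) (ℕ.≤-trans (ℕ.n≤1+n _) slack≤n)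
    n≥Nᵥ : Nᵥ ℕ.≤ N
    n≥Nᵥ = ℕ.≤-trans (ℕ.≤-trans (ℕ.m≤n+m Nᵥ Nₘ) (ℕ.≤-trans (ℕ.m≤m+n (Nₘ ℕ.+ Nᵥ) j) (ℕ.m≤m+n (Nₘ ℕ.+ Nᵥ ℕ.+ j) w))) (ℕ.≤-trans (ℕ.n≤1+n _) slack≤n)
    n≥j : j ℕ.≤ N
    n≥j = ℕ.≤-trans (ℕ.≤-trans (ℕ.m≤n+m j (Nₘ ℕ.+ Nᵥ)) (ℕ.m≤m+n (Nₘ ℕ.+ Nᵥ ℕ.+ j) w)) (ℕ.≤-trans (ℕ.n≤1+n _) slack≤n)
    n≥m : w ℕ.≤ N
    n≥m = ℕ.≤-trans (ℕ.m≤n+m w (Nₘ ℕ.+ Nᵥ ℕ.+ j)) (ℕ.≤-trans (ℕ.n≤1+n _) slack≤n)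
    n≥1 : 1 ℕ.≤ N
    n≥1 = ℕ.≤-trans (ℕ.s≤s ℕ.z≤n) slack≤n
    X = fromℕ (N ^ suc f)
    P≥0 : 0ℚ ≤ X
    P≥0 = 0≤fromℕ (N ^ suc f)
    P>0 : 0ℚ < X
    P>0 = 0<fromℕ {{ℕ.m^n≢0 N (suc f) {{ℕ.>-nonZero n≥1}}}}
    W = fromℕ i
    I≥0 : 0ℚ ≤ W
    I≥0 = 0≤fromℕ i
    θ≥0 = ℚ.<⇒≤ θ>0
    Iθ≥0 : 0ℚ ≤ W * θ
    Iθ≥0 = *-nonNeg I≥0 θ≥0

    i₁≤i : i₁ ℕ.≤ i
    i₁≤i = ℕ.≤-trans (ℕ.≤-trans (ℕ.m≤m+n i₁ i₂) (ℕ.m≤m+n (i₁ ℕ.+ i₂) ℓ)) (ℕ.n≤1+n _)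
    i₂≤i : i₂ ℕ.≤ i
    i₂≤i = ℕ.≤-trans (ℕ.≤-trans (ℕ.m≤n+m i₂ i₁) (ℕ.m≤m+n (i₁ ℕ.+ i₂) ℓ)) (ℕ.n≤1+n _)
    m≤i+i : w ℕ.≤ i ℕ.+ i
    m≤i+i = ℕ.+-monoʳ-≤ i (ℕ.≤-trans (ℕ.m≤n+m ℓ (i₁ ℕ.+ i₂)) (ℕ.n≤1+n _))

    coefficient : (W * θ + W * θ + W * θ + W * θ) ≤ κ w * iF
    coefficient = ≤-by (W * θ + W * θ + W * θ + (W * θ + c₀))
      (+-nonNeg (+-nonNeg (+-nonNeg Iθ≥0 Iθ≥0) Iθ≥0)
        (ℚ.≤-trans (0≤-diff (-p≤∣p∣ c₀)) (ℚ.≤-trans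
          (ℚ.≤-reflexive (S.solve 2 (λ a c → a :- (:- c) := a :+ c) refl ∣ c₀ ∣ c₀))
          (ℚ.+-monoˡ-≤ c₀ (ℚ.≤-trans (ℚ.<⇒≤ (proj₂ arch₁)) (*-monoʳ θ θ≥0 (fromℕ-mono-≤ i₁≤i)))))))
      (begin
        (W * θ + W * θ + W * θ + W * θ) + (W * θ + W * θ + W * θ + (W * θ + c₀))
          ≡⟨ S.solve 4 (λ i s f k → let θ = con ⅛ :* (s :* f) in
               (i :* θ :+ i :* θ :+ i :* θ :+ i :* θ) :+ (i :* θ :+ i :* θ :+ i :* θ :+ (i :* θ :+ k :* f)) := (k :+ i :* s) :* f) refl W s iF (κ ℓ) ⟩
        (κ ℓ + W * s) * iF   ≡⟨ cong (_* iF) (κ-linear i) ⟨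
        κ w * iF             ∎)
      where open ≡-Reasoning

    remainder : Kₘ * fromℕ (N ^ f) ≤ (W * θ + W * θ) * X
    remainder = begin
      Kₘ * fromℕ (N ^ f)            ≤⟨ *-monoʳ (fromℕ (N ^ f)) (0≤fromℕ (N ^ f)) (ℚ.≤-trans (ℚ.<⇒≤ (proj₂ arch₃)) (*-monoʳ θ θ≥0 (fromℕ-mono-≤ n≥j))) ⟩
      fromℕ N * θ * fromℕ (N ^ f)   ≡⟨ S.solve 3 (λ N θ p → N :* θ :* p := θ :* (N :* p)) refl (fromℕ N) θ (fromℕ (N ^ f)) ⟩
      θ * (fromℕ N * fromℕ (N ^ f)) ≡⟨ cong (θ *_) (fromℕ-* N (N ^ f)) ⟨
      θ * X                         ≤⟨ *-monoʳ X P≥0 (ℚ.≤-trans (ℚ.≤-reflexive (sym (ℚ.*-identityˡ θ)))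
                                         (ℚ.≤-trans (*-monoʳ θ θ≥0 (fromℕ-mono-≤ {1} {i} (ℕ.s≤s ℕ.z≤n))) (≤-by (W * θ) Iθ≥0 refl))) ⟩
      (W * θ + W * θ) * X           ∎
      where open ℚ.≤-Reasoning

    T-large : (W * θ + W * θ) * X ≤ T w N
    T-large = begin
      (W * θ + W * θ) * X
        ≡⟨ S.solve 2 (λ x p → (x :+ x) :* p := (x :+ x :+ x :+ x) :* p :- (x :+ x) :* p) refl (W * θ) X ⟩
      (W * θ + W * θ + W * θ + W * θ) * X - (W * θ + W * θ) * X
        ≤⟨ ℚ.+-mono-≤ (*-monoʳ X P≥0 coefficient) (ℚ.neg-antimono-≤ (ℚ.≤-trans (proj₂ (proj₂ (proj₂ leading)) N n≥Nₘ) remainder)) ⟩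
      κ w * iF * X - ∣ T w N - κ w * iF * X ∣
        ≤⟨ ℚ.+-monoʳ-≤ (κ w * iF * X) (ℚ.neg-antimono-≤ (-p≤∣p∣ (T w N - κ w * iF * X))) ⟩
      κ w * iF * X - - (T w N - κ w * iF * X)
        ≡⟨ S.solve 2 (λ c t → c :- (:- (t :- c)) := t) refl (κ w * iF * X) (T w N) ⟩
      T w N ∎
      where open ℚ.≤-Reasoning

    -- The best multiplier would be T/w. Here T ≥ 2 `W` `θ` `X` and w ≤ 2 `W`, so `x` is a lower
    -- bound for it, and the gain is still 2 `W` `θ`² `X`².
    x = θ * X
    x≥0 : 0ℚ ≤ x
    x≥0 = *-nonNeg θ≥0 P≥0

    upper : (W * (θ * θ) + W * (θ * θ)) * (X * X) ≤ M * (X * X)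
    upper = begin
      (W * (θ * θ) + W * (θ * θ)) * (X * X)
        ≡⟨ S.solve 3 (λ i t p → (i :* (t :* t) :+ i :* (t :* t)) :* (p :* p) :=
             (t :* p) :* ((i :* t :+ i :* t) :* p) :+ (t :* p) :* ((i :* t :+ i :* t) :* p) :- (t :* p) :* (t :* p) :* (i :+ i)) refl W θ X ⟩
      x * ((W * θ + W * θ) * X) + x * ((W * θ + W * θ) * X) - x * x * (W + W)
        ≤⟨ ℚ.+-mono-≤ (ℚ.+-mono-≤ (*-monoˡ x x≥0 T-large) (*-monoˡ x x≥0 T-large))
             (ℚ.neg-antimono-≤ (*-monoˡ (x * x) (square-nonNeg x) (ℚ.≤-trans (fromℕ-mono-≤ m≤i+i) (ℚ.≤-reflexive (fromℕ-+ i i))))) ⟩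
      x * T w N + x * T w N - x * x * fromℕ w
        ≤⟨ correlated w N t m+n≡Dt x x≥0 ⟩
      V (w ℕ.+ N)
        ≤⟨ bound (w ℕ.+ N) (ℕ.≤-trans n≥Nᵥ (ℕ.m≤n+m N w)) ⟩
      Kᵥ * fromℕ ((w ℕ.+ N) ^ d)
        ≤⟨ *-monoʳ (fromℕ ((w ℕ.+ N) ^ d)) (0≤fromℕ ((w ℕ.+ N) ^ d)) (p≤∣p∣ Kᵥ) ⟩
      ∣ Kᵥ ∣ * fromℕ ((w ℕ.+ N) ^ d)
        ≤⟨ *-monoˡ ∣ Kᵥ ∣ (ℚ.0≤∣p∣ Kᵥ) (fromℕ-mono-≤ (ℕ.^-monoˡ-≤ d (ℕ.≤-trans (ℕ.+-monoˡ-≤ N n≥m) (ℕ.≤-reflexive (cong (N ℕ.+_) (sym (ℕ.+-identityʳ N))))))) ⟩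
      ∣ Kᵥ ∣ * fromℕ ((2 ℕ.* N) ^ d)
        ≡⟨ cong (∣ Kᵥ ∣ *_) (trans (cong fromℕ (trans (^-distribʳ-* 2 N d) (cong (2 ^ d ℕ.*_) (ℕ.^-distribˡ-+-* N (suc f) (suc f)))))
             (trans (fromℕ-* (2 ^ d) (N ^ suc f ℕ.* N ^ suc f)) (cong (fromℕ (2 ^ d) *_) (fromℕ-* (N ^ suc f) (N ^ suc f))))) ⟩
      ∣ Kᵥ ∣ * (fromℕ (2 ^ d) * (X * X))
        ≡⟨ ℚ.*-assoc ∣ Kᵥ ∣ (fromℕ (2 ^ d)) (X * X) ⟨
      M * (X * X) ∎
      where
      open ℚ.≤-Reasoning
      d = suc f ℕ.+ suc f

    lower : M * (X * X) < (W * (θ * θ) + W * (θ * θ)) * (X * X)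
    lower = ℚ.*-monoˡ-<-pos (X * X) {{ℚ.positive (*-pos P>0 P>0)}} (ℚ.<-≤-trans (proj₂ arch₂) (ℚ.≤-trans
      (*-monoʳ (θ * θ) (square-nonNeg θ) (fromℕ-mono-≤ i₂≤i))
      (≤-by (W * (θ * θ)) (*-nonNeg I≥0 (square-nonNeg θ)) refl)))

-- At least two blocks

module TwoBlocks (π : Permutation′ (suc k)) (A : Subset k) (f : ℕ) (free-A : free A ≡ suc f) where

  private
    K = fromℕ (suc k)
    u = 1/ suc k !
    -- Chosen such that `K * B` is exactly half of `u * q`: even summed over all letters, the
    -- second-order error stays below the first-order term.
    D = 2 ℕ.* (suc k ℕ.* suc k) ℕ.* (suc k !)
    q = inv (fromℕ D)
    r₀ = π ⟨$⟩ˡ Fin.zero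
    δ : Fin (suc k) → ℚ
    δ r = 𝟙 (r Fin.≟ r₀)
    total = u * (K * q)
    B = K * (q * q)
    c = fromℕ (suc (lead A))

    D≥1 : 1 ℕ.≤ D
    D≥1 = ℕ.*-mono-≤ {1} {2 ℕ.* (suc k ℕ.* suc k)} (ℕ.s≤s ℕ.z≤n) (ℕ.>-nonZero⁻¹ (suc k !) {{(suc k) ℕ.!≢0}})

    0<D : 0ℚ < fromℕ D
    0<D = 0<fromℕ {{ℕ.>-nonZero D≥1}}

    Dq≡1 : fromℕ D * q ≡ 1ℚ
    Dq≡1 = inv-inverseʳ 0<D

    q>0 : 0ℚ < q
    q>0 = inv-pos 0<D

    q≤1 : q ≤ 1ℚ
    q≤1 = ℚ.≤-trans (ℚ.≤-reflexive (sym (ℚ.*-identityˡ q))) (ℚ.≤-trans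
      (*-monoʳ q (ℚ.<⇒≤ q>0) (fromℕ-mono-≤ D≥1)) (ℚ.≤-reflexive Dq≡1))

    nq≡t : ∀ {n t} → n ≡ D ℕ.* t → fromℕ n * q ≡ fromℕ t
    nq≡t {t = t} refl = begin
      fromℕ (D ℕ.* t) * q        ≡⟨ cong (_* q) (fromℕ-* D t) ⟩
      fromℕ D * fromℕ t * q      ≡⟨ S.solve 3 (λ d t q → d :* t :* q := t :* (d :* q)) refl (fromℕ D) (fromℕ t) q ⟩
      fromℕ t * (fromℕ D * q)    ≡⟨ cong (fromℕ t *_) Dq≡1 ⟩
      fromℕ t * 1ℚ               ≡⟨ ℚ.*-identityʳ (fromℕ t) ⟩
      fromℕ t                    ∎
      where open ≡-Reasoning

    uq>0 : 0ℚ < u * q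
    uq>0 = *-pos (0<1/n! (suc k)) q>0

    B≥0 : 0ℚ ≤ B
    B≥0 = *-nonNeg (0≤fromℕ (suc k)) (square-nonNeg q)

    K*B : K * B ≡ ½ * (u * q)
    K*B = begin
      K * (K * (q * q))                         ≡⟨ ℚ.*-identityʳ _ ⟨
      K * (K * (q * q)) * 1ℚ                    ≡⟨ cong (K * (K * (q * q)) *_) (n!*1/n!≡1 (suc k)) ⟨
      K * (K * (q * q)) * (fromℕ (suc k !) * u) ≡⟨ S.solve 4 (λ K q n u → K :* (K :* (q :* q)) :* (n :* u) :=
                                                     con ½ :* ((con (fromℕ 2) :* (K :* K) :* n) :* q :* (u :* q))) refl K q (fromℕ (suc k !)) u ⟩
      ½ * (fromℕ 2 * (K * K) * fromℕ (suc k !) * q * (u * q)) ≡⟨ cong (λ d → ½ * (d * q * (u * q))) D≡ ⟨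
      ½ * (fromℕ D * q * (u * q))               ≡⟨ cong (λ y → ½ * (y * (u * q))) Dq≡1 ⟩
      ½ * (1ℚ * (u * q))                        ≡⟨ cong (½ *_) (ℚ.*-identityˡ (u * q)) ⟩
      ½ * (u * q)                               ∎
      where
      open ≡-Reasoning
      D≡ : fromℕ D ≡ fromℕ 2 * (K * K) * fromℕ (suc k !)
      D≡ = trans (fromℕ-* (2 ℕ.* (suc k ℕ.* suc k)) (suc k !))
        (cong (_* fromℕ (suc k !)) (trans (fromℕ-* 2 (suc k ℕ.* suc k)) (cong (fromℕ 2 *_) (fromℕ-* (suc k) (suc k)))))

    1≤K : 1ℚ ≤ K
    1≤K = fromℕ-mono-≤ {1} {suc k} (ℕ.s≤s ℕ.z≤n)

    uq-B>0 : 0ℚ < u * q - B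
    uq-B>0 = ℚ.<-≤-trans (*-pos (ℚ.positive⁻¹ ½) uq>0) (ℚ.≤-trans
      (ℚ.≤-reflexive (trans (S.solve 1 (λ x → con ½ :* x := x :- con ½ :* x) refl (u * q)) (cong (λ y → u * q - y) (sym K*B))))
      (ℚ.+-monoʳ-≤ (u * q) (ℚ.neg-antimono-≤ (ℚ.≤-trans (ℚ.≤-reflexive (sym (ℚ.*-identityˡ B))) (*-monoʳ B B≥0 1≤K)))))

    uq-KB>0 : 0ℚ < u * q - K * B
    uq-KB>0 = ℚ.<-≤-trans (*-pos (ℚ.positive⁻¹ ½) uq>0)
      (ℚ.≤-reflexive (trans (S.solve 1 (λ x → con ½ :* x := x :- con ½ :* x) refl (u * q)) (cong (λ y → u * q - y) (sym K*B))))

    -- The second block supplies a letter outside the first.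
    c≤K-1 : c + 1ℚ ≤ K
    c≤K-1 = ℚ.≤-trans (ℚ.≤-reflexive (trans (ℚ.+-comm c 1ℚ) (sym (fromℕ-suc (suc (lead A))))))
      (fromℕ-mono-≤ (ℕ.s≤s (1+lead≤k A (subst (1 ℕ.≤_) (sym free-A) (ℕ.s≤s ℕ.z≤n)))))

    0<c : 0ℚ < c
    0<c = 0<fromℕ {suc (lead A)}

  -- Weights below the covariances, up to a global sign, with positive sum over the first block.
  record Weights : Set where
    field
      sign        : ℚ
      sign²       : sign * sign ≡ 1ℚ
      weight      : Fin (suc k) → ℚ
      weight-≤    : ∀ {n t} (t≤n : t ℕ.≤ n) (n≡Dt : n ≡ D ℕ.* t) {v : Fin (suc k) → Fin n} → Injective v →
                    ∀ r → weight r ≤ sign * cov (χ π v) (small t (v r))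
      positive    : 0ℚ < blockSum A weight

  -- If the minimum lies in the first block, the block sum is u q (K - c) - c B, at least u q - K B
  -- since c ≤ K - 1. If it lies elsewhere, all covariances of the block are negative; after a
  -- change of sign the sum is c (u q - B).
  weights : Weights
  weights with blockSum-indicator A r₀
  ... | inj₂ e = record
    { sign     = 1ℚ
    ; sign²    = refl
    ; weight   = λ r → total * δ r + - (u * q + B)
    ; weight-≤ = λ {n} {t} t≤n n≡Dt {v} inj r → ℚ.≤-trans
        (SmallLetters.cov-χ-small-≥ t≤n q≤1 (nq≡t n≡Dt) π inj r)
        (ℚ.≤-reflexive (sym (ℚ.*-identityˡ (cov (χ π v) (small t (v r))))))
    ; positive = subst (0ℚ <_) (sym (trans (blockSum-affine A total (- (u * q + B)) δ) (cong (λ y → total * y + c * - (u * q + B)) e)))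
        (ℚ.<-≤-trans uq-KB>0 (≤-by ((K - (c + 1ℚ)) * (u * q + B) + B)
          (+-nonNeg (*-nonNeg (0≤-diff c≤K-1) (+-nonNeg (ℚ.<⇒≤ uq>0) B≥0)) B≥0)
          (S.solve 5 (λ u q K c B → (u :* q :- K :* B) :+ ((K :- (c :+ con 1ℚ)) :* (u :* q :+ B) :+ B) :=
             (u :* (K :* q)) :* con 1ℚ :+ c :* (:- (u :* q :+ B))) refl u q K c B)))
    }
  ... | inj₁ e = record
    { sign     = - 1ℚ
    ; sign²    = refl
    ; weight   = λ r → - total * δ r + (u * q - B)
    ; weight-≤ = λ {n} {t} t≤n n≡Dt {v} inj r → ℚ.≤-trans
        (SmallLetters.cov-χ-small-≤ t≤n q≤1 (nq≡t n≡Dt) π inj r)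
        (ℚ.≤-reflexive (S.solve 1 (λ y → :- y := (:- con 1ℚ) :* y) refl (cov (χ π v) (small t (v r)))))
    ; positive = subst (0ℚ <_) (sym (trans (blockSum-affine A (- total) (u * q - B) δ)
          (trans (cong (λ y → - total * y + c * (u * q - B)) e) (S.solve 2 (λ t y → (:- t) :* con 0ℚ :+ y := y) refl total (c * (u * q - B))))))
        (*-pos 0<c uq-B>0)
    }

  open Weights weights

  module _ {n t : ℕ} (t≤n : t ℕ.≤ n) (n≡Dt : n ≡ D ℕ.* t) where

    open SmallLetters t≤n q≤1 (nq≡t n≡Dt)

    windowWeight-≤ : ∀ m (v : Vec (Fin n) (suc k)) → InjectiveVec v →
      windowWeight m 0ℚ weight v ≤ sign * cov (χ π (lookup v)) (initialSmall m)
    windowWeight-≤ m v v-inj = begin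
      0ℚ + ∑Fin (suc k) (λ r → g r * weight r)
        ≡⟨ ℚ.+-identityˡ _ ⟩
      ∑Fin (suc k) (λ r → g r * weight r)
        ≤⟨ ∑-mono (allFin (suc k)) (λ r → ℚ.≤-trans (*-monoˡ (g r) (0≤𝟙 (toℕ (lookup v r) ℕ.<? m)) (weight-≤ t≤n n≡Dt v-inj r))
             (ℚ.≤-reflexive (S.solve 3 (λ g s c → g :* (s :* c) := s :* (g :* c)) refl (g r) sign (cov (χ π (lookup v)) (small t (lookup v r)))))) ⟩
      ∑Fin (suc k) (λ r → sign * (g r * cov (χ π (lookup v)) (small t (lookup v r))))
        ≡⟨ ∑-*ˡ (allFin (suc k)) sign (λ r → g r * cov (χ π (lookup v)) (small t (lookup v r))) ⟩
      sign * ∑Fin (suc k) (λ r → g r * cov (χ π (lookup v)) (small t (lookup v r)))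
        ≡⟨ cong (sign *_) (cov-χ-initialSmall π v-inj m) ⟨
      sign * cov (χ π (lookup v)) (initialSmall m) ∎
      where
      open ℚ.≤-Reasoning
      g : Fin (suc k) → ℚ
      g r = 𝟙 (toℕ (lookup v r) ℕ.<? m)

    ∑-windowWeight-≤ : ∀ m → ∑ (positions (false ∷ A) n) (windowWeight m 0ℚ weight) ≤ sign * cov (count π A) (initialSmall m)
    ∑-windowWeight-≤ m = begin
      ∑ (positions (false ∷ A) n) (windowWeight m 0ℚ weight)
        ≤⟨ ∑-mono-All (positions-injective (false ∷ A) n) (windowWeight-≤ m) ⟩
      ∑ (positions (false ∷ A) n) (λ v → sign * cov (χ π (lookup v)) (initialSmall m))
        ≡⟨ ∑-*ˡ (positions (false ∷ A) n) sign (λ v → cov (χ π (lookup v)) (initialSmall m)) ⟩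
      sign * ∑ (positions (false ∷ A) n) (λ v → cov (χ π (lookup v)) (initialSmall m))
        ≡⟨ cong (sign *_) (cov-∑ˡ (positions (false ∷ A) n) (λ v → χ π (lookup v)) (initialSmall m)) ⟨
      sign * cov (count π A) (initialSmall m) ∎
      where open ℚ.≤-Reasoning

    -- Cauchy-Schwarz with the multiplier `sign * x`: the linear term takes up the sign, and the
    -- quadratic one does not see it because of `sign²`.
    variance-≥ : ∀ {m} → m ℕ.≤ n → ∀ x → 0ℚ ≤ x → let T = ∑ (positions (false ∷ A) n) (windowWeight m 0ℚ weight) in
      x * T + x * T - x * x * fromℕ m ≤ Var {n} (occurrences π A)
    variance-≥ {m} m≤n x x≥0 = begin
      x * T + x * T - x * x * fromℕ m
        ≤⟨ ℚ.+-mono-≤ (ℚ.+-mono-≤ (*-monoˡ x x≥0 (∑-windowWeight-≤ m)) (*-monoˡ x x≥0 (∑-windowWeight-≤ m)))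
             (ℚ.neg-antimono-≤ (*-monoˡ (x * x) (square-nonNeg x) (variance-initialSmall m≤n))) ⟩
      x * (sign * C) + x * (sign * C) - x * x * Y
        ≡⟨ cong (λ y → x * (sign * C) + x * (sign * C) - y * Y) (trans (sym (ℚ.*-identityˡ (x * x))) (cong (_* (x * x)) (sym sign²))) ⟩
      x * (sign * C) + x * (sign * C) - sign * sign * (x * x) * Y
        ≡⟨ S.solve 4 (λ x s c y → x :* (s :* c) :+ x :* (s :* c) :- s :* s :* (x :* x) :* y :=
             (s :* x) :* c :+ (s :* x) :* c :- (s :* x) :* (s :* x) :* y) refl x sign C Y ⟩
      sign * x * C + sign * x * C - sign * x * (sign * x) * Y
        ≤⟨ cauchy-schwarz (count π A) (initialSmall m) (sign * x) ⟩
      cov (count π A) (count π A)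
        ≡⟨ Var≡cov π A n ⟨
      Var {n} (occurrences π A) ∎
      where
      open ℚ.≤-Reasoning
      T = ∑ (positions (false ∷ A) n) (windowWeight m 0ℚ weight)
      C = cov (count π A) (initialSmall m)
      Y = cov (initialSmall m) (initialSmall m)

  unbounded : ¬ BoundedBy (suc f ℕ.+ suc f) (λ n → Var {n} (occurrences π A))
  unbounded = correlated⇒unbounded (λ n → Var {n} (occurrences π A)) (λ m → windowSum m 0ℚ (false ∷ A) weight)
    (λ m → windowLeading m A weight) f D (lead A) (blockSum A weight) D≥1 positive
    (λ m → Degree-subst free-A (windowSum₀-degree m A weight))
    (windowLeading-lead A weight)
    (λ m n t m+n≡Dt x x≥0 → variance-≥
      (ℕ.≤-trans (ℕ.m≤n*m t D {{ℕ.>-nonZero D≥1}}) (ℕ.≤-reflexive (sym m+n≡Dt))) m+n≡Dt (ℕ.m≤m+n m n) x x≥0)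

-- Lower bound for all patterns and the conclusion

single-block-unbounded : 1 ℕ.≤ k → (π : Permutation′ (suc k)) (A : Subset k) → free A ≡ 0 →
  ¬ BoundedBy 0 (λ n → Var {n} (occurrences π A))
single-block-unbounded _ π (true ∷ [])      e = consecutive-unbounded-short π
single-block-unbounded _ π A@(true ∷ _ ∷ _) e = consecutive-unbounded-long π A e (ℕ.s≤s (ℕ.s≤s ℕ.z≤n))

Var-unbounded : 1 ℕ.≤ k → (π : Permutation′ (suc k)) (A : Subset k) →
  ¬ BoundedBy (free A ℕ.+ free A) (λ n → Var {n} (occurrences π A))
Var-unbounded k≥1 π A = go (free A) refl
  where
  go : ∀ f → free A ≡ f → ¬ BoundedBy (free A ℕ.+ free A) (λ n → Var {n} (occurrences π A))
  go zero    e = subst (λ f → ¬ BoundedBy (f ℕ.+ f) (λ n → Var {n} (occurrences π A))) (sym e) (single-block-unbounded k≥1 π A e)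
  go (suc f) e = subst (λ f → ¬ BoundedBy (f ℕ.+ f) (λ n → Var {n} (occurrences π A))) (sym e) (TwoBlocks.unbounded π A f e)

theorem4p1 : ∀ (k : ℕ) → 2 ℕ.≤ k → (π : Permutation′ k) (A : Subset (pred k)) →
  let p = 2 ℕ.* blocks k A ∸ 1 in
  Σ[ C ∈ ℝ ] Σ[ C>0 ∈ 0ℝ <ℝ C ]
    (λ n → fromℚ (Var {n} (occurrences π A))
             ÷ℝ (C *ℝ pow n p) ⟨ *ℝ-pos C (pow n p) C>0 (pow-pos n p) ⟩)
    ⟶ 1ℝ
theorem4p1 (suc k) (ℕ.s≤s k≥1) π A = subst (AsymptoticTo (λ n → Var {n} (occurrences π A))) (sym (exponent A))
  (unbounded⇒AsymptoticTo (proj₂ (Var-degree π A)) (Var-unbounded k≥1 π A))
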